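{- Let $(\mathcal{E},\mathcal{S})$ be a category with small maps. Then an exact completion $\mathbf{y}:(\mathcal{E},\mathcal{S})\to(\overline{\mathcal{E}},\overline{\mathcal{S}})$ of $(\mathcal{E},\mathcal{S})$ exists. Moreover, besides being a morphism of categories with small maps, $\mathbf{y}$ has the following properties: (1) $\mathbf{y}$ is full and faithful; (2) $\mathbf{y}$ is covering: for every object $X$ of $\overline{\mathcal{E}}$ there are an object $Y$ of $\mathcal{E}$ and a cover $\mathbf{y}Y\to X$; (3) for every object $X$ of $\mathcal{E}$, $\mathbf{y}$ induces a bijection between the subobjects of $X$ in $\mathcal{E}$ and the subobjects of $\mathbf{y}X$ in $\overline{\mathcal{E}}$; (4) a morphism $f$ of $\overline{\mathcal{E}}$ belongs to $\overline{\mathcal{S}}$ if and only if $f$ is covered by a morphism of the form $\mathbf{y}f'$ with $f'\in\mathcal{S}$.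
   Context: A cover is a morphism $f$ such that whenever $f=m\circ g$ with $m$ a monomorphism, $m$ is an isomorphism. A positive Heyting category is a category with finite limits in which every morphism factors as a cover followed by a monomorphism, covers are stable under pullback, finite coproducts exist and are disjoint and stable under pullback, and for every morphism $f:Y\to X$ the pullback map $f^*:\mathrm{Sub}(X)\to\mathrm{Sub}(Y)$ has a right adjoint $\forall_f$. A commutative square with top $A\to B$, left $f:A\to C$, right $g:B\to D$ and bottom $p:C\to D$ is a covering square if $p$ is a cover and the induced map $A\to C\times_D B$ is a cover; then $f$ is said to cover $g$. A class of small maps in a positive Heyting category $\mathcal{E}$ is a class $\mathcal{S}$ of morphisms satisfying: (A1) pullbacks of maps in $\mathcal{S}$ along arbitrary maps are in $\mathcal{S}$; (A2) if the pullback of $f$ along a cover is in $\mathcal{S}$ then $f\in\mathcal{S}$; (A3) if $X\to Y$ and $X'\to Y'$ are in $\mathcal{S}$ so is $X+X'\to Y+Y'$; (A4) $0\to1$, $1\to1$, $1+1\to1$ are in $\mathcal{S}$; (A5) $\mathcal{S}$ is closed under composition; (A6) if $h=g\circ f$ with $f$ a cover and $h\in\mathcal{S}$ then $g\in\mathcal{S}$; (A7) (Collection) for any cover $p:Y\to X$ and $f:X\to A$ in $\mathcal{S}$ there is a covering square with left side $g:Z\to B$ in $\mathcal{S}$, top $Z\to X$ factoring through $p$, right side $f$ and bottom a cover $B\to A$; (A8) for $f:Y\to X$ in $\mathcal{S}$, $\forall_f$ sends bounded subobjects to bounded subobjects (a subobject is bounded if represented by a mono in $\mathcal{S}$); (A9)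 all diagonals $X\to X\times X$ are in $\mathcal{S}$. A category with small maps is a pair $(\mathcal{E},\mathcal{S})$ of a positive Heyting category and a class of small maps; a morphism $F:(\mathcal{E},\mathcal{S})\to(\mathcal{F},\mathcal{T})$ is a functor preserving finite limits, covers, finite coproducts, finite unions of subobjects and the $\forall_f$, and sending maps in $\mathcal{S}$ to maps in $\mathcal{T}$. An equivalence relation $R\subseteq X\times X$ is bounded if $R\to X\times X$ is in $\mathcal{S}$. A quotient of it is a map $q:X\to Q$ such that $R\rightrightarrows X\to Q$ is both a pullback (kernel pair) and a coequaliser, and remains so after pulling back along any map $P\to Q$. $(\mathcal{E},\mathcal{S})$ is (bounded) exact if every bounded equivalence relation has a quotient. An exact completion of $(\mathcal{E},\mathcal{S})$ is an exact category with small maps $(\overline{\mathcal{E}},\overline{\mathcal{S}})$ together with a morphism $\mathbf{y}:(\mathcal{E},\mathcal{S})\to(\overline{\mathcal{E}},\overline{\mathcal{S}})$ such that for every exact category with small maps $(\mathcal{F},\mathcal{T})$, precomposition with $\mathbf{y}$ induces an equivalence between morphisms $(\overline{\mathcal{E}},\overline{\mathcal{S}})\to(\mathcal{F},\mathcal{T})$ and morphisms $(\mathcal{E},\mathcal{S})\to(\mathcal{F},\mathcal{T})$. -}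

module Defs where

open import Level using (Level; _⊔_; suc; Setω)
open import Data.Product using (Σ; _×_; _,_; proj₁; proj₂)
open import Relation.Binary using (Rel; IsEquivalence)

record Category (o ℓ e : Level) : Set (suc (o ⊔ ℓ ⊔ e)) where
  infixr 9 _∘_
  infix 4 _≈_
  infix 5 _⇒_
  field
    Obj : Set o
    _⇒_ : Obj → Obj → Set ℓ
    _≈_ : ∀ {A B} → Rel (A ⇒ B) e
    id : ∀ {A} → A ⇒ A
    _∘_ : ∀ {A B C} → B ⇒ C → A ⇒ B → A ⇒ C
    equiv : ∀ {A B} → IsEquivalence (_≈_ {A} {B})
    ∘-resp-≈ : ∀ {A B C} {f h : B ⇒ C} {g i : A ⇒ B} → f ≈ h → g ≈ i → f ∘ g ≈ h ∘ i
    assoc : ∀ {A B C D} {f : A ⇒ B} {g : B ⇒ C} {h : C ⇒ D} → (h ∘ g) ∘ f ≈ h ∘ (g ∘ f)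
    identityˡ : ∀ {A B} {f : A ⇒ B} → id ∘ f ≈ f
    identityʳ : ∀ {A B} {f : A ⇒ B} → f ∘ id ≈ f

module Notions {o ℓ e : Level} (C : Category o ℓ e) where
  open Category C

  private
    L : Level
    L = o ⊔ ℓ ⊔ e

  Mono : ∀ {A B} → A ⇒ B → Set L
  Mono {A} f = ∀ {Z} (g h : Z ⇒ A) → f ∘ g ≈ f ∘ h → g ≈ h

  JointlyMonic : ∀ {R X} → R ⇒ X → R ⇒ X → Set L
  JointlyMonic {R} r₁ r₂ = ∀ {Z} (g h : Z ⇒ R) → r₁ ∘ g ≈ r₁ ∘ h → r₂ ∘ g ≈ r₂ ∘ h → g ≈ h

  IsIso : ∀ {A B} → A ⇒ B → Set (ℓ ⊔ e)
  IsIso {A} {B} f = Σ (B ⇒ A) λ g → (g ∘ f ≈ id) × (f ∘ g ≈ id)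

  Cover : ∀ {A B} → A ⇒ B → Set L
  Cover {A} {B} f = ∀ {M} (m : M ⇒ B) (g : A ⇒ M) → Mono m → f ≈ m ∘ g → IsIso m

  IsTerminal : Obj → Set L
  IsTerminal T = ∀ X → Σ (X ⇒ T) λ h → ∀ (h' : X ⇒ T) → h' ≈ h

  IsInitial : Obj → Set L
  IsInitial I = ∀ X → Σ (I ⇒ X) λ h → ∀ (h' : I ⇒ X) → h' ≈ h

  IsPullback : ∀ {P A B D} → P ⇒ A → P ⇒ B → A ⇒ D → B ⇒ D → Set L
  IsPullback {P} {A} {B} p q f g =
    (f ∘ p ≈ g ∘ q) ×
    (∀ {Z} (a : Z ⇒ A) (b : Z ⇒ B) → f ∘ a ≈ g ∘ b →
       Σ (Z ⇒ P) λ u → (p ∘ u ≈ a) × (q ∘ u ≈ b) ×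
         (∀ (u' : Z ⇒ P) → p ∘ u' ≈ a → q ∘ u' ≈ b → u' ≈ u))

  IsProduct : ∀ {P A B} → P ⇒ A → P ⇒ B → Set L
  IsProduct {P} {A} {B} π₁ π₂ =
    ∀ {Z} (a : Z ⇒ A) (b : Z ⇒ B) →
      Σ (Z ⇒ P) λ u → (π₁ ∘ u ≈ a) × (π₂ ∘ u ≈ b) ×
        (∀ (u' : Z ⇒ P) → π₁ ∘ u' ≈ a → π₂ ∘ u' ≈ b → u' ≈ u)

  IsCoproduct : ∀ {S A B} → A ⇒ S → B ⇒ S → Set L
  IsCoproduct {S} {A} {B} i₁ i₂ =
    ∀ {Z} (a : A ⇒ Z) (b : B ⇒ Z) →
      Σ (S ⇒ Z) λ u → (u ∘ i₁ ≈ a) × (u ∘ i₂ ≈ b) ×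
        (∀ (u' : S ⇒ Z) → u' ∘ i₁ ≈ a → u' ∘ i₂ ≈ b → u' ≈ u)

  IsCoequalizer : ∀ {R X Q} → R ⇒ X → R ⇒ X → X ⇒ Q → Set L
  IsCoequalizer {R} {X} {Q} r₁ r₂ q =
    (q ∘ r₁ ≈ q ∘ r₂) ×
    (∀ {Z} (h : X ⇒ Z) → h ∘ r₁ ≈ h ∘ r₂ →
       Σ (Q ⇒ Z) λ u → (u ∘ q ≈ h) × (∀ (u' : Q ⇒ Z) → u' ∘ q ≈ h → u' ≈ u))

  IsCoveringSquare : ∀ {A B C' D} → A ⇒ B → A ⇒ C' → B ⇒ D → C' ⇒ D → Set L
  IsCoveringSquare {A} {B} {C'} {D} t f g p =
    (g ∘ t ≈ p ∘ f) × Cover p ×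
    (∀ {P} (π₁ : P ⇒ C') (π₂ : P ⇒ B) → IsPullback π₁ π₂ p g →
       ∀ (u : A ⇒ P) → π₁ ∘ u ≈ f → π₂ ∘ u ≈ t → Cover u)

  _≤ₛ_ : ∀ {M N X} → M ⇒ X → N ⇒ X → Set (ℓ ⊔ e)
  _≤ₛ_ {M} {N} m n = Σ (M ⇒ N) λ k → n ∘ k ≈ m

  IsUnion : ∀ {M N U X} → M ⇒ X → N ⇒ X → U ⇒ X → Set L
  IsUnion {X = X} m n u =
    Mono u × (m ≤ₛ u) × (n ≤ₛ u) ×
    (∀ {W} (w : W ⇒ X) → Mono w → m ≤ₛ w → n ≤ₛ w → u ≤ₛ w)

  IsLeastSub : ∀ {B X} → B ⇒ X → Set L
  IsLeastSub {X = X} b = Mono b × (∀ {W} (w : W ⇒ X) → Mono w → b ≤ₛ w)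

  IsForall : ∀ {Y X M A} → Y ⇒ X → M ⇒ Y → A ⇒ X → Set L
  IsForall {Y} {X} f m a =
    Mono a ×
    (∀ {N P} (n : N ⇒ X) (n' : P ⇒ Y) (k : P ⇒ N) → Mono n → IsPullback n' k f n →
       ((n' ≤ₛ m) → (n ≤ₛ a)) × ((n ≤ₛ a) → (n' ≤ₛ m)))

  IsEquivRel : ∀ {R X} → R ⇒ X → R ⇒ X → Set L
  IsEquivRel {R} {X} r₁ r₂ =
    JointlyMonic r₁ r₂ ×
    (Σ (X ⇒ R) λ ρ → (r₁ ∘ ρ ≈ id) × (r₂ ∘ ρ ≈ id)) ×
    (Σ (R ⇒ R) λ σ → (r₁ ∘ σ ≈ r₂) × (r₂ ∘ σ ≈ r₁)) ×
    (∀ {T} (t₁ t₂ : T ⇒ R) → IsPullback t₁ t₂ r₂ r₁ →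
       Σ (T ⇒ R) λ τ → (r₁ ∘ τ ≈ r₁ ∘ t₁) × (r₂ ∘ τ ≈ r₂ ∘ t₂))

  -- q : X ⇒ Q is a quotient of the relation r₁ , r₂ : R ⇒ X:
  -- R is the kernel pair of q, q is the coequaliser of R, and this is stable:
  -- for every h : P ⇒ Q, the pullback q' of q along h is the coequaliser of
  -- its kernel pair (which is the pullback of R).
  IsQuotient : ∀ {R X Q} → R ⇒ X → R ⇒ X → X ⇒ Q → Set L
  IsQuotient {R} {X} {Q} r₁ r₂ q =
    IsPullback r₁ r₂ q q × IsCoequalizer r₁ r₂ q ×
    (∀ {P X'} (h : P ⇒ Q) (q' : X' ⇒ P) (h' : X' ⇒ X) → IsPullback q' h' h q →
       ∀ {R'} (a b : R' ⇒ X') → IsPullback a b q' q' → IsCoequalizer a b q')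

record IsPositiveHeyting {o ℓ e : Level} (C : Category o ℓ e) : Set (suc (o ⊔ ℓ ⊔ e)) where
  open Category C
  open Notions C
  field
    terminal : Σ Obj IsTerminal
    pullback : ∀ {A B D} (f : A ⇒ D) (g : B ⇒ D) →
      Σ Obj λ P → Σ (P ⇒ A) λ p → Σ (P ⇒ B) λ q → IsPullback p q f g
    factor : ∀ {A B} (f : A ⇒ B) →
      Σ Obj λ M → Σ (A ⇒ M) λ c → Σ (M ⇒ B) λ m → Cover c × Mono m × (f ≈ m ∘ c)
    cover-stable : ∀ {P A B D} {p : P ⇒ A} {q : P ⇒ B} {f : A ⇒ D} {g : B ⇒ D} →
      IsPullback p q f g → Cover f → Cover q
    initial : Σ Obj IsInitial
    coproduct : ∀ A B → Σ Obj λ S → Σ (A ⇒ S) λ i₁ → Σ (B ⇒ S) λ i₂ → IsCoproduct i₁ i₂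
    disjoint : ∀ {S A B} {i₁ : A ⇒ S} {i₂ : B ⇒ S} → IsCoproduct i₁ i₂ →
      Mono i₁ × Mono i₂ × (∀ {P} (p : P ⇒ A) (q : P ⇒ B) → IsPullback p q i₁ i₂ → IsInitial P)
    coproduct-stable : ∀ {S A B} {i₁ : A ⇒ S} {i₂ : B ⇒ S} → IsCoproduct i₁ i₂ →
      ∀ {Y P₁ P₂} (f : Y ⇒ S) (p₁ : P₁ ⇒ A) (j₁ : P₁ ⇒ Y) (p₂ : P₂ ⇒ B) (j₂ : P₂ ⇒ Y) →
      IsPullback p₁ j₁ i₁ f → IsPullback p₂ j₂ i₂ f → IsCoproduct j₁ j₂
    initial-stable : ∀ {I Y} → IsInitial I → Y ⇒ I → IsInitial Y
    forall-exists : ∀ {Y X M} (f : Y ⇒ X) (m : M ⇒ Y) → Mono m →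
      Σ Obj λ A → Σ (A ⇒ X) λ a → IsForall f m a

record IsSmallMaps {o ℓ e s : Level} (C : Category o ℓ e)
                   (S : ∀ {A B} → Category._⇒_ C A B → Set s) : Set (o ⊔ ℓ ⊔ e ⊔ s) where
  open Category C
  open Notions C
  field
    S-resp-≈ : ∀ {A B} {f g : A ⇒ B} → f ≈ g → S f → S g
    A1 : ∀ {P A B D} {p : P ⇒ A} {q : P ⇒ B} {f : A ⇒ D} {g : B ⇒ D} →
      IsPullback p q f g → S f → S q
    A2 : ∀ {P A B D} {p : P ⇒ A} {q : P ⇒ B} {f : A ⇒ D} {g : B ⇒ D} →
      IsPullback p q f g → Cover g → S q → S f
    A3 : ∀ {X X' Y Y' SX SY} {f : X ⇒ Y} {f' : X' ⇒ Y'}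
           {i₁ : X ⇒ SX} {i₂ : X' ⇒ SX} {j₁ : Y ⇒ SY} {j₂ : Y' ⇒ SY} →
      IsCoproduct i₁ i₂ → IsCoproduct j₁ j₂ → S f → S f' →
      (h : SX ⇒ SY) → h ∘ i₁ ≈ j₁ ∘ f → h ∘ i₂ ≈ j₂ ∘ f' → S h
    A4-0 : ∀ {Z T} → IsInitial Z → IsTerminal T → (h : Z ⇒ T) → S h
    A4-1 : ∀ {T} → IsTerminal T → (h : T ⇒ T) → S h
    A4-2 : ∀ {T U} {i₁ i₂ : T ⇒ U} → IsTerminal T → IsCoproduct i₁ i₂ → (h : U ⇒ T) → S h
    A5 : ∀ {A B D} {f : A ⇒ B} {g : B ⇒ D} → S f → S g → S (g ∘ f)
    A6 : ∀ {A B D} {f : A ⇒ B} {g : B ⇒ D} {h : A ⇒ D} → h ≈ g ∘ f → Cover f → S h → S g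
    A7 : ∀ {Y X A} (p : Y ⇒ X) (f : X ⇒ A) → Cover p → S f →
      Σ Obj λ Z → Σ Obj λ B → Σ (Z ⇒ B) λ g → Σ (Z ⇒ X) λ z → Σ (B ⇒ A) λ b →
        S g × IsCoveringSquare z g f b × (Σ (Z ⇒ Y) λ k → p ∘ k ≈ z)
    A8 : ∀ {Y X M A} {f : Y ⇒ X} {m : M ⇒ Y} {a : A ⇒ X} →
      S f → Mono m → S m → IsForall f m a → S a
    A9 : ∀ {X P} {π₁ π₂ : P ⇒ X} → IsProduct π₁ π₂ →
      (d : X ⇒ P) → π₁ ∘ d ≈ id → π₂ ∘ d ≈ id → S d

record CatWithSmallMaps (o ℓ e s : Level) : Set (suc (o ⊔ ℓ ⊔ e ⊔ s)) where
  field
    cat : Category o ℓ e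
    heyting : IsPositiveHeyting cat
    S : ∀ {A B} → Category._⇒_ cat A B → Set s
    small : IsSmallMaps cat S

module _ {o ℓ e s : Level} (E : CatWithSmallMaps o ℓ e s) where
  open CatWithSmallMaps E
  open Category cat
  open Notions cat

  IsBoundedRel : ∀ {R X} → R ⇒ X → R ⇒ X → Set (o ⊔ ℓ ⊔ e ⊔ s)
  IsBoundedRel {R} {X} r₁ r₂ =
    ∀ {P} (π₁ π₂ : P ⇒ X) → IsProduct π₁ π₂ →
      (u : R ⇒ P) → π₁ ∘ u ≈ r₁ → π₂ ∘ u ≈ r₂ → S u

  IsExact : Set (o ⊔ ℓ ⊔ e ⊔ s)
  IsExact = ∀ {R X} (r₁ r₂ : R ⇒ X) → IsEquivRel r₁ r₂ → IsBoundedRel r₁ r₂ →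
    Σ Obj λ Q → Σ (X ⇒ Q) λ q → IsQuotient r₁ r₂ q

record Functor {o ℓ e o' ℓ' e' : Level} (C : Category o ℓ e) (D : Category o' ℓ' e')
       : Set (o ⊔ ℓ ⊔ e ⊔ o' ⊔ ℓ' ⊔ e') where
  private
    module C = Category C
    module D = Category D
  field
    F₀ : C.Obj → D.Obj
    F₁ : ∀ {A B} → A C.⇒ B → F₀ A D.⇒ F₀ B
    identity : ∀ {A} → F₁ (C.id {A}) D.≈ D.id
    homomorphism : ∀ {A B X} {f : A C.⇒ B} {g : B C.⇒ X} → F₁ (g C.∘ f) D.≈ F₁ g D.∘ F₁ f
    F-resp-≈ : ∀ {A B} {f g : A C.⇒ B} → f C.≈ g → F₁ f D.≈ F₁ g

_∘F_ : ∀ {o ℓ e o' ℓ' e' o'' ℓ'' e''} {C : Category o ℓ e} {D : Category o' ℓ' e'}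
         {K : Category o'' ℓ'' e''} → Functor D K → Functor C D → Functor C K
_∘F_ {K = K} G F = record
  { F₀ = λ X → G.F₀ (F.F₀ X)
  ; F₁ = λ f → G.F₁ (F.F₁ f)
  ; identity = IsEquivalence.trans K.equiv (G.F-resp-≈ F.identity) G.identity
  ; homomorphism = IsEquivalence.trans K.equiv (G.F-resp-≈ F.homomorphism) G.homomorphism
  ; F-resp-≈ = λ p → G.F-resp-≈ (F.F-resp-≈ p)
  }
  where
    module G = Functor G
    module F = Functor F
    module K = Category K

record NatTrans {o ℓ e o' ℓ' e' : Level} {C : Category o ℓ e} {D : Category o' ℓ' e'}
       (F G : Functor C D) : Set (o ⊔ ℓ ⊔ e ⊔ o' ⊔ ℓ' ⊔ e') where
  private
    module C = Category C
    module D = Category D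
    module F = Functor F
    module G = Functor G
  field
    η : ∀ X → F.F₀ X D.⇒ G.F₀ X
    commute : ∀ {X Y} (f : X C.⇒ Y) → η Y D.∘ F.F₁ f D.≈ G.F₁ f D.∘ η X

IsNatIso : ∀ {o ℓ e o' ℓ' e' : Level} {C : Category o ℓ e} {D : Category o' ℓ' e'}
           {F G : Functor C D} → NatTrans F G → Set (o ⊔ ℓ' ⊔ e')
IsNatIso {D = D} α = ∀ X → Notions.IsIso D (NatTrans.η α X)

record Morphism {o ℓ e s o' ℓ' e' s' : Level}
       (E : CatWithSmallMaps o ℓ e s) (F : CatWithSmallMaps o' ℓ' e' s')
       : Set (o ⊔ ℓ ⊔ e ⊔ s ⊔ o' ⊔ ℓ' ⊔ e' ⊔ s') where
  private
    module E = CatWithSmallMaps E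
    module F = CatWithSmallMaps F
    module EC = Category E.cat
    module FC = Category F.cat
    module EN = Notions E.cat
    module FN = Notions F.cat
  field
    functor : Functor E.cat F.cat
  open Functor functor public
  field
    pres-terminal : ∀ {T} → EN.IsTerminal T → FN.IsTerminal (F₀ T)
    pres-pullback : ∀ {P A B D} {p : P EC.⇒ A} {q : P EC.⇒ B} {f : A EC.⇒ D} {g : B EC.⇒ D} →
      EN.IsPullback p q f g → FN.IsPullback (F₁ p) (F₁ q) (F₁ f) (F₁ g)
    pres-cover : ∀ {A B} {f : A EC.⇒ B} → EN.Cover f → FN.Cover (F₁ f)
    pres-initial : ∀ {I} → EN.IsInitial I → FN.IsInitial (F₀ I)
    pres-coproduct : ∀ {S A B} {i₁ : A EC.⇒ S} {i₂ : B EC.⇒ S} →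
      EN.IsCoproduct i₁ i₂ → FN.IsCoproduct (F₁ i₁) (F₁ i₂)
    pres-least : ∀ {B X} {b : B EC.⇒ X} → EN.IsLeastSub b → FN.IsLeastSub (F₁ b)
    pres-union : ∀ {M N U X} {m : M EC.⇒ X} {n : N EC.⇒ X} {u : U EC.⇒ X} →
      EN.Mono m → EN.Mono n → EN.IsUnion m n u → FN.IsUnion (F₁ m) (F₁ n) (F₁ u)
    pres-forall : ∀ {Y X M A} {f : Y EC.⇒ X} {m : M EC.⇒ Y} {a : A EC.⇒ X} →
      EN.Mono m → EN.IsForall f m a → FN.IsForall (F₁ f) (F₁ m) (F₁ a)
    pres-small : ∀ {A B} {f : A EC.⇒ B} → E.S f → F.S (F₁ f)

record PrecompEquivalence {o ℓ e s o₁ ℓ₁ e₁ s₁ o₂ ℓ₂ e₂ s₂ : Level}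
       {E : CatWithSmallMaps o ℓ e s} {Ē : CatWithSmallMaps o₁ ℓ₁ e₁ s₁}
       (y : Morphism E Ē) (F : CatWithSmallMaps o₂ ℓ₂ e₂ s₂)
       : Set (o ⊔ ℓ ⊔ e ⊔ s ⊔ o₁ ⊔ ℓ₁ ⊔ e₁ ⊔ s₁ ⊔ o₂ ⊔ ℓ₂ ⊔ e₂ ⊔ s₂) where
  private
    module FC = Category (CatWithSmallMaps.cat F)
    module y = Morphism y
    _·y : Morphism Ē F → Functor (CatWithSmallMaps.cat E) (CatWithSmallMaps.cat F)
    H ·y = Morphism.functor H ∘F Morphism.functor y
  field
    ess-surj : ∀ (G : Morphism E F) →
      Σ (Morphism Ē F) λ H → Σ (NatTrans (H ·y) (Morphism.functor G)) λ α → IsNatIso α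
    full : ∀ (H H' : Morphism Ē F) (α : NatTrans (H ·y) (H' ·y)) →
      Σ (NatTrans (Morphism.functor H) (Morphism.functor H')) λ β →
        ∀ X → NatTrans.η β (y.F₀ X) FC.≈ NatTrans.η α X
    faithful : ∀ (H H' : Morphism Ē F) (β β' : NatTrans (Morphism.functor H) (Morphism.functor H')) →
      (∀ X → NatTrans.η β (y.F₀ X) FC.≈ NatTrans.η β' (y.F₀ X)) →
      ∀ X → NatTrans.η β X FC.≈ NatTrans.η β' X

record ExactCompletion {o ℓ e s : Level} (E : CatWithSmallMaps o ℓ e s) : Setω where
  field
    o₁ ℓ₁ e₁ s₁ : Level
    Ē : CatWithSmallMaps o₁ ℓ₁ e₁ s₁
    Ē-exact : IsExact Ē
    y : Morphism E Ē
    universal : ∀ {o₂ ℓ₂ e₂ s₂ : Level} (F : CatWithSmallMaps o₂ ℓ₂ e₂ s₂) →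
      IsExact F → PrecompEquivalence y F

module _ {o ℓ e s o₁ ℓ₁ e₁ s₁ : Level}
         {E : CatWithSmallMaps o ℓ e s} {Ē : CatWithSmallMaps o₁ ℓ₁ e₁ s₁}
         (y : Morphism E Ē) where
  private
    module E = CatWithSmallMaps E
    module Ē = CatWithSmallMaps Ē
    module EC = Category E.cat
    module ĒC = Category Ē.cat
    module EN = Notions E.cat
    module ĒN = Notions Ē.cat
    module y = Morphism y

  FullyFaithful : Set (o ⊔ ℓ ⊔ e ⊔ ℓ₁ ⊔ e₁)
  FullyFaithful =
    (∀ {A B} (g : y.F₀ A ĒC.⇒ y.F₀ B) → Σ (A EC.⇒ B) λ f → y.F₁ f ĒC.≈ g) ×
    (∀ {A B} (f g : A EC.⇒ B) → y.F₁ f ĒC.≈ y.F₁ g → f EC.≈ g)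

  Covering : Set (o ⊔ o₁ ⊔ ℓ₁ ⊔ e₁)
  Covering = ∀ (X : ĒC.Obj) → Σ EC.Obj λ Y → Σ (y.F₀ Y ĒC.⇒ X) λ c → ĒN.Cover c

  SubBijection : Set (o ⊔ ℓ ⊔ e ⊔ o₁ ⊔ ℓ₁ ⊔ e₁)
  SubBijection = ∀ (X : EC.Obj) →
    (∀ {M N} (m : M EC.⇒ X) (n : N EC.⇒ X) → EN.Mono m → EN.Mono n →
       y.F₁ m ĒN.≤ₛ y.F₁ n → y.F₁ n ĒN.≤ₛ y.F₁ m → (m EN.≤ₛ n) × (n EN.≤ₛ m)) ×
    (∀ {N} (n : N ĒC.⇒ y.F₀ X) → ĒN.Mono n →
       Σ EC.Obj λ M → Σ (M EC.⇒ X) λ m → EN.Mono m × (y.F₁ m ĒN.≤ₛ n) × (n ĒN.≤ₛ y.F₁ m))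

  CoveredBySmallY : ∀ {B D} → B ĒC.⇒ D → Set (o ⊔ ℓ ⊔ s ⊔ o₁ ⊔ ℓ₁ ⊔ e₁)
  CoveredBySmallY {B} {D} f =
    Σ EC.Obj λ A' → Σ EC.Obj λ C' → Σ (A' EC.⇒ C') λ f' → E.S f' ×
      Σ (y.F₀ A' ĒC.⇒ B) λ t → Σ (y.F₀ C' ĒC.⇒ D) λ p → ĒN.IsCoveringSquare t (y.F₁ f') f p

  SmallCharacterisation : Set (o ⊔ ℓ ⊔ s ⊔ o₁ ⊔ ℓ₁ ⊔ e₁ ⊔ s₁)
  SmallCharacterisation = ∀ {B D} (f : B ĒC.⇒ D) →
    (Ē.S f → CoveredBySmallY f) × (CoveredBySmallY f → Ē.S f)

record ExactCompletionWithProperties {o ℓ e s : Level} (E : CatWithSmallMaps o ℓ e s) : Setω where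
  field
    completion : ExactCompletion E
  open ExactCompletion completion
  field
    fully-faithful : FullyFaithful y
    covering : Covering y
    sub-bijection : SubBijection y
    small-characterisation : SmallCharacterisation y

module Submission where

-- The objects of Ē are the pairs (X , R) of an object X of E and a bounded equivalence relation R on it; a
-- morphism (X , R) → (Y , S) is a map from a cover of X to Y that respects R and S, and y X = (X , =).
-- Elements of (X , R) over T are represented, locally on T, by elements of X modulo R, so the regular structure
-- of Ē can be computed with generalised elements in E.
--
-- All further properties of Ē follow from a few facts about y : E → Ē: it is fully faithful and preserves covers,
-- every object A has a cover q : yX → A whose kernel pair is the image under y of a bounded equivalence relation of E,
-- and each bounded equivalence relation of E has such a quotient in Ē.  Call a map of Ē small if it is
-- covered by some yf with f small.  Since ∀ and smallness descend along covering squares, both can be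
-- computed in E after covering the map in question by one between objects of E.  A bounded equivalence
-- relation R on A pulls back along q to a bounded equivalence relation on X, because subobjects of y(X × X) come
-- from E, and its quotient is also a quotient of A by R.  A morphism G : E → F with F exact extends by sending
-- A to the quotient of G X by the image of the kernel pair of q; preservation of the structure follows from the
-- fact that every element of this quotient is locally the class of an element of G X.

-- Quotients are available only for bounded equivalence relations, so each relation formed on the
-- way has to be shown bounded. Equality is bounded because diagonals are small, which gives the
-- objects yX. Intersections of pullbacks of bounded relations are bounded, which gives images and
-- pullbacks in Ē; sums are bounded by smallness of coproduct injections, which gives coproducts.
--
-- The second obstacle is the absence of chosen representatives: an element of a quotient lifts only
-- after passing to a cover. Universal properties are therefore checked in a local form, with
-- existence up to a cover and uniqueness outright, and descent along covers produces the actual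
-- arrow. Since two parallel morphisms of Ē may be defined on different covers, they are compared
-- through the elements that they relate.
--
-- In the extension of G, an equation between classes in F has to be reflected to E. Locally such an
-- equation is an element of the image under G of the presenting relation, and this image comes from
-- an object of E over which the equation already holds in Ē.

open import Level using (Level; _⊔_; suc; Setω)
open import Data.Product using (Σ; _×_; _,_; proj₁; proj₂)
open import Relation.Binary using (IsEquivalence)
open import Defs

-- Monos, covers and pullbacks in an arbitrary category

module CategoryLemmas {o ℓ e : Level} (C : Category o ℓ e) where
  open Category C
  open Notions C

  open module ≈-Equivalence {A B : Obj} = IsEquivalence (equiv {A} {B}) public using (refl; sym)

  infix 4 _⊑_
  _⊑_ : ∀ {M N X} → M ⇒ X → N ⇒ X → Set (ℓ ⊔ e)
  _⊑_ = _≤ₛ_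

  infixr 2 _∙_
  infixr 9 _▷_
  infixl 10 _◁_

  opaque
    _∙_ : ∀ {A B} {f g h : A ⇒ B} → f ≈ g → g ≈ h → f ≈ h
    p ∙ q = IsEquivalence.trans equiv p q

  opaque
    _▷_ : ∀ {A B D} (g : B ⇒ D) {f f' : A ⇒ B} → f ≈ f' → g ∘ f ≈ g ∘ f'
    g ▷ p = ∘-resp-≈ refl p

  opaque
    _◁_ : ∀ {A B D} {g g' : B ⇒ D} → g ≈ g' → (f : A ⇒ B) → g ∘ f ≈ g' ∘ f
    p ◁ f = ∘-resp-≈ p refl

  opaque
    -- Composites are kept nested to the right; `pull`, `push` and `ext` apply an equation to the
    -- leading factors in front of a tail `x`.
    pull : ∀ {A B D T} {a : B ⇒ D} {b : A ⇒ B} {c : A ⇒ D} {x : T ⇒ A} →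
           a ∘ b ≈ c → a ∘ b ∘ x ≈ c ∘ x
    pull p = sym assoc ∙ p ◁ _

  opaque
    push : ∀ {A B D T} {a : B ⇒ D} {b : A ⇒ B} {c : A ⇒ D} {x : T ⇒ A} →
           a ∘ b ≈ c → c ∘ x ≈ a ∘ b ∘ x
    push p = sym (pull p)

  opaque
    ext : ∀ {A B B' D T} {a : B ⇒ D} {b : A ⇒ B} {a' : B' ⇒ D} {b' : A ⇒ B'} {x : T ⇒ A} →
          a ∘ b ≈ a' ∘ b' → a ∘ b ∘ x ≈ a' ∘ b' ∘ x
    ext p = pull p ∙ assoc

  opaque
    cancel : ∀ {A B T} {a : B ⇒ A} {b : A ⇒ B} {x : T ⇒ A} → a ∘ b ≈ id → a ∘ b ∘ x ≈ x
    cancel p = pull p ∙ identityˡ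

  opaque
    mono-∘ : ∀ {A B D} {f : A ⇒ B} {g : B ⇒ D} → Mono g → Mono f → Mono (g ∘ f)
    mono-∘ mg mf x y p = mf x y (mg _ _ (sym assoc ∙ p ∙ assoc))

  opaque
    mono-resp : ∀ {A B} {f g : A ⇒ B} → f ≈ g → Mono f → Mono g
    mono-resp p m x y q = m x y (p ◁ x ∙ q ∙ sym p ◁ y)

  opaque
    mono-cancel : ∀ {A B D} {f : A ⇒ B} {g : B ⇒ D} → Mono (g ∘ f) → Mono f
    mono-cancel m x y p = m x y (assoc ∙ _ ▷ p ∙ sym assoc)

  opaque
    iso-mono : ∀ {A B} {f : A ⇒ B} → IsIso f → Mono f
    iso-mono (j , jf , _) x y p = sym (cancel jf) ∙ j ▷ p ∙ cancel jf

  opaque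
    section-iso : ∀ {A B} {m : A ⇒ B} {g : B ⇒ A} → Mono m → m ∘ g ≈ id → IsIso m
    section-iso {m = m} {g} mm p = g , mm _ _ (cancel p ∙ sym identityʳ) , p

  opaque
    iso-cover : ∀ {A B} {f : A ⇒ B} → IsIso f → Cover f
    iso-cover (j , _ , fj) m g mm p = section-iso mm (sym assoc ∙ sym p ◁ j ∙ fj)

  opaque
    id-iso : ∀ {A} → IsIso (id {A})
    id-iso = id , identityˡ , identityˡ

  opaque
    iso-inv : ∀ {A B} {f : A ⇒ B} (i : IsIso f) → IsIso (proj₁ i)
    iso-inv {f = f} (j , jf , fj) = f , fj , jf

  opaque
    cover-resp : ∀ {A B} {f g : A ⇒ B} → f ≈ g → Cover f → Cover g
    cover-resp p c m k mm q = c m k mm (p ∙ q)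

  opaque
    cover-cancel : ∀ {A B D} {f : A ⇒ B} {g : B ⇒ D} → Cover (g ∘ f) → Cover g
    cover-cancel c m k mm p = c m (k ∘ _) mm (p ◁ _ ∙ assoc)

  opaque
    cover-mono-iso : ∀ {A B} {m : A ⇒ B} → Cover m → Mono m → IsIso m
    cover-mono-iso c mm = c _ id mm (sym identityʳ)

  module _ {P A B D : Obj} {p : P ⇒ A} {q : P ⇒ B} {f : A ⇒ D} {g : B ⇒ D}
           (pb : IsPullback p q f g) where

    opaque
      pb-comm : f ∘ p ≈ g ∘ q
      pb-comm = proj₁ pb

    opaque
      pb-pair : ∀ {Z} (a : Z ⇒ A) (b : Z ⇒ B) → f ∘ a ≈ g ∘ b →
                Σ (Z ⇒ P) λ u → (p ∘ u ≈ a) × (q ∘ u ≈ b)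
      pb-pair a b r with proj₂ pb a b r
      ... | u , s , t , _ = u , s , t

    opaque
      pb-jm : ∀ {Z} {x y : Z ⇒ P} → p ∘ x ≈ p ∘ y → q ∘ x ≈ q ∘ y → x ≈ y
      pb-jm {x = x} {y} s t with proj₂ pb (p ∘ y) (q ∘ y) (ext pb-comm)
      ... | _ , _ , _ , uniq = uniq x s t ∙ sym (uniq y refl refl)

    opaque
      pb-mono : Mono f → Mono q
      pb-mono mf x y r = pb-jm (mf _ _ (ext pb-comm ∙ g ▷ r ∙ sym (ext pb-comm))) r

    opaque
      pb-swap : IsPullback q p g f
      pb-swap = sym pb-comm , λ b a r → let (u , s , t , uniq) = proj₂ pb a b (sym r)
                                        in u , t , s , λ u' t' s' → uniq u' s' t'

  opaque
    pb-id : ∀ {A B} {f : A ⇒ B} → IsPullback f id id f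
    pb-id = (identityˡ ∙ sym identityʳ) , λ a b r →
      b , (sym r ∙ identityˡ) , identityˡ , λ u' _ t → sym identityˡ ∙ t

  opaque
    -- Expresses monicity by a pullback square, so that a functor preserving pullbacks preserves
    -- monos.
    mono-kernel : ∀ {A B} {m : A ⇒ B} → Mono m → IsPullback id id m m
    mono-kernel mm = refl , λ a b r →
      a , identityˡ , (identityˡ ∙ mm _ _ r) , λ u' s _ → sym identityˡ ∙ s

-- Regular categories and reasoning with generalised elements

record IsRegular {o ℓ e : Level} (C : Category o ℓ e) : Set (suc (o ⊔ ℓ ⊔ e)) where
  open Category C
  open Notions C
  field
    terminal : Σ Obj IsTerminal
    pullback : ∀ {A B D} (f : A ⇒ D) (g : B ⇒ D) →
      Σ Obj λ P → Σ (P ⇒ A) λ p → Σ (P ⇒ B) λ q → IsPullback p q f g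
    factor : ∀ {A B} (f : A ⇒ B) →
      Σ Obj λ M → Σ (A ⇒ M) λ c → Σ (M ⇒ B) λ m → Cover c × Mono m × (f ≈ m ∘ c)
    cover-stable : ∀ {P A B D} {p : P ⇒ A} {q : P ⇒ B} {f : A ⇒ D} {g : B ⇒ D} →
      IsPullback p q f g → Cover f → Cover q

-- The regular fragment is isolated because for Ē it is established first: coproducts and
-- quantifiers of Ē are then constructed from it with the help of E.
heyting-regular : ∀ {o ℓ e} {C : Category o ℓ e} → IsPositiveHeyting C → IsRegular C
heyting-regular h = record { terminal = terminal ; pullback = pullback ; factor = factor
                           ; cover-stable = cover-stable }
  where open IsPositiveHeyting h

module Regular {o ℓ e : Level} (C : Category o ℓ e) (reg : IsRegular C) where
  open Category C
  open Notions C
  open CategoryLemmas C public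
  open IsRegular reg public

  infixr 7 _⊗_
  opaque
    ⊤ : Obj
    ⊤ = proj₁ terminal

    ⊤-terminal : IsTerminal ⊤
    ⊤-terminal = proj₂ terminal

    ! : ∀ {X} → X ⇒ ⊤
    ! {X} = proj₁ (proj₂ terminal X)

    !-unique : ∀ {X} {f g : X ⇒ ⊤} → f ≈ g
    !-unique {X} {f} {g} = proj₂ (proj₂ terminal X) f ∙ sym (proj₂ (proj₂ terminal X) g)

    _⊗_ : Obj → Obj → Obj
    A ⊗ B = proj₁ (pullback (! {A}) (! {B}))

    π₁ : ∀ {A B} → A ⊗ B ⇒ A
    π₁ {A} {B} = proj₁ (proj₂ (pullback (! {A}) (! {B})))

    π₂ : ∀ {A B} → A ⊗ B ⇒ B
    π₂ {A} {B} = proj₁ (proj₂ (proj₂ (pullback (! {A}) (! {B}))))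

    ⊗-pullback : ∀ {A B} → IsPullback (π₁ {A} {B}) π₂ ! !
    ⊗-pullback {A} {B} = proj₂ (proj₂ (proj₂ (pullback (! {A}) (! {B}))))

    ⟨_,_⟩ : ∀ {A B Z} → Z ⇒ A → Z ⇒ B → Z ⇒ A ⊗ B
    ⟨ a , b ⟩ = proj₁ (pb-pair ⊗-pullback a b !-unique)

    π₁-β : ∀ {A B Z} {a : Z ⇒ A} {b : Z ⇒ B} → π₁ ∘ ⟨ a , b ⟩ ≈ a
    π₁-β {a = a} {b} = proj₁ (proj₂ (pb-pair ⊗-pullback a b !-unique))

    π₂-β : ∀ {A B Z} {a : Z ⇒ A} {b : Z ⇒ B} → π₂ ∘ ⟨ a , b ⟩ ≈ b
    π₂-β {a = a} {b} = proj₂ (proj₂ (pb-pair ⊗-pullback a b !-unique))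

    ⊗-unique : ∀ {A B Z} {x y : Z ⇒ A ⊗ B} → π₁ ∘ x ≈ π₁ ∘ y → π₂ ∘ x ≈ π₂ ∘ y → x ≈ y
    ⊗-unique = pb-jm ⊗-pullback

    ⊗-product : ∀ {A B} → IsProduct (π₁ {A} {B}) π₂
    ⊗-product a b = ⟨ a , b ⟩ , π₁-β , π₂-β , λ u s t →
      ⊗-unique (s ∙ sym π₁-β) (t ∙ sym π₂-β)

  opaque
    ⟨⟩-mono : ∀ {R X Y} {r₁ : R ⇒ X} {r₂ : R ⇒ Y} →
              (∀ {Z} (g h : Z ⇒ R) → r₁ ∘ g ≈ r₁ ∘ h → r₂ ∘ g ≈ r₂ ∘ h → g ≈ h) → Mono ⟨ r₁ , r₂ ⟩
    ⟨⟩-mono jm x y p = jm x y (push π₁-β ∙ π₁ ▷ p ∙ pull π₁-β) (push π₂-β ∙ π₂ ▷ p ∙ pull π₂-β)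

  opaque
    equalizer : ∀ {A B} (f g : A ⇒ B) → Σ Obj λ E → Σ (E ⇒ A) λ i →
      Mono i × (f ∘ i ≈ g ∘ i) × (∀ {T} (t : T ⇒ A) → f ∘ t ≈ g ∘ t → t ⊑ i)
    equalizer f g with pullback ⟨ id , f ⟩ ⟨ id , g ⟩
    ... | E , p , q , pb = E , p ,
          (λ x y r → pb-jm pb r (sym p≈q ◁ x ∙ r ∙ p≈q ◁ y)) ,
          (push π₂-β ∙ π₂ ▷ pb-comm pb ∙ pull π₂-β ∙ g ▷ sym p≈q) ,
          λ t r → let (u , s , _) = pb-pair pb t t (⊗-unique (pull π₁-β ∙ push π₁-β)
                                                             (pull π₂-β ∙ r ∙ push π₂-β))
                  in u , s
      where
        p≈q : p ≈ q
        p≈q = sym identityˡ ∙ push π₁-β ∙ π₁ ▷ pb-comm pb ∙ pull π₁-β ∙ identityˡ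

  opaque
    -- A mono `m` through which `g ∘ f` factors is pulled back along `g`. There `f` factors through
    -- it, so the pulled-back mono is invertible and `g` itself factors through `m`.
    cover-∘ : ∀ {A B D} {f : A ⇒ B} {g : B ⇒ D} → Cover g → Cover f → Cover (g ∘ f)
    cover-∘ {f = f} {g} cg cf m k mm r with pullback m g
    ... | P , p , q , pb with pb-pair pb k f (sym r)
    ... | u , _ , qu with cf q u (pb-mono pb mm) (sym qu)
    ... | j , _ , qj = cg m (p ∘ j) mm
          (sym identityʳ ∙ g ▷ sym qj ∙ sym (ext (pb-comm pb)))

  opaque
    lift : ∀ {A B T} {f : A ⇒ B} → Cover f → (y : T ⇒ B) →
           Σ Obj λ T' → Σ (T' ⇒ T) λ t → Cover t × Σ (T' ⇒ A) λ x → f ∘ x ≈ y ∘ t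
    lift {f = f} c y with pullback f y
    ... | T' , x , t , pb = T' , t , cover-stable pb c , x , pb-comm pb

  opaque
    lift₂ : ∀ {A B A' B' T} {f : A ⇒ B} {g : A' ⇒ B'} → Cover f → Cover g → (x : T ⇒ B) (y : T ⇒ B') →
            Σ Obj λ T' → Σ (T' ⇒ T) λ t → Cover t ×
            Σ (T' ⇒ A) λ u → Σ (T' ⇒ A') λ v → (f ∘ u ≈ x ∘ t) × (g ∘ v ≈ y ∘ t)
    lift₂ cf cg x y with lift cf x
    ... | T₁ , t₁ , c₁ , u , p with lift cg (y ∘ t₁)
    ... | T₂ , t₂ , c₂ , v , q = T₂ , t₁ ∘ t₂ , cover-∘ c₁ c₂ , u ∘ t₂ , v , (ext p) , (q ∙ assoc)

  opaque
    cover-epi : ∀ {A B Z} {f : A ⇒ B} {x y : B ⇒ Z} → Cover f → x ∘ f ≈ y ∘ f → x ≈ y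
    cover-epi {f = f} {x} {y} c p with equalizer x y
    ... | E , i , mi , xi≈yi , univ with univ f p
    ... | k , ik with c i k mi (sym ik)
    ... | j , _ , ij = sym identityʳ ∙ x ▷ sym ij ∙ ext xi≈yi ∙ y ▷ ij ∙ identityʳ

  opaque
    -- The pullback of `m` along `x` is a mono through which the cover `t` factors, hence an
    -- isomorphism.
    ⊑-local : ∀ {M X T T'} {m : M ⇒ X} {x : T ⇒ X} {t : T' ⇒ T} →
               Mono m → Cover t → x ∘ t ⊑ m → x ⊑ m
    ⊑-local {m = m} {x} {t} mm c (l , ml) with pullback m x
    ... | P , p , q , pb with pb-pair pb l t ml
    ... | u , _ , qu with c q u (pb-mono pb mm) (sym qu)
    ... | j , _ , qj = p ∘ j , (ext (pb-comm pb) ∙ x ▷ qj ∙ identityʳ)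

  opaque
    -- The image of `⟨ c , h ⟩` is the graph of the desired map. Its projection to `A` is a cover
    -- because `c` is, and a mono because `h` is constant on the fibres of `c`; so it is invertible.
    descend : ∀ {U A B} {c : U ⇒ A} (h : U ⇒ B) → Cover c →
              (∀ {T} (u v : T ⇒ U) → c ∘ u ≈ c ∘ v → h ∘ u ≈ h ∘ v) →
              Σ (A ⇒ B) λ k → k ∘ c ≈ h
    descend {U} {A} {B} {c} h cov ker with factor ⟨ c , h ⟩
    ... | I , d , m , cd , mm , fac = (π₂ ∘ m) ∘ proj₁ iso ,
          (assoc ∙ (π₂ ∘ m) ▷ (proj₁ iso ▷ sym πd₁ ∙ cancel (proj₁ (proj₂ iso))) ∙ πd₂)
      where
        πd₁ : (π₁ ∘ m) ∘ d ≈ c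
        πd₁ = assoc ∙ π₁ ▷ sym fac ∙ π₁-β
        πd₂ : (π₂ ∘ m) ∘ d ≈ h
        πd₂ = assoc ∙ π₂ ▷ sym fac ∙ π₂-β
        inj : Mono (π₁ ∘ m)
        inj x y r with lift₂ cd cd x y
        ... | T , t , ct , u , v , du , dv = cover-epi ct (mm _ _ (⊗-unique e₁ e₂))
          where
            cu≈cv : c ∘ u ≈ c ∘ v
            cu≈cv = push πd₁ ∙ (π₁ ∘ m) ▷ du ∙ pull r ∙ assoc ∙ sym ((π₁ ∘ m) ▷ dv) ∙ pull πd₁
            e₁ : π₁ ∘ m ∘ x ∘ t ≈ π₁ ∘ m ∘ y ∘ t
            e₁ = sym assoc ∙ pull r ∙ assoc ∙ assoc
            e₂ : π₂ ∘ m ∘ x ∘ t ≈ π₂ ∘ m ∘ y ∘ t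
            e₂ = sym assoc ∙ sym ((π₂ ∘ m) ▷ du) ∙ pull πd₂ ∙ ker u v cu≈cv ∙ push πd₂ ∙
                 (π₂ ∘ m) ▷ dv ∙ assoc
        iso : IsIso (π₁ ∘ m)
        iso = cover-mono-iso (cover-cancel (cover-resp (sym πd₁) cov)) inj

  opaque
    -- Joint monicity makes locally given elements of `P` compatible, so `descend` glues them to a
    -- global one; local existence is therefore enough.
    mk-pullback : ∀ {P A B D} {p : P ⇒ A} {q : P ⇒ B} {f : A ⇒ D} {g : B ⇒ D} → f ∘ p ≈ g ∘ q →
      (∀ {Z} {x y : Z ⇒ P} → p ∘ x ≈ p ∘ y → q ∘ x ≈ q ∘ y → x ≈ y) →
      (∀ {Z} (a : Z ⇒ A) (b : Z ⇒ B) → f ∘ a ≈ g ∘ b → Σ Obj λ T → Σ (T ⇒ Z) λ t → Cover t ×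
         Σ (T ⇒ P) λ w → (p ∘ w ≈ a ∘ t) × (q ∘ w ≈ b ∘ t)) →
      IsPullback p q f g
    mk-pullback {P} {A} {B} {p = p} {q} {f} {g} comm jm sur = comm , univ
      where
        univ : ∀ {Z} (a : Z ⇒ A) (b : Z ⇒ B) → f ∘ a ≈ g ∘ b →
          Σ (Z ⇒ P) λ u → (p ∘ u ≈ a) × (q ∘ u ≈ b) ×
            (∀ (u' : Z ⇒ P) → p ∘ u' ≈ a → q ∘ u' ≈ b → u' ≈ u)
        univ a b r with sur a b r
        ... | T , t , ct , w , pw , qw
          with descend w ct (λ u v s → jm (ext pw ∙ a ▷ s ∙ sym (ext pw)) (ext qw ∙ b ▷ s ∙ sym (ext qw)))
        ... | k , kt = k , pk , qk , λ u s t' → jm (s ∙ sym pk) (t' ∙ sym qk)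
          where
            pk : p ∘ k ≈ a
            pk = cover-epi ct (assoc ∙ p ▷ kt ∙ pw)
            qk : q ∘ k ≈ b
            qk = cover-epi ct (assoc ∙ q ▷ kt ∙ qw)

  opaque
    coequalizer-cover : ∀ {R X Q} {r₁ r₂ : R ⇒ X} {q : X ⇒ Q} → IsCoequalizer r₁ r₂ q → Cover q
    coequalizer-cover {q = q} (comm , univ) m g mm q≈mg
      with univ g (mm _ _ (pull (sym q≈mg) ∙ comm ∙ push (sym q≈mg))) | univ q comm
    ... | u , uq , _ | _ , _ , uniq =
      section-iso mm (uniq (m ∘ u) (assoc ∙ m ▷ uq ∙ sym q≈mg) ∙ sym (uniq id identityˡ))

  opaque
    kernel-coequalizer : ∀ {R X Q} {r₁ r₂ : R ⇒ X} {q : X ⇒ Q} → Cover q → IsPullback r₁ r₂ q q →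
                         IsCoequalizer r₁ r₂ q
    kernel-coequalizer {r₁ = r₁} {r₂} {q} c pb = pb-comm pb , univ
      where
        univ : ∀ {Z} (h : _ ⇒ Z) → h ∘ r₁ ≈ h ∘ r₂ →
          Σ (_ ⇒ Z) λ u → (u ∘ q ≈ h) × (∀ (u' : _ ⇒ Z) → u' ∘ q ≈ h → u' ≈ u)
        univ h r with descend h c ker
          where
            ker : ∀ {T} (u v : T ⇒ _) → q ∘ u ≈ q ∘ v → h ∘ u ≈ h ∘ v
            ker u v s with pb-pair pb u v s
            ... | w , s₁ , s₂ = h ▷ sym s₁ ∙ ext r ∙ h ▷ s₂
        ... | k , kq = k , kq , λ u' s → cover-epi c (s ∙ sym kq)

  opaque
    -- In a regular category every cover is the coequaliser of its kernel pair, so stability of the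
    -- quotient reduces to stability of covers.
    cover-quotient : ∀ {R X Q} {r₁ r₂ : R ⇒ X} {q : X ⇒ Q} → Cover q → IsPullback r₁ r₂ q q →
                     IsQuotient r₁ r₂ q
    cover-quotient c pb = pb , kernel-coequalizer c pb ,
      λ h q' h' sq a b pb' → kernel-coequalizer (cover-stable (pb-swap sq) c) pb'

  -- The condition that the comparison map into the pullback be a cover, stated with elements and
  -- without mentioning a pullback object.
  Lifts : ∀ {A B C' D} → A ⇒ B → A ⇒ C' → B ⇒ D → C' ⇒ D → Set (o ⊔ ℓ ⊔ e)
  Lifts {A} {B} {C'} t f g p = ∀ {Z} (c : Z ⇒ C') (b : Z ⇒ B) → p ∘ c ≈ g ∘ b →
    Σ Obj λ T → Σ (T ⇒ Z) λ s → Cover s × Σ (T ⇒ A) λ a → (f ∘ a ≈ c ∘ s) × (t ∘ a ≈ b ∘ s)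

  opaque
    square-lifts : ∀ {A B C' D} {t : A ⇒ B} {f : A ⇒ C'} {g : B ⇒ D} {p : C' ⇒ D} →
                   IsCoveringSquare t f g p → Lifts t f g p
    square-lifts {t = t} {f} {g} {p} (comm , _ , cov) c b r with pullback p g
    ... | P , p₁ , p₂ , pb with pb-pair pb f t (sym comm) | pb-pair pb c b r
    ... | u , p₁u , p₂u | z , p₁z , p₂z with lift (cov p₁ p₂ pb u p₁u p₂u) z
    ... | T , s , cs , a , ua = T , s , cs , a ,
          (push p₁u ∙ p₁ ▷ ua ∙ pull p₁z) , (push p₂u ∙ p₂ ▷ ua ∙ pull p₂z)

  opaque
    mk-square : ∀ {A B C' D} {t : A ⇒ B} {f : A ⇒ C'} {g : B ⇒ D} {p : C' ⇒ D} →
                g ∘ t ≈ p ∘ f → Cover p → Lifts t f g p → IsCoveringSquare t f g p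
    mk-square {A} {B} {C'} {t = t} {f} {g} {p} comm cp lifts = comm , cp , cov
      where
        cov : ∀ {P} (p₁ : P ⇒ C') (p₂ : P ⇒ B) → IsPullback p₁ p₂ p g →
              ∀ (u : A ⇒ P) → p₁ ∘ u ≈ f → p₂ ∘ u ≈ t → Cover u
        cov p₁ p₂ pb u p₁u p₂u with lifts p₁ p₂ (pb-comm pb)
        ... | T , s , cs , a , fa , ta =
          cover-cancel (cover-resp (pb-jm pb (sym fa ∙ push p₁u) (sym ta ∙ push p₂u)) cs)

  opaque
    pullback-lifts : ∀ {P A B D} {p : P ⇒ A} {q : P ⇒ B} {f : A ⇒ D} {g : B ⇒ D} →
                     IsPullback p q f g → Lifts p q f g
    pullback-lifts pb c b r with pb-pair pb b c (sym r)
    ... | u , s , t = _ , id , iso-cover id-iso , u , (t ∙ sym identityʳ) , (s ∙ sym identityʳ)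

  opaque
    square-∘ : ∀ {A B C' D A' C''} {t : A ⇒ B} {f : A ⇒ C'} {g : B ⇒ D} {p : C' ⇒ D}
               {t' : A' ⇒ A} {f' : A' ⇒ C''} {p' : C'' ⇒ C'} →
               IsCoveringSquare t f g p → IsCoveringSquare t' f' f p' →
               IsCoveringSquare (t ∘ t') f' g (p ∘ p')
    square-∘ {B = B} {t = t} {f} {g} {p} {t'} {f'} {p'} sq@(comm , cp , _) sq'@(comm' , cp' , _) =
      mk-square (ext comm ∙ p ▷ comm' ∙ sym assoc) (cover-∘ cp cp') lifts
      where
        lifts : Lifts (t ∘ t') f' g (p ∘ p')
        lifts c b r with square-lifts sq (p' ∘ c) b (sym assoc ∙ r)
        ... | T , s , cs , a , fa , ta with square-lifts sq' (c ∘ s) a (sym assoc ∙ sym fa)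
        ... | T' , s' , cs' , a' , f'a' , t'a' = T' , s ∘ s' , cover-∘ cs cs' , a' ,
          (f'a' ∙ assoc) , (assoc ∙ t ▷ t'a' ∙ ext ta)

  module _ {Y X M A : Obj} {f : Y ⇒ X} {m : M ⇒ Y} {a : A ⇒ X} where

    opaque
      forall-elim : IsForall f m a → ∀ {T} (b : T ⇒ X) (x : T ⇒ Y) → f ∘ x ≈ b → b ⊑ a → x ⊑ m
      forall-elim (ma , adj) b x r (k , ak) with pullback f a
      ... | P , p₁ , p₂ , pb with pb-pair pb x k (r ∙ sym ak) | proj₂ (adj a p₁ p₂ ma pb) (id , identityʳ)
      ... | u , p₁u , _ | v , mv = v ∘ u , (pull mv ∙ p₁u)

    opaque
      -- The adjunction speaks of subobjects of `X` only, so `b` is replaced by its image `n`.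
      -- Elements of the pullback of `n` along `f` lift locally to `T`, where the hypothesis
      -- applies.
      forall-intro : IsForall f m a → Mono m → ∀ {T} (b : T ⇒ X) →
        (∀ {T'} (s : T' ⇒ T) (x : T' ⇒ Y) → f ∘ x ≈ b ∘ s → x ⊑ m) → b ⊑ a
      forall-intro (ma , adj) mm b hyp with factor b
      ... | I , c , n , cc , mn , b≈nc with pullback f n
      ... | P , p₁ , p₂ , pb with lift cc p₂
      ... | T , t , ct , x , cx with proj₁ (adj n p₁ p₂ mn pb)
                                      (⊑-local mm ct (hyp x (p₁ ∘ t)
                                        (ext (pb-comm pb) ∙ n ▷ sym cx ∙ pull (sym b≈nc))))
      ... | k , ak = k ∘ c , (pull ak ∙ sym b≈nc)

    opaque
      mk-forall : Mono a → (∀ {T} (b : T ⇒ X) (x : T ⇒ Y) → f ∘ x ≈ b → b ⊑ a → x ⊑ m) →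
        (∀ {T} (b : T ⇒ X) → (∀ {T'} (s : T' ⇒ T) (x : T' ⇒ Y) → f ∘ x ≈ b ∘ s → x ⊑ m) → b ⊑ a) →
        IsForall f m a
      mk-forall ma elim intro = ma , λ n n' k mn pb →
        (λ { (l , ml) → intro n λ s x r → let (u , n'u , _) = pb-pair pb x s r
                                           in l ∘ u , (pull ml ∙ n'u) }) ,
        (λ { (l , al) → elim (n ∘ k) n' (pb-comm pb) (l ∘ k , pull al) })

  module _ {Y X Y' X' M A M' A' : Obj} {f : Y ⇒ X} {t : Y' ⇒ Y} {f' : Y' ⇒ X'} {p : X' ⇒ X}
           {m : M ⇒ Y} {a : A ⇒ X} {m' : M' ⇒ Y'} {a' : A' ⇒ X'} {k : M' ⇒ M}
           (sq : IsCoveringSquare t f' f p) (mm : Mono m) (mpb : IsPullback k m' m t) where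

    opaque
      mm' : Mono m'
      mm' = pb-mono mpb mm

    opaque
      m'-intro : ∀ {T} (x : T ⇒ Y') → t ∘ x ⊑ m → x ⊑ m'
      m'-intro x (j , mj) with pb-pair mpb j x mj
      ... | u , _ , s = u , s

    opaque
      m'-elim : ∀ {T} {x : T ⇒ Y'} → x ⊑ m' → t ∘ x ⊑ m
      m'-elim (j , mj) = k ∘ j , (ext (pb-comm mpb) ∙ t ▷ mj)

    opaque
      -- Membership in `a` and in `m` is local, and the covering square supplies, for an element of
      -- `Y` lying over a point of `X'`, a local preimage in `Y'` over that same point. So the
      -- quantifier can be tested upstairs.
      forall-descent : Mono a → (c : A' ⇒ A) → Cover c → a ∘ c ≈ p ∘ a' → IsForall f' m' a' → IsForall f m a
      forall-descent ma c cc ac fa' = mk-forall ma elim intro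
        where
          elim : ∀ {T} (b : T ⇒ X) (x : T ⇒ Y) → f ∘ x ≈ b → b ⊑ a → x ⊑ m
          elim b x r (l , al) with lift cc l
          ... | T₁ , s₁ , cs₁ , w , cw
            with square-lifts sq (a' ∘ w) (x ∘ s₁) (ext (sym ac) ∙ a ▷ cw ∙ pull (al ∙ sym r) ∙ assoc)
          ... | T₂ , s₂ , cs₂ , z , f'z , tz = ⊑-local mm cs₁ (⊑-local mm cs₂
                  (let (j , mj) = m'-elim (forall-elim fa' _ z f'z (w ∘ s₂ , sym assoc)) in j , (mj ∙ tz)))

          intro : ∀ {T} (b : T ⇒ X) → (∀ {T'} (s : T' ⇒ T) (x : T' ⇒ Y) → f ∘ x ≈ b ∘ s → x ⊑ m) → b ⊑ a
          intro b hyp with lift (proj₁ (proj₂ sq)) b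
          ... | T₁ , s₁ , cs₁ , y , py
            with forall-intro fa' mm' y (λ s z r → m'-intro z (hyp (s₁ ∘ s) (t ∘ z)
                   (ext (proj₁ sq) ∙ p ▷ r ∙ pull py ∙ assoc)))
          ... | j , a'j = ⊑-local ma cs₁ (c ∘ j , (ext ac ∙ p ▷ a'j ∙ py))

    opaque
      -- The Beck-Chevalley condition for covering squares instead of pullback squares: elements of
      -- `Y` over `p ∘ b` lift to `Y'` only locally, which suffices since membership in the mono `m`
      -- is local.
      forall-BC : ∀ {c : A' ⇒ A} → IsPullback c a' a p → IsForall f m a → IsForall f' m' a'
      forall-BC {c} apb fa = mk-forall (pb-mono apb (proj₁ fa)) elim intro
        where
          elim : ∀ {T} (b : T ⇒ X') (x : T ⇒ Y') → f' ∘ x ≈ b → b ⊑ a' → x ⊑ m'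
          elim b x r (l , al) = m'-intro x (forall-elim fa (p ∘ b) (t ∘ x) (ext (proj₁ sq) ∙ p ▷ r)
                                  (c ∘ l , (ext (pb-comm apb) ∙ p ▷ al)))

          intro : ∀ {T} (b : T ⇒ X') → (∀ {T'} (s : T' ⇒ T) (x : T' ⇒ Y') → f' ∘ x ≈ b ∘ s → x ⊑ m') → b ⊑ a'
          intro b hyp with forall-intro fa mm (p ∘ b) (λ s x r →
              let (T , u , cu , z , f'z , tz) = square-lifts sq (b ∘ s) x (sym assoc ∙ sym r)
                  (j , mj) = m'-elim (hyp (s ∘ u) z (f'z ∙ assoc))
              in ⊑-local mm cu (j , (mj ∙ tz)))
          ... | j , aj with pb-pair apb j b aj
          ... | u , _ , s = u , s

  -- Jointly covering pairs and the recognition of coproducts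

  JointlyCovering : ∀ {A B X} → A ⇒ X → B ⇒ X → Set (o ⊔ ℓ ⊔ e)
  JointlyCovering {X = X} f g = ∀ {M} (m : M ⇒ X) → Mono m → f ⊑ m → g ⊑ m → IsIso m

  -- A disjunction in the internal logic: on two jointly covering parts of `T` the element `u` comes
  -- from `A` and from `B` respectively.
  record Split {A B K T : Obj} (j₁ : A ⇒ K) (j₂ : B ⇒ K) (u : T ⇒ K) : Set (o ⊔ ℓ ⊔ e) where
    field
      {T₁ T₂} : Obj
      t₁ : T₁ ⇒ T
      t₂ : T₂ ⇒ T
      joint : JointlyCovering t₁ t₂
      u₁ : T₁ ⇒ A
      u₂ : T₂ ⇒ B
      eq₁ : j₁ ∘ u₁ ≈ u ∘ t₁
      eq₂ : j₂ ∘ u₂ ≈ u ∘ t₂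

  Splits : ∀ {A B K} → A ⇒ K → B ⇒ K → Set (o ⊔ ℓ ⊔ e)
  Splits {K = K} j₁ j₂ = ∀ {T} (u : T ⇒ K) → Split j₁ j₂ u

  Disjoint : ∀ {A B K} → A ⇒ K → B ⇒ K → Set (o ⊔ ℓ ⊔ e)
  Disjoint {A} {B} j₁ j₂ = ∀ {T} (a : T ⇒ A) (b : T ⇒ B) → j₁ ∘ a ≈ j₂ ∘ b → IsInitial T

  opaque
    initial-≈ : ∀ {I X} {f g : I ⇒ X} → IsInitial I → f ≈ g
    initial-≈ {X = X} {f} {g} i = proj₂ (i X) f ∙ sym (proj₂ (i X) g)

  opaque
    initial-⊑ : ∀ {I X M} {x : I ⇒ X} {m : M ⇒ X} → IsInitial I → x ⊑ m
    initial-⊑ {M = M} i = proj₁ (i M) , initial-≈ i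

  opaque
    joint-⊑ : ∀ {A B X M Y} {f : A ⇒ X} {g : B ⇒ X} {x : X ⇒ Y} {m : M ⇒ Y} →
              JointlyCovering f g → Mono m → x ∘ f ⊑ m → x ∘ g ⊑ m → x ⊑ m
    joint-⊑ {f = f} {g} {x} {m} jc mm (k₁ , mk₁) (k₂ , mk₂) with pullback m x
    ... | P , p , q , pb with pb-pair pb k₁ f mk₁ | pb-pair pb k₂ g mk₂
    ... | u , _ , qu | v , _ , qv with jc q (pb-mono pb mm) (u , qu) (v , qv)
    ... | j , _ , qj = p ∘ j , (ext (pb-comm pb) ∙ x ▷ qj ∙ identityʳ)

  opaque
    joint-≈ : ∀ {A B X Y} {f : A ⇒ X} {g : B ⇒ X} {x y : X ⇒ Y} →
              JointlyCovering f g → x ∘ f ≈ y ∘ f → x ∘ g ≈ y ∘ g → x ≈ y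
    joint-≈ {x = x} {y} jc p q with equalizer x y
    ... | E , i , mi , xi , univ with jc i mi (univ _ p) (univ _ q)
    ... | j , _ , ij = sym identityʳ ∙ x ▷ sym ij ∙ ext xi ∙ y ▷ ij ∙ identityʳ

  opaque
    joint-cover : ∀ {A B X Y} {f : A ⇒ X} {g : B ⇒ X} {c : X ⇒ Y} → JointlyCovering f g → Cover c →
                  JointlyCovering (c ∘ f) (c ∘ g)
    joint-cover {c = c} jc cc m mm (a , p) (b , q) with joint-⊑ jc mm (a , p) (b , q)
    ... | k , mk = cc m k mm (sym mk)

  module _ {A B K A' B' K' T : Obj} {j₁ : A ⇒ K} {j₂ : B ⇒ K} {j₁' : A' ⇒ K'} {j₂' : B' ⇒ K'}
           (sp : Splits j₁ j₂) (sp' : Splits j₁' j₂') (u : T ⇒ K) (v : T ⇒ K') where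

    opaque
      case₂-⊑ : ∀ {M X} {x : T ⇒ X} {m : M ⇒ X} → Mono m →
        (∀ {T'} (s : T' ⇒ T) a b → j₁ ∘ a ≈ u ∘ s → j₁' ∘ b ≈ v ∘ s → x ∘ s ⊑ m) →
        (∀ {T'} (s : T' ⇒ T) a b → j₁ ∘ a ≈ u ∘ s → j₂' ∘ b ≈ v ∘ s → x ∘ s ⊑ m) →
        (∀ {T'} (s : T' ⇒ T) a b → j₂ ∘ a ≈ u ∘ s → j₁' ∘ b ≈ v ∘ s → x ∘ s ⊑ m) →
        (∀ {T'} (s : T' ⇒ T) a b → j₂ ∘ a ≈ u ∘ s → j₂' ∘ b ≈ v ∘ s → x ∘ s ⊑ m) → x ⊑ m
      case₂-⊑ {m = m} mm c₁₁ c₁₂ c₂₁ c₂₂ with sp u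
      ... | S with sp' (v ∘ Split.t₁ S) | sp' (v ∘ Split.t₂ S)
      ... | S₁ | S₂ = joint-⊑ S.joint mm
          (joint-⊑ S₁.joint mm
            (↻ (c₁₁ (S.t₁ ∘ S₁.t₁) (S.u₁ ∘ S₁.t₁) S₁.u₁ (ext S.eq₁) (S₁.eq₁ ∙ assoc)))
            (↻ (c₁₂ (S.t₁ ∘ S₁.t₂) (S.u₁ ∘ S₁.t₂) S₁.u₂ (ext S.eq₁) (S₁.eq₂ ∙ assoc))))
          (joint-⊑ S₂.joint mm
            (↻ (c₂₁ (S.t₂ ∘ S₂.t₁) (S.u₂ ∘ S₂.t₁) S₂.u₁ (ext S.eq₂) (S₂.eq₁ ∙ assoc)))
            (↻ (c₂₂ (S.t₂ ∘ S₂.t₂) (S.u₂ ∘ S₂.t₂) S₂.u₂ (ext S.eq₂) (S₂.eq₂ ∙ assoc))))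
        where
          module S = Split S
          module S₁ = Split S₁
          module S₂ = Split S₂
          ↻ : ∀ {V W X N M} {x : W ⇒ X} {s : V ⇒ W} {r : N ⇒ V} {m : M ⇒ X} →
              x ∘ s ∘ r ⊑ m → (x ∘ s) ∘ r ⊑ m
          ↻ (k , p) = k , (p ∙ sym assoc)

    opaque
      case₂-≈ : ∀ {X} {x y : T ⇒ X} →
        (∀ {T'} (s : T' ⇒ T) a b → j₁ ∘ a ≈ u ∘ s → j₁' ∘ b ≈ v ∘ s → x ∘ s ≈ y ∘ s) →
        (∀ {T'} (s : T' ⇒ T) a b → j₁ ∘ a ≈ u ∘ s → j₂' ∘ b ≈ v ∘ s → x ∘ s ≈ y ∘ s) →
        (∀ {T'} (s : T' ⇒ T) a b → j₂ ∘ a ≈ u ∘ s → j₁' ∘ b ≈ v ∘ s → x ∘ s ≈ y ∘ s) →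
        (∀ {T'} (s : T' ⇒ T) a b → j₂ ∘ a ≈ u ∘ s → j₂' ∘ b ≈ v ∘ s → x ∘ s ≈ y ∘ s) → x ≈ y
      case₂-≈ {x = x} {y} c₁₁ c₁₂ c₂₁ c₂₂ with equalizer x y
      ... | E , i , mi , xi , univ with case₂-⊑ {x = id} mi
              (λ s a b p q → univ _ (x ▷ identityˡ ∙ c₁₁ s a b p q ∙ y ▷ sym identityˡ))
              (λ s a b p q → univ _ (x ▷ identityˡ ∙ c₁₂ s a b p q ∙ y ▷ sym identityˡ))
              (λ s a b p q → univ _ (x ▷ identityˡ ∙ c₂₁ s a b p q ∙ y ▷ sym identityˡ))
              (λ s a b p q → univ _ (x ▷ identityˡ ∙ c₂₂ s a b p q ∙ y ▷ sym identityˡ))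
      ... | j , ij = sym identityʳ ∙ x ▷ sym ij ∙ ext xi ∙ y ▷ ij ∙ identityʳ

  -- Data for building the map `S → Z` with components `a` and `b` by descent. Maps out of `S` are
  -- not yet available, so the copairing is given as `h` on a cover `K` of `S` that is already known
  -- to split.
  record CopairCover {A B S Z : Obj} (i₁ : A ⇒ S) (i₂ : B ⇒ S) (a : A ⇒ Z) (b : B ⇒ Z) : Set (o ⊔ ℓ ⊔ e) where
    field
      {K₁ K₂ K} : Obj
      j₁ : K₁ ⇒ K
      j₂ : K₂ ⇒ K
      splits : Splits j₁ j₂
      k : K ⇒ S
      k-cover : Cover k
      a₁ : K₁ ⇒ A
      b₁ : K₂ ⇒ B
      ka : i₁ ∘ a₁ ≈ k ∘ j₁
      kb : i₂ ∘ b₁ ≈ k ∘ j₂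
      h : K ⇒ Z
      ha : h ∘ j₁ ≈ a ∘ a₁
      hb : h ∘ j₂ ≈ b ∘ b₁

  opaque
    -- To descend `h` along `k`, two elements of `K` with the same image are split into four cases.
    -- The mixed cases live on initial stages by disjointness; in the others the injections are
    -- monic, so the components in `A` or in `B` agree.
    coproduct-intro : ∀ {A B S} {i₁ : A ⇒ S} {i₂ : B ⇒ S} → Mono i₁ → Mono i₂ → Disjoint i₁ i₂ →
      (∀ {Z} (a : A ⇒ Z) (b : B ⇒ Z) → CopairCover i₁ i₂ a b) → IsCoproduct i₁ i₂
    coproduct-intro {A} {B} {S} {i₁} {i₂} mi₁ mi₂ disj cov {Z} a b = w , wi₁ , wi₂ , uniq
      where
        open CopairCover (cov a b)

        same₁ : ∀ {T} (x y : T ⇒ K₁) → k ∘ j₁ ∘ x ≈ k ∘ j₁ ∘ y → h ∘ j₁ ∘ x ≈ h ∘ j₁ ∘ y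
        same₁ x y r = ext ha ∙ a ▷ mi₁ _ _ (ext ka ∙ r ∙ sym (ext ka)) ∙ sym (ext ha)

        same₂ : ∀ {T} (x y : T ⇒ K₂) → k ∘ j₂ ∘ x ≈ k ∘ j₂ ∘ y → h ∘ j₂ ∘ x ≈ h ∘ j₂ ∘ y
        same₂ x y r = ext hb ∙ b ▷ mi₂ _ _ (ext kb ∙ r ∙ sym (ext kb)) ∙ sym (ext hb)

        shift : ∀ {T T' X Y} {f : K ⇒ X} {u : T ⇒ K} {s : T' ⇒ T} {j : Y ⇒ K} {x : T' ⇒ Y} →
                j ∘ x ≈ u ∘ s → (f ∘ u) ∘ s ≈ f ∘ j ∘ x
        shift p = assoc ∙ _ ▷ sym p

        ker : ∀ {T} (u v : T ⇒ K) → k ∘ u ≈ k ∘ v → h ∘ u ≈ h ∘ v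
        ker u v r = case₂-≈ splits splits u v
          (λ s x y p q → shift p ∙ same₁ x y (sym (shift p) ∙ r ◁ s ∙ shift q) ∙ sym (shift q))
          (λ s x y p q → initial-≈ (disj (a₁ ∘ x) (b₁ ∘ y)
            (ext ka ∙ sym (shift p) ∙ r ◁ s ∙ shift q ∙ sym (ext kb))))
          (λ s x y p q → initial-≈ (disj (a₁ ∘ y) (b₁ ∘ x)
            (ext ka ∙ sym (shift q) ∙ sym r ◁ s ∙ shift p ∙ sym (ext kb))))
          (λ s x y p q → shift p ∙ same₂ x y (sym (shift p) ∙ r ◁ s ∙ shift q) ∙ sym (shift q))

        w : S ⇒ Z
        w = proj₁ (descend h k-cover ker)
        wk : w ∘ k ≈ h
        wk = proj₂ (descend h k-cover ker)

        wi₁ : w ∘ i₁ ≈ a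
        wi₁ with lift k-cover i₁
        ... | T , t , ct , κ , kκ with splits κ
        ... | record { t₁ = t₁ ; t₂ = t₂ ; joint = joint ; u₁ = u₁ ; u₂ = u₂ ; eq₁ = eq₁ ; eq₂ = eq₂ } =
          cover-epi ct (joint-≈ joint
            (assoc ∙ assoc ∙ w ▷ (i₁ ▷ sym a₁u₁ ∙ ext ka) ∙ pull wk ∙ ext ha ∙ a ▷ a₁u₁ ∙ sym assoc)
            (initial-≈ (disj (t ∘ t₂) (b₁ ∘ u₂) (ext (sym kκ) ∙ k ▷ sym eq₂ ∙ sym (ext kb)))))
          where
            a₁u₁ : a₁ ∘ u₁ ≈ t ∘ t₁
            a₁u₁ = mi₁ _ _ (ext ka ∙ k ▷ eq₁ ∙ ext kκ)

        wi₂ : w ∘ i₂ ≈ b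
        wi₂ with lift k-cover i₂
        ... | T , t , ct , κ , kκ with splits κ
        ... | record { t₁ = t₁ ; t₂ = t₂ ; joint = joint ; u₁ = u₁ ; u₂ = u₂ ; eq₁ = eq₁ ; eq₂ = eq₂ } =
          cover-epi ct (joint-≈ joint
            (initial-≈ (disj (a₁ ∘ u₁) (t ∘ t₁) (ext ka ∙ k ▷ eq₁ ∙ ext kκ)))
            (assoc ∙ assoc ∙ w ▷ (i₂ ▷ sym b₁u₂ ∙ ext kb) ∙ pull wk ∙ ext hb ∙ b ▷ b₁u₂ ∙ sym assoc))
          where
            b₁u₂ : b₁ ∘ u₂ ≈ t ∘ t₂
            b₁u₂ = mi₂ _ _ (ext kb ∙ k ▷ eq₂ ∙ ext kκ)

        uniq : ∀ (w' : S ⇒ Z) → w' ∘ i₁ ≈ a → w' ∘ i₂ ≈ b → w' ≈ w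
        uniq w' p q with splits (id {K})
        ... | record { t₁ = t₁ ; t₂ = t₂ ; joint = joint ; u₁ = u₁ ; u₂ = u₂ ; eq₁ = eq₁ ; eq₂ = eq₂ } =
          cover-epi k-cover (joint-≈ joint
            (assoc ∙ w' ▷ (k ▷ (sym identityˡ ∙ sym eq₁) ∙ ext (sym ka)) ∙ pull p ∙ ext (sym ha) ∙
              h ▷ (eq₁ ∙ identityˡ) ∙ sym wk ◁ t₁)
            (assoc ∙ w' ▷ (k ▷ (sym identityˡ ∙ sym eq₂) ∙ ext (sym kb)) ∙ pull q ∙ ext (sym hb) ∙
              h ▷ (eq₂ ∙ identityˡ) ∙ sym wk ◁ t₂))

  -- Equivalence relations as relations on generalised elements

  record EqRel (X : Obj) : Set (o ⊔ ℓ ⊔ e) where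
    field
      {R} : Obj
      r₁ r₂ : R ⇒ X
      equivRel : IsEquivRel r₁ r₂

    infix 4 _~_
    _~_ : ∀ {T} → T ⇒ X → T ⇒ X → Set (ℓ ⊔ e)
    _~_ {T} x y = Σ (T ⇒ R) λ k → (r₁ ∘ k ≈ x) × (r₂ ∘ k ≈ y)

    opaque
      ⟨r⟩-mono : Mono ⟨ r₁ , r₂ ⟩
      ⟨r⟩-mono = ⟨⟩-mono (proj₁ equivRel)

    opaque
      ~⇒⊑ : ∀ {T} {x y : T ⇒ X} → x ~ y → ⟨ x , y ⟩ ⊑ ⟨ r₁ , r₂ ⟩
      ~⇒⊑ (k , p , q) = k , ⊗-unique (pull π₁-β ∙ p ∙ sym π₁-β) (pull π₂-β ∙ q ∙ sym π₂-β)

    opaque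
      ⊑⇒~ : ∀ {T} {x y : T ⇒ X} → ⟨ x , y ⟩ ⊑ ⟨ r₁ , r₂ ⟩ → x ~ y
      ⊑⇒~ (k , p) = k , (push π₁-β ∙ π₁ ▷ p ∙ π₁-β) , (push π₂-β ∙ π₂ ▷ p ∙ π₂-β)

    opaque
      ~-resp : ∀ {T} {x x' y y' : T ⇒ X} → x ≈ x' → y ≈ y' → x ~ y → x' ~ y'
      ~-resp p q (k , s , t) = k , (s ∙ p) , (t ∙ q)

    opaque
      ~-∘ : ∀ {T T'} {x y : T ⇒ X} (t : T' ⇒ T) → x ~ y → x ∘ t ~ y ∘ t
      ~-∘ t (k , p , q) = k ∘ t , pull p , pull q

    opaque
      ~-refl : ∀ {T} {x y : T ⇒ X} → x ≈ y → x ~ y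
      ~-refl {x = x} p with proj₁ (proj₂ equivRel)
      ... | ρ , s , t = ρ ∘ x , cancel s , (cancel t ∙ p)

    opaque
      ~-sym : ∀ {T} {x y : T ⇒ X} → x ~ y → y ~ x
      ~-sym (k , p , q) with proj₁ (proj₂ (proj₂ equivRel))
      ... | σ , s , t = σ ∘ k , (pull s ∙ q) , (pull t ∙ p)

    opaque
      ~-trans : ∀ {T} {x y z : T ⇒ X} → x ~ y → y ~ z → x ~ z
      ~-trans (k , p , q) (l , s , t) with pullback r₂ r₁
      ... | P , p₁ , p₂ , pb with proj₂ (proj₂ (proj₂ equivRel)) p₁ p₂ pb | pb-pair pb k l (q ∙ sym s)
      ... | τ , u , v | w , p₁w , p₂w =
        τ ∘ w , (ext u ∙ r₁ ▷ p₁w ∙ p) , (ext v ∙ r₂ ▷ p₂w ∙ t)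

    opaque
      ~-local : ∀ {T T'} {x y : T ⇒ X} {t : T' ⇒ T} → Cover t → x ∘ t ~ y ∘ t → x ~ y
      ~-local {x = x} {y} ct r with ~⇒⊑ r
      ... | k , p = ⊑⇒~ (⊑-local ⟨r⟩-mono ct
        (k , (p ∙ ⊗-unique (π₁-β ∙ push π₁-β) (π₂-β ∙ push π₂-β))))

  opaque
    mk-equivRel : ∀ {R X} {r₁ r₂ : R ⇒ X} → JointlyMonic r₁ r₂ →
      (Σ (X ⇒ R) λ ρ → (r₁ ∘ ρ ≈ id) × (r₂ ∘ ρ ≈ id)) →
      (Σ (R ⇒ R) λ σ → (r₁ ∘ σ ≈ r₂) × (r₂ ∘ σ ≈ r₁)) →
      (∀ {T} (k l : T ⇒ R) → r₂ ∘ k ≈ r₁ ∘ l → Σ (T ⇒ R) λ τ → (r₁ ∘ τ ≈ r₁ ∘ k) × (r₂ ∘ τ ≈ r₂ ∘ l)) →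
      IsEquivRel r₁ r₂
    mk-equivRel jm ρ σ τ = jm , ρ , σ , λ k l pb → τ k l (pb-comm pb)

-- Coproducts in a positive Heyting category

module Positive {o ℓ e : Level} (C : Category o ℓ e) (hey : IsPositiveHeyting C) where
  open Category C
  open Notions C
  open Regular C (heyting-regular hey) public
  open IsPositiveHeyting hey public
    using (initial; coproduct; disjoint; coproduct-stable; initial-stable; forall-exists)

  opaque
    coproduct-joint : ∀ {A B K} {j₁ : A ⇒ K} {j₂ : B ⇒ K} → IsCoproduct j₁ j₂ → JointlyCovering j₁ j₂
    coproduct-joint {j₁ = j₁} {j₂} cp m mm (a , p) (b , q) with cp a b | cp j₁ j₂
    ... | u , u₁ , u₂ , _ | _ , _ , _ , uniq = section-iso mm
      (uniq (m ∘ u) (assoc ∙ m ▷ u₁ ∙ p) (assoc ∙ m ▷ u₂ ∙ q) ∙ sym (uniq id identityˡ identityˡ))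

  opaque
    coproduct-splits : ∀ {A B K} {j₁ : A ⇒ K} {j₂ : B ⇒ K} → IsCoproduct j₁ j₂ → Splits j₁ j₂
    coproduct-splits {j₁ = j₁} {j₂} cp u with pullback j₁ u | pullback j₂ u
    ... | P , p , t₁ , pb₁ | Q , q , t₂ , pb₂ = record
      { t₁ = t₁ ; t₂ = t₂ ; u₁ = p ; u₂ = q ; eq₁ = pb-comm pb₁ ; eq₂ = pb-comm pb₂
      ; joint = coproduct-joint (coproduct-stable cp u p t₁ q t₂ pb₁ pb₂) }

  opaque
    -- By strictness the map from the initial object to `T` is a mono; both parts factor through it,
    -- so it is invertible.
    joint-initial : ∀ {A B T} {f : A ⇒ T} {g : B ⇒ T} → JointlyCovering f g → IsInitial A → IsInitial B → IsInitial T
    joint-initial {T = T} jc ia ib with initial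
    ... | I , i = initial-stable i (proj₁ (jc (proj₁ (i T)) (λ g h _ → initial-≈ (initial-stable i g))
                                    (initial-⊑ ia) (initial-⊑ ib)))

  opaque
    coproduct-disjoint : ∀ {A B K} {j₁ : A ⇒ K} {j₂ : B ⇒ K} → IsCoproduct j₁ j₂ → Disjoint j₁ j₂
    coproduct-disjoint {j₁ = j₁} {j₂} cp a b r with pullback j₁ j₂
    ... | P , p , q , pb with pb-pair pb a b r
    ... | u , _ = initial-stable (proj₂ (proj₂ (disjoint cp)) p q pb) u

-- Monos, least subobjects and unions under functors preserving the rest

module Preservation {o ℓ e o' ℓ' e' : Level} {C : Category o ℓ e} {D : Category o' ℓ' e'}
    (hC : IsPositiveHeyting C) (hD : IsPositiveHeyting D) (F : Functor C D) where
  private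
    module C where
      open Category C public
      open Notions C public
      open Positive C hC public
    module D where
      open Category D public
      open Notions D public
      open Positive D hD public
  open Functor F
  open D using (_∙_; sym; _▷_; _◁_)

  module _ (pres-pullback : ∀ {P A B D} {p : P C.⇒ A} {q : P C.⇒ B} {f : A C.⇒ D} {g : B C.⇒ D} →
              C.IsPullback p q f g → D.IsPullback (F₁ p) (F₁ q) (F₁ f) (F₁ g)) where
    opaque
      pres-mono : ∀ {A B} {m : A C.⇒ B} → C.Mono m → D.Mono (F₁ m)
      pres-mono mm x y r with D.pb-pair (pres-pullback (C.mono-kernel mm)) x y r
      ... | u , s , t = sym s ∙ t

    module _ (pres-initial : ∀ {I} → C.IsInitial I → D.IsInitial (F₀ I)) where
      opaque
        -- The initial object is a subobject of `X`, so the domain of the least one maps to it and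
        -- is itself initial by strictness.
        pres-least : ∀ {B X} {b : B C.⇒ X} → C.IsLeastSub b → D.IsLeastSub (F₁ b)
        pres-least {X = X} {b} (mb , least) with C.initial
        ... | Z , zi with least (proj₁ (zi X)) (λ g h _ → C.initial-≈ (C.initial-stable zi g))
        ... | k , _ = pres-mono mb , λ w mw → D.initial-⊑ (pres-initial (C.initial-stable zi k))

      module _ (pres-cover : ∀ {A B} {f : A C.⇒ B} → C.Cover f → D.Cover (F₁ f))
               (pres-coproduct : ∀ {S A B} {i₁ : A C.⇒ S} {i₂ : B C.⇒ S} →
                  C.IsCoproduct i₁ i₂ → D.IsCoproduct (F₁ i₁) (F₁ i₂)) where
        opaque
          -- Minimality of `u` makes the map from the coproduct of `M` and `N` to its domain a
          -- cover. Both the coproduct and the cover are preserved, so the image of `u` is again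
          -- covered by the two parts.
          pres-union : ∀ {M N U X} {m : M C.⇒ X} {n : N C.⇒ X} {u : U C.⇒ X} →
            C.Mono m → C.Mono n → C.IsUnion m n u → D.IsUnion (F₁ m) (F₁ n) (F₁ u)
          pres-union {M} {N} {m = m} {n} {u} mm mn (mu , (k , uk) , (l , ul) , least)
            with C.coproduct M N
          ... | S , i₁ , i₂ , cp with cp k l
          ... | c , ci₁ , ci₂ , _ = pres-mono mu , (F₁ k , (sym homomorphism ∙ F-resp-≈ uk)) ,
                  (F₁ l , (sym homomorphism ∙ F-resp-≈ ul)) , least'
            where
              c-cover : C.Cover c
              c-cover v g mv c≈vg with least (u C.∘ v) (C.mono-∘ mu mv)
                  (g C.∘ i₁ , (C.assoc C.∙ u C.▷ (C.pull (C.sym c≈vg) C.∙ ci₁) C.∙ uk))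
                  (g C.∘ i₂ , (C.assoc C.∙ u C.▷ (C.pull (C.sym c≈vg) C.∙ ci₂) C.∙ ul))
              ... | j , uvj = C.section-iso mv (mu _ _ (C.sym C.assoc C.∙ uvj C.∙ C.sym C.identityʳ))

              least' : ∀ {W} (w : W D.⇒ F₀ _) → D.Mono w → F₁ m D.⊑ w → F₁ n D.⊑ w → F₁ u D.⊑ w
              least' w mw (a , wa) (b , wb) = D.⊑-local mw (pres-cover c-cover)
                (D.joint-⊑ (D.coproduct-joint (pres-coproduct cp)) mw
                  (a , (wa ∙ sym (F-resp-≈ uk) ∙ homomorphism ∙ F₁ u ▷ (F-resp-≈ (C.sym ci₁) ∙ homomorphism)
                        ∙ sym D.assoc))
                  (b , (wb ∙ sym (F-resp-≈ ul) ∙ homomorphism ∙ F₁ u ▷ (F-resp-≈ (C.sym ci₂) ∙ homomorphism)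
                        ∙ sym D.assoc)))

-- Closure properties of small maps

module SmallMaps {o ℓ e s : Level} (E : CatWithSmallMaps o ℓ e s) where
  open CatWithSmallMaps E public
  open Category cat public
  open Notions cat public
  open Positive cat heyting public
  open IsSmallMaps small public

  opaque
    -- Every identity is a pullback of the one on `⊤`, and an isomorphism is a pullback of the
    -- identity of its codomain.
    iso-small : ∀ {A B} {i : A ⇒ B} → IsIso i → S i
    iso-small {i = i} (j , ji , ij) = A1 {p = i} {q = i} {f = id} {g = id}
      (refl , λ a b r → j ∘ a , cancel ij , (cancel ij ∙ sym identityˡ ∙ r ∙ identityˡ) ,
         λ u s _ → sym (cancel ji) ∙ j ▷ s)
      (A1 (pb-id {f = !}) (A4-1 ⊤-terminal id))

  opaque
    -- The cover onto the pullback makes `p₁` small by `A6`, and `A2` descends smallness along `p`.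
    covered-small : ∀ {A B C' D} {t : A ⇒ B} {f : A ⇒ C'} {g : B ⇒ D} {p : C' ⇒ D} →
                    IsCoveringSquare t f g p → S f → S g
    covered-small {f = f} {g} {p} (comm , cp , cov) sf with pullback p g
    ... | P , p₁ , p₂ , pb with pb-pair pb f _ (sym comm)
    ... | u , p₁u , p₂u = A2 (pb-swap pb) cp (A6 (sym p₁u) (cov p₁ p₂ pb u p₁u p₂u) sf)

  opaque
    -- An equaliser is a pullback of the diagonal of `B`, which is small by `A9`.
    equalizer-small : ∀ {A B I} {f g : A ⇒ B} {i : I ⇒ A} → Mono i → f ∘ i ≈ g ∘ i →
                      (∀ {T} (t : T ⇒ A) → f ∘ t ≈ g ∘ t → t ⊑ i) → S i
    equalizer-small {A} {B} {I} {f} {g} {i} mi fi univ =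
      A1 {p = f ∘ i} {q = i} {f = ⟨ id , id ⟩} {g = ⟨ f , g ⟩} (comm , λ a b r →
        proj₁ (fac a b r) ,
        (assoc ∙ f ▷ proj₂ (fac a b r) ∙ fst a b r) , proj₂ (fac a b r) ,
        λ u _ q → mi _ _ (q ∙ sym (proj₂ (fac a b r))))
        (A9 ⊗-product ⟨ id , id ⟩ π₁-β π₂-β)
      where
        comm : ⟨ id , id ⟩ ∘ f ∘ i ≈ ⟨ f , g ⟩ ∘ i
        comm = ⊗-unique (pull π₁-β ∙ identityˡ ∙ push π₁-β) (pull π₂-β ∙ identityˡ ∙ fi ∙ push π₂-β)
        fst : ∀ {Z} (a : Z ⇒ B) (b : Z ⇒ A) → ⟨ id , id ⟩ ∘ a ≈ ⟨ f , g ⟩ ∘ b → f ∘ b ≈ a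
        fst a b r = push π₁-β ∙ π₁ ▷ sym r ∙ pull π₁-β ∙ identityˡ
        fac : ∀ {Z} (a : Z ⇒ B) (b : Z ⇒ A) → ⟨ id , id ⟩ ∘ a ≈ ⟨ f , g ⟩ ∘ b → b ⊑ i
        fac a b r = univ b (fst a b r ∙ sym identityˡ ∙ push π₂-β ∙ π₂ ▷ r ∙ pull π₂-β)

  opaque
    -- The product of two maps is the composite of a pullback of one with a pullback of the other.
    ⊗-small : ∀ {A B X Y} {f : A ⇒ B} {g : X ⇒ Y} {u : A ⊗ X ⇒ B ⊗ Y} →
              π₁ ∘ u ≈ f ∘ π₁ → π₂ ∘ u ≈ g ∘ π₂ → S f → S g → S u
    ⊗-small {A} {B} {X} {Y} {f} {g} {u} p q sf sg = S-resp-≈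
      (⊗-unique (pull π₁-β ∙ assoc ∙ f ▷ π₁-β ∙ sym p) (pull π₂-β ∙ π₂-β ∙ sym q))
      (A5 (A1 pb₂ sg) (A1 pb₁ sf))
      where
        pb₁ : IsPullback (π₁ {A} {Y}) ⟨ f ∘ π₁ , π₂ ⟩ f π₁
        pb₁ = sym π₁-β , λ a b r → ⟨ a , π₂ ∘ b ⟩ , π₁-β ,
          ⊗-unique (pull π₁-β ∙ assoc ∙ f ▷ π₁-β ∙ r) (pull π₂-β ∙ π₂-β) ,
          λ u' s t → ⊗-unique (s ∙ sym π₁-β) (push π₂-β ∙ π₂ ▷ t ∙ sym π₂-β)
        pb₂ : IsPullback (π₂ {A} {X}) ⟨ π₁ , g ∘ π₂ ⟩ g π₂
        pb₂ = sym π₂-β , λ a b r → ⟨ π₁ ∘ b , a ⟩ , π₂-β ,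
          ⊗-unique (pull π₁-β ∙ π₁-β) (pull π₂-β ∙ assoc ∙ g ▷ π₂-β ∙ r) ,
          λ u' s t → ⊗-unique (push π₁-β ∙ π₁ ▷ t ∙ sym π₁-β) (s ∙ sym π₂-β)

  opaque
    bounded-⟨⟩ : ∀ {R X} {r₁ r₂ : R ⇒ X} → IsBoundedRel E r₁ r₂ → S ⟨ r₁ , r₂ ⟩
    bounded-⟨⟩ bd = bd π₁ π₂ ⊗-product ⟨ _ , _ ⟩ π₁-β π₂-β

  opaque
    ⟨⟩-bounded : ∀ {R X} {r₁ r₂ : R ⇒ X} → S ⟨ r₁ , r₂ ⟩ → IsBoundedRel E r₁ r₂
    ⟨⟩-bounded {r₁ = r₁} {r₂} sr p₁ p₂ prod u p₁u p₂u with prod π₁ π₂ | prod p₁ p₂ | prod r₁ r₂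
    ... | w , p₁w , p₂w , _ | _ , _ , _ , uniq | _ , _ , _ , uniq' = S-resp-≈
        (uniq' _ (pull p₁w ∙ π₁-β) (pull p₂w ∙ π₂-β) ∙ sym (uniq' u p₁u p₂u))
        (A5 sr (iso-small (⟨ p₁ , p₂ ⟩ ,
          ⊗-unique (pull π₁-β ∙ p₁w ∙ sym identityʳ) (pull π₂-β ∙ p₂w ∙ sym identityʳ) ,
          (uniq _ (pull p₁w ∙ π₁-β) (pull p₂w ∙ π₂-β) ∙ sym (uniq id identityʳ identityʳ)))))

  opaque
    -- `h` is the sum of its two restrictions followed by the codiagonal of `P`. The codiagonal is
    -- the pullback of `1 + 1 → 1` along `P → 1`, and by stability this pullback `Q` is a coproduct
    -- of two copies of `P`.
    copair-small : ∀ {A B K P} {i₁ : A ⇒ K} {i₂ : B ⇒ K} {h : K ⇒ P} → IsCoproduct i₁ i₂ →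
                   S (h ∘ i₁) → S (h ∘ i₂) → S h
    copair-small {P = P} {i₁} {i₂} {h} cp s₁ s₂ with coproduct ⊤ ⊤
    ... | U , κ₁ , κ₂ , cpU with pullback (! {U}) (! {P})
    ... | Q , a , b , pb with pb-pair pb (κ₁ ∘ !) id !-unique | pb-pair pb (κ₂ ∘ !) id !-unique
    ... | l₁ , al₁ , bl₁ | l₂ , al₂ , bl₂ with cp (l₁ ∘ h ∘ i₁) (l₂ ∘ h ∘ i₂) | cp (h ∘ i₁) (h ∘ i₂)
    ... | m , mi₁ , mi₂ , _ | _ , _ , _ , uniq = S-resp-≈
        (uniq (b ∘ m) (assoc ∙ b ▷ mi₁ ∙ cancel bl₁) (assoc ∙ b ▷ mi₂ ∙ cancel bl₂) ∙ sym (uniq h refl refl))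
        (A5 (A3 cp (coproduct-stable cpU a ! l₁ ! l₂ (slice al₁ bl₁) (slice al₂ bl₂)) s₁ s₂ m mi₁ mi₂)
            (A1 pb (A4-2 ⊤-terminal cpU !)))
      where
        slice : ∀ {κ : ⊤ ⇒ U} {l : P ⇒ Q} → a ∘ l ≈ κ ∘ ! → b ∘ l ≈ id → IsPullback ! l κ a
        slice {κ} {l} al bl = sym al , λ x y r → b ∘ y , !-unique ,
          pb-jm pb (pull al ∙ assoc ∙ κ ▷ !-unique ∙ r) (cancel bl) ,
          λ u _ t → sym (cancel bl) ∙ b ▷ t

  opaque
    -- The map `d` to `1 + 1` tells the two summands apart, so each injection is the equaliser of
    -- `d` with a constant map.
    injection-small : ∀ {A B K} {i₁ : A ⇒ K} {i₂ : B ⇒ K} → IsCoproduct i₁ i₂ → S i₁ × S i₂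
    injection-small {i₁ = i₁} {i₂} cp with coproduct ⊤ ⊤
    ... | U , κ₁ , κ₂ , cpU with cp (κ₁ ∘ !) (κ₂ ∘ !)
    ... | d , di₁ , di₂ , _ =
        equalizer-small (proj₁ (disjoint cp)) (di₁ ∙ κ₁ ▷ !-unique ∙ sym assoc) univ₁ ,
        equalizer-small (proj₁ (proj₂ (disjoint cp))) (di₂ ∙ κ₂ ▷ !-unique ∙ sym assoc) univ₂
      where
        univ₁ : ∀ {T} (t : T ⇒ _) → d ∘ t ≈ (κ₁ ∘ !) ∘ t → t ⊑ i₁
        univ₁ t r with coproduct-splits cp t
        ... | record { t₁ = t₁ ; t₂ = t₂ ; joint = joint ; u₁ = u₁ ; u₂ = u₂ ; eq₁ = eq₁ ; eq₂ = eq₂ } =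
          joint-⊑ joint (proj₁ (disjoint cp)) (u₁ , eq₁) (initial-⊑ (coproduct-disjoint cpU (! ∘ t ∘ t₂) (! ∘ u₂)
            (sym assoc ∙ sym (ext r) ∙ d ▷ sym eq₂ ∙ ext di₂)))
        univ₂ : ∀ {T} (t : T ⇒ _) → d ∘ t ≈ (κ₂ ∘ !) ∘ t → t ⊑ i₂
        univ₂ t r with coproduct-splits cp t
        ... | record { t₁ = t₁ ; t₂ = t₂ ; joint = joint ; u₁ = u₁ ; u₂ = u₂ ; eq₁ = eq₁ ; eq₂ = eq₂ } =
          joint-⊑ joint (proj₁ (proj₂ (disjoint cp))) (initial-⊑ (coproduct-disjoint cpU (! ∘ u₁) (! ∘ t ∘ t₁)
            (sym (ext di₁) ∙ d ▷ eq₁ ∙ ext r ∙ assoc))) (u₂ , eq₂)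

  -- The sum of two bounded equivalence relations

  module _ {X Y K : Obj} (ρ : EqRel X) (ς : EqRel Y) {i₁ : X ⇒ K} {i₂ : Y ⇒ K} (cp : IsCoproduct i₁ i₂)
           {L : Obj} {κ₁ : EqRel.R ρ ⇒ L} {κ₂ : EqRel.R ς ⇒ L} (cpL : IsCoproduct κ₁ κ₂)
           {s₁ s₂ : L ⇒ K}
           (s₁κ₁ : s₁ ∘ κ₁ ≈ i₁ ∘ EqRel.r₁ ρ) (s₁κ₂ : s₁ ∘ κ₂ ≈ i₂ ∘ EqRel.r₁ ς)
           (s₂κ₁ : s₂ ∘ κ₁ ≈ i₁ ∘ EqRel.r₂ ρ) (s₂κ₂ : s₂ ∘ κ₂ ≈ i₂ ∘ EqRel.r₂ ς) where
    private
      module ρ = EqRel ρ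
      module ς = EqRel ς

    opaque
      via : ∀ {A T T' V} {s : L ⇒ K} {κ : A ⇒ L} {i : V ⇒ K} {r : A ⇒ V} {a : T' ⇒ A} {u : T ⇒ L} {t : T' ⇒ T}
            {x : T ⇒ K} → s ∘ κ ≈ i ∘ r → κ ∘ a ≈ u ∘ t → s ∘ u ≈ x → i ∘ r ∘ a ≈ x ∘ t
      via {s = s} p q r = sym (ext p) ∙ s ▷ q ∙ pull r

    opaque
      sum-jm : JointlyMonic s₁ s₂
      sum-jm g h p q = case₂-≈ (coproduct-splits cpL) (coproduct-splits cpL) g h
        (λ t a b u v → sym u ∙ κ₁ ▷ proj₁ ρ.equivRel a b
          (proj₁ (disjoint cp) _ _ (via s₁κ₁ u p ∙ sym (via s₁κ₁ v refl)))
          (proj₁ (disjoint cp) _ _ (via s₂κ₁ u q ∙ sym (via s₂κ₁ v refl))) ∙ v)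
        (λ t a b u v → initial-≈ (coproduct-disjoint cp _ _ (via s₁κ₁ u p ∙ sym (via s₁κ₂ v refl))))
        (λ t a b u v → initial-≈ (coproduct-disjoint cp _ _ (via s₁κ₁ v refl ∙ sym (via s₁κ₂ u p))))
        (λ t a b u v → sym u ∙ κ₂ ▷ proj₁ ς.equivRel a b
          (proj₁ (proj₂ (disjoint cp)) _ _ (via s₁κ₂ u p ∙ sym (via s₁κ₂ v refl)))
          (proj₁ (proj₂ (disjoint cp)) _ _ (via s₂κ₂ u q ∙ sym (via s₂κ₂ v refl))) ∙ v)

    opaque
      sum-refl : Σ (K ⇒ L) λ r → (s₁ ∘ r ≈ id) × (s₂ ∘ r ≈ id)
      sum-refl with proj₁ (proj₂ ρ.equivRel) | proj₁ (proj₂ ς.equivRel)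
      ... | a , a₁ , a₂ | b , b₁ , b₂ with cp (κ₁ ∘ a) (κ₂ ∘ b)
      ... | r , ri₁ , ri₂ , _ = r ,
        joint-≈ (coproduct-joint cp) (go s₁κ₁ ri₁ a₁) (go s₁κ₂ ri₂ b₁) ,
        joint-≈ (coproduct-joint cp) (go s₂κ₁ ri₁ a₂) (go s₂κ₂ ri₂ b₂)
        where
          go : ∀ {A V} {s : L ⇒ K} {κ : A ⇒ L} {i : V ⇒ K} {r' : A ⇒ V} {a : V ⇒ A} →
               s ∘ κ ≈ i ∘ r' → r ∘ i ≈ κ ∘ a → r' ∘ a ≈ id → (s ∘ r) ∘ i ≈ id ∘ i
          go {s = s} {i = i} p q u = assoc ∙ s ▷ q ∙ ext p ∙ i ▷ u ∙ identityʳ ∙ sym identityˡ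

    opaque
      sum-sym : Σ (L ⇒ L) λ r → (s₁ ∘ r ≈ s₂) × (s₂ ∘ r ≈ s₁)
      sum-sym with proj₁ (proj₂ (proj₂ ρ.equivRel)) | proj₁ (proj₂ (proj₂ ς.equivRel))
      ... | a , a₁ , a₂ | b , b₁ , b₂ with cpL (κ₁ ∘ a) (κ₂ ∘ b)
      ... | r , rκ₁ , rκ₂ , _ = r ,
        joint-≈ (coproduct-joint cpL) (go s₁κ₁ rκ₁ a₁ s₂κ₁) (go s₁κ₂ rκ₂ b₁ s₂κ₂) ,
        joint-≈ (coproduct-joint cpL) (go s₂κ₁ rκ₁ a₂ s₁κ₁) (go s₂κ₂ rκ₂ b₂ s₁κ₂)
        where
          go : ∀ {A V} {s s' : L ⇒ K} {κ : A ⇒ L} {i : V ⇒ K} {r' r'' : A ⇒ V} {a : A ⇒ A} →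
               s ∘ κ ≈ i ∘ r' → r ∘ κ ≈ κ ∘ a → r' ∘ a ≈ r'' → s' ∘ κ ≈ i ∘ r'' → (s ∘ r) ∘ κ ≈ s' ∘ κ
          go {s = s} {i = i} p q u v = assoc ∙ s ▷ q ∙ ext p ∙ i ▷ u ∙ sym v

    opaque
      -- Since `⟨ s₁ , s₂ ⟩` is monic, the existence of a composite is membership in a subobject and
      -- may be checked case by case; when the two links lie in different summands the stage is
      -- initial.
      sum-trans : ∀ {T} (k l : T ⇒ L) → s₂ ∘ k ≈ s₁ ∘ l →
                  Σ (T ⇒ L) λ t → (s₁ ∘ t ≈ s₁ ∘ k) × (s₂ ∘ t ≈ s₂ ∘ l)
      sum-trans k l r with case₂-⊑ (coproduct-splits cpL) (coproduct-splits cpL) k l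
          {x = ⟨ s₁ ∘ k , s₂ ∘ l ⟩} {⟨ s₁ , s₂ ⟩} (⟨⟩-mono sum-jm)
          (λ t a b u v → comp t s₁κ₁ s₂κ₁ u v
            (ρ.~-trans (a , refl , refl) (b , proj₁ (disjoint cp) _ _
              (via s₁κ₁ v (sym r) ∙ sym (via s₂κ₁ u refl)) , refl)))
          (λ t a b u v → initial-⊑ (coproduct-disjoint cp _ _ (via s₂κ₁ u r ∙ sym (via s₁κ₂ v refl))))
          (λ t a b u v → initial-⊑ (coproduct-disjoint cp _ _ (via s₁κ₁ v refl ∙ sym (via s₂κ₂ u r))))
          (λ t a b u v → comp t s₁κ₂ s₂κ₂ u v
            (ς.~-trans (a , refl , refl) (b , proj₁ (proj₂ (disjoint cp)) _ _
              (via s₁κ₂ v (sym r) ∙ sym (via s₂κ₂ u refl)) , refl)))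
        where
          comp : ∀ {A V T'} (t : T' ⇒ _) {κ : A ⇒ L} {i : V ⇒ K} {r' r'' : A ⇒ V} {a b : T' ⇒ A} →
                 s₁ ∘ κ ≈ i ∘ r' → s₂ ∘ κ ≈ i ∘ r'' → κ ∘ a ≈ k ∘ t → κ ∘ b ≈ l ∘ t →
                 (Σ (T' ⇒ A) λ c → (r' ∘ c ≈ r' ∘ a) × (r'' ∘ c ≈ r'' ∘ b)) →
                 ⟨ s₁ ∘ k , s₂ ∘ l ⟩ ∘ t ⊑ ⟨ s₁ , s₂ ⟩
          comp t {κ} {i} p q u v (c , c₁ , c₂) = κ ∘ c , ⊗-unique
            (pull π₁-β ∙ ext p ∙ i ▷ c₁ ∙ via p u refl ∙ push π₁-β)
            (pull π₂-β ∙ ext q ∙ i ▷ c₂ ∙ via q v refl ∙ push π₂-β)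
      ... | w , p = w , (push π₁-β ∙ π₁ ▷ p ∙ π₁-β) , (push π₂-β ∙ π₂ ▷ p ∙ π₂-β)

    opaque
      sum-equivRel : IsEquivRel s₁ s₂
      sum-equivRel = mk-equivRel sum-jm sum-refl sum-sym sum-trans

    opaque
      -- On each summand the relation is a bounded relation followed by the square of a small
      -- injection; `copair-small` combines the two.
      sum-bounded : IsBoundedRel E ρ.r₁ ρ.r₂ → IsBoundedRel E ς.r₁ ς.r₂ → IsBoundedRel E s₁ s₂
      sum-bounded bρ bς = ⟨⟩-bounded (copair-small cpL
        (part (proj₁ (injection-small cp)) (bounded-⟨⟩ bρ) s₁κ₁ s₂κ₁)
        (part (proj₂ (injection-small cp)) (bounded-⟨⟩ bς) s₁κ₂ s₂κ₂))
        where
          part : ∀ {A V} {κ : A ⇒ L} {i : V ⇒ K} {r' r'' : A ⇒ V} → S i → S ⟨ r' , r'' ⟩ →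
                 s₁ ∘ κ ≈ i ∘ r' → s₂ ∘ κ ≈ i ∘ r'' → S (⟨ s₁ , s₂ ⟩ ∘ κ)
          part {i = i} si sr p q = S-resp-≈
            (⊗-unique (pull π₁-β ∙ assoc ∙ i ▷ π₁-β ∙ sym p ∙ push π₁-β)
                      (pull π₂-β ∙ assoc ∙ i ▷ π₂-β ∙ sym q ∙ push π₂-β))
            (A5 sr (⊗-small {u = ⟨ i ∘ π₁ , i ∘ π₂ ⟩} π₁-β π₂-β si si))

-- Presentations and the abstract properties of y

module EqRelNotation {o ℓ e s : Level} (E : CatWithSmallMaps o ℓ e s) where
  open CatWithSmallMaps E public
  open Category cat public
  open Notions cat public

  EqRel : Obj → Set (o ⊔ ℓ ⊔ e)
  EqRel = Regular.EqRel cat (heyting-regular heyting)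

  module EqRel {X : Obj} (ρ : EqRel X) = Regular.EqRel {C = cat} {reg = heyting-regular heyting} ρ

record Presentation {o ℓ e s o₁ ℓ₁ e₁ : Level} (E : CatWithSmallMaps o ℓ e s) {C̄ : Category o₁ ℓ₁ e₁}
    (Y : Functor (CatWithSmallMaps.cat E) C̄) (A : Category.Obj C̄) : Set (o ⊔ ℓ ⊔ e ⊔ s ⊔ o₁ ⊔ ℓ₁ ⊔ e₁) where
  private
    module E = EqRelNotation E
  open Category C̄
  open Notions C̄
  open Functor Y renaming (F₀ to Y₀; F₁ to Y₁)
  field
    {X} : E.Obj
    rel : E.EqRel X
    bounded : IsBoundedRel E (E.EqRel.r₁ rel) (E.EqRel.r₂ rel)
    q : Y₀ X ⇒ A
    q-cover : Cover q
    q-kernel : IsPullback (Y₁ (E.EqRel.r₁ rel)) (Y₁ (E.EqRel.r₂ rel)) q q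

-- The properties of y : E → Ē from which everything else about the completion follows.
record Envelope : Setω where
  field
    {o ℓ e s o₁ ℓ₁ e₁} : Level
    E : CatWithSmallMaps o ℓ e s
  private
    module E = EqRelNotation E
  field
    C̄ : Category o₁ ℓ₁ e₁
    regular : IsRegular C̄
    Y : Functor E.cat C̄
  open Category C̄
  open Notions C̄
  open Functor Y renaming (F₀ to Y₀; F₁ to Y₁)
  field
    y-full : ∀ {A B} (g : Y₀ A ⇒ Y₀ B) → Σ (A E.⇒ B) λ f → Y₁ f ≈ g
    y-faithful : ∀ {A B} {f g : A E.⇒ B} → Y₁ f ≈ Y₁ g → f E.≈ g
    y-cover : ∀ {A B} {f : A E.⇒ B} → E.Cover f → Cover (Y₁ f)
    present : ∀ A → Presentation E Y A
    effective : ∀ {X} (rel : E.EqRel X) → IsBoundedRel E (E.EqRel.r₁ rel) (E.EqRel.r₂ rel) →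
      Σ Obj λ A → Σ (Y₀ X ⇒ A) λ q → Cover q ×
        IsPullback (Y₁ (E.EqRel.r₁ rel)) (Y₁ (E.EqRel.r₂ rel)) q q

-- What y preserves and reflects

module EnvelopeTheory (V : Envelope) where
  open Envelope V public
  module E = SmallMaps E
  open Category C̄ public
  open Notions C̄ public
  open Regular C̄ regular public
  open Functor Y public renaming
    (F₀ to Y₀; F₁ to Y₁; identity to y-id; homomorphism to y-∘; F-resp-≈ to y-resp)
  module P (A : Obj) = Presentation (present A)

  opaque
    y-tri : ∀ {A B D} {f : A E.⇒ B} {g : B E.⇒ D} {h : A E.⇒ D} → g E.∘ f E.≈ h → Y₁ g ∘ Y₁ f ≈ Y₁ h
    y-tri p = sym y-∘ ∙ y-resp p

  opaque
    y-square : ∀ {A B B' D} {f : A E.⇒ B} {g : B E.⇒ D} {f' : A E.⇒ B'} {g' : B' E.⇒ D} →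
               g E.∘ f E.≈ g' E.∘ f' → Y₁ g ∘ Y₁ f ≈ Y₁ g' ∘ Y₁ f'
    y-square p = y-tri p ∙ y-∘

  opaque
    y-square⁻¹ : ∀ {A B B' D} {f : A E.⇒ B} {g : B E.⇒ D} {f' : A E.⇒ B'} {g' : B' E.⇒ D} →
                 Y₁ g ∘ Y₁ f ≈ Y₁ g' ∘ Y₁ f' → g E.∘ f E.≈ g' E.∘ f'
    y-square⁻¹ p = y-faithful (y-∘ ∙ p ∙ sym y-∘)

  opaque
    y-tri⁻¹ : ∀ {A B D} {f : A E.⇒ B} {g : B E.⇒ D} {h : A E.⇒ D} → Y₁ g ∘ Y₁ f ≈ Y₁ h → g E.∘ f E.≈ h
    y-tri⁻¹ p = y-faithful (y-∘ ∙ p)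

  opaque
    y-iso-reflect : ∀ {A B} {f : A E.⇒ B} → IsIso (Y₁ f) → E.IsIso f
    y-iso-reflect {f = f} (j , p , q) with y-full j
    ... | j₀ , r = j₀ , y-tri⁻¹ (r ◁ Y₁ f ∙ p ∙ sym y-id) , y-tri⁻¹ (Y₁ f ▷ r ∙ q ∙ sym y-id)

  opaque
    -- Reduces elements at an arbitrary stage `Z` of Ē to maps of E: restricted along the cover
    -- `P.q Z`, an element of `Y₀ A` is a map between objects of E, to which fullness applies.
    probe : ∀ {Z A} (a : Z ⇒ Y₀ A) → Σ (P.X Z E.⇒ A) λ a₀ → Y₁ a₀ ≈ a ∘ P.q Z
    probe {Z} a = y-full (a ∘ P.q Z)

  opaque
    y-mono : ∀ {A B} {m : A E.⇒ B} → E.Mono m → Mono (Y₁ m)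
    y-mono {m = m} mm {Z} g h p with probe g | probe h
    ... | g₀ , g≈ | h₀ , h≈ = cover-epi (P.q-cover Z)
      (sym g≈ ∙ y-resp (mm g₀ h₀ (y-square⁻¹ (Y₁ m ▷ g≈ ∙ pull p ∙ assoc ∙ Y₁ m ▷ sym h≈))) ∙ h≈)

  opaque
    y-mono-reflect : ∀ {A B} {m : A E.⇒ B} → Mono (Y₁ m) → E.Mono m
    y-mono-reflect mm g h p = y-faithful (mm _ _ (y-square p))

  opaque
    -- A mono of E through which `f` factors stays a mono under y, so it becomes invertible there,
    -- and full and faithful functors reflect isomorphisms.
    y-cover-reflect : ∀ {A B} {f : A E.⇒ B} → Cover (Y₁ f) → E.Cover f
    y-cover-reflect c m g mm p = y-iso-reflect (c (Y₁ m) (Y₁ g) (y-mono mm) (y-resp p ∙ y-∘))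

  opaque
    -- Refines `lift` so that the new stage and the cover leading to it lie in E.
    locally : ∀ {T A B} {f : A ⇒ B} → Cover f → (y : Y₀ T ⇒ B) →
      Σ E.Obj λ T' → Σ (T' E.⇒ T) λ t → E.Cover t × Σ (Y₀ T' ⇒ A) λ a → f ∘ a ≈ y ∘ Y₁ t
    locally {f = f} cf y with lift cf y
    ... | Z , z , cz , a , fa with probe z
    ... | t , t≈ = P.X Z , t , y-cover-reflect (cover-resp (sym t≈) (cover-∘ cz (P.q-cover Z))) ,
          a ∘ P.q Z , (pull fa ∙ assoc ∙ y ▷ sym t≈)

  opaque
    locally-X : ∀ {T A} (y : Y₀ T ⇒ A) →
      Σ E.Obj λ T' → Σ (T' E.⇒ T) λ t → E.Cover t × Σ (T' E.⇒ P.X A) λ x → P.q A ∘ Y₁ x ≈ y ∘ Y₁ t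
    locally-X {A = A} y with locally (P.q-cover A) y
    ... | T' , t , ct , a , p with y-full a
    ... | x , x≈ = T' , t , ct , x , (P.q A ▷ x≈ ∙ p)

  opaque
    y-pullback : ∀ {P A B D} {p : P E.⇒ A} {q : P E.⇒ B} {f : A E.⇒ D} {g : B E.⇒ D} →
      E.IsPullback p q f g → IsPullback (Y₁ p) (Y₁ q) (Y₁ f) (Y₁ g)
    y-pullback {P} {A} {B} {p = p} {q} {f} {g} pb = mk-pullback (y-square (E.pb-comm pb)) jm sur
      where
        jm : ∀ {Z} {x y : Z ⇒ Y₀ P} → Y₁ p ∘ x ≈ Y₁ p ∘ y → Y₁ q ∘ x ≈ Y₁ q ∘ y → x ≈ y
        jm {Z} {x} {y} r r' with probe x | probe y
        ... | x₀ , x≈ | y₀ , y≈ = cover-epi (P.q-cover Z) (sym x≈ ∙ y-resp (E.pb-jm pb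
              (y-square⁻¹ (Y₁ p ▷ x≈ ∙ pull r ∙ assoc ∙ Y₁ p ▷ sym y≈))
              (y-square⁻¹ (Y₁ q ▷ x≈ ∙ pull r' ∙ assoc ∙ Y₁ q ▷ sym y≈))) ∙ y≈)
        sur : ∀ {Z} (a : Z ⇒ Y₀ A) (b : Z ⇒ Y₀ B) → Y₁ f ∘ a ≈ Y₁ g ∘ b → Σ Obj λ T → Σ (T ⇒ Z) λ t → Cover t ×
              Σ (T ⇒ Y₀ P) λ w → (Y₁ p ∘ w ≈ a ∘ t) × (Y₁ q ∘ w ≈ b ∘ t)
        sur {Z} a b r with probe a | probe b
        ... | a₀ , a≈ | b₀ , b≈ with E.pb-pair pb a₀ b₀ (y-square⁻¹ (Y₁ f ▷ a≈ ∙ ext r ∙ Y₁ g ▷ sym b≈))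
        ... | u , pu , qu = _ , P.q Z , P.q-cover Z , Y₁ u , (y-tri pu ∙ a≈) , (y-tri qu ∙ b≈)

  opaque
    y-terminal-unique : ∀ {T Z} → E.IsTerminal T → (f g : Z ⇒ Y₀ T) → f ≈ g
    y-terminal-unique {Z = Z} term f g with probe f | probe g
    ... | f₀ , f≈ | g₀ , g≈ = cover-epi (P.q-cover Z)
      (sym f≈ ∙ y-resp (proj₂ (term _) f₀ E.∙ E.sym (proj₂ (term _) g₀)) ∙ g≈)

  opaque
    y-terminal : ∀ {T} → E.IsTerminal T → IsTerminal (Y₀ T)
    y-terminal term Z with descend (Y₁ (proj₁ (term (P.X Z)))) (P.q-cover Z)
                                   (λ _ _ _ → y-terminal-unique term _ _)
    ... | k , _ = k , λ h → y-terminal-unique term h k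

  opaque
    y-⊑ : ∀ {A B X} {m : A E.⇒ X} {n : B E.⇒ X} → m E.⊑ n → Y₁ m ⊑ Y₁ n
    y-⊑ (k , p) = Y₁ k , y-tri p

  opaque
    y-⊑-reflect : ∀ {A B X} {m : A E.⇒ X} {n : B E.⇒ X} → Y₁ m ⊑ Y₁ n → m E.⊑ n
    y-⊑-reflect {n = n} (k , p) with y-full k
    ... | k₀ , k≈ = k₀ , y-tri⁻¹ (Y₁ n ▷ k≈ ∙ p)

  opaque
    -- Up to the cover `P.q N`, the mono `n` is a map `f` of E, and the image of `f` taken in E
    -- represents `n`: both are images of `n ∘ P.q N`.
    sub-rep : ∀ {N X} (n : N ⇒ Y₀ X) → Mono n →
      Σ E.Obj λ M → Σ (M E.⇒ X) λ m → E.Mono m × (Y₁ m ⊑ n) × (n ⊑ Y₁ m)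
    sub-rep {N} n mn with probe n
    ... | f , f≈ with E.factor f
    ... | M , c , m , cc , mm , f≈mc = M , m , mm ,
          ⊑-local mn (y-cover cc) (P.q N , (sym f≈ ∙ y-resp f≈mc ∙ y-∘)) ,
          ⊑-local (y-mono mm) (P.q-cover N) (Y₁ c , (y-tri (E.sym f≈mc) ∙ f≈))

  opaque
    sub-pullback : ∀ {M X A N} {m : M ⇒ A} → Mono m → (t : Y₀ X ⇒ A) {k : N ⇒ M} {n : N ⇒ Y₀ X} →
      IsPullback k n m t →
      Σ E.Obj λ M₀ → Σ (M₀ E.⇒ X) λ m₀ → E.Mono m₀ × Σ (Y₀ M₀ ⇒ M) λ k₀ → IsPullback k₀ (Y₁ m₀) m t
    sub-pullback {M} {X} {A} {N} {m} mm t {k} {n} pb with sub-rep n (pb-mono pb mm)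
    ... | M₀ , m₀ , mm₀ , (a , na) , (b , mb) = M₀ , m₀ , mm₀ , k ∘ a ,
      mk-pullback (ext (pb-comm pb) ∙ t ▷ na) (λ _ r → y-mono mm₀ _ _ r) sur
      where
        sur : ∀ {Z} (x : Z ⇒ M) (y : Z ⇒ Y₀ X) → m ∘ x ≈ t ∘ y → Σ Obj λ T → Σ (T ⇒ Z) λ s → Cover s ×
              Σ (T ⇒ Y₀ M₀) λ w → ((k ∘ a) ∘ w ≈ x ∘ s) × (Y₁ m₀ ∘ w ≈ y ∘ s)
        sur x y r with pb-pair pb x y r
        ... | u , ku , nu = _ , id , iso-cover id-iso , b ∘ u ,
          (mm _ _ (sym assoc ∙ (sym assoc ∙ pb-comm pb ◁ a) ◁ (b ∘ u) ∙ (assoc ∙ t ▷ na) ◁ (b ∘ u) ∙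
             assoc ∙ t ▷ (pull mb ∙ nu) ∙ sym r ∙ m ▷ sym identityʳ)) , (pull mb ∙ nu ∙ sym identityʳ)

  opaque
    ~⇒≈ : ∀ A {T} {x y : T E.⇒ P.X A} → E.EqRel._~_ (P.rel A) x y → P.q A ∘ Y₁ x ≈ P.q A ∘ Y₁ y
    ~⇒≈ A (k , p , q) = P.q A ▷ sym (y-tri p) ∙ ext (pb-comm (P.q-kernel A)) ∙ P.q A ▷ y-tri q

  opaque
    ≈⇒~ : ∀ A {T} {x y : T E.⇒ P.X A} → P.q A ∘ Y₁ x ≈ P.q A ∘ Y₁ y → E.EqRel._~_ (P.rel A) x y
    ≈⇒~ A {x = x} {y} p with pb-pair (P.q-kernel A) (Y₁ x) (Y₁ y) p
    ... | k , s , t with y-full k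
    ... | k₀ , k≈ = k₀ , y-tri⁻¹ (_ ▷ k≈ ∙ s) , y-tri⁻¹ (_ ▷ k≈ ∙ t)

  -- The initial object and coproducts of the completion

  opaque
    -- The two maps lift to the presentation of `Z` only on a cover of `X`, but the domain of that
    -- cover is again initial by strictness in E, so the lifts agree.
    initial-≈-Y : ∀ {X Z} {f g : Y₀ X ⇒ Z} → E.IsInitial X → f ≈ g
    initial-≈-Y {Z = Z} {f} {g} i with locally-X f
    ... | T , t , ct , x , qx with locally-X (g ∘ Y₁ t)
    ... | T' , t' , ct' , y , qy = cover-epi (y-cover ct) (cover-epi (y-cover ct')
          (sym qx ◁ Y₁ t' ∙ assoc ∙ P.q Z ▷ (sym y-∘ ∙
            y-resp (E.initial-≈ (E.initial-stable i (t E.∘ t')))) ∙ qy))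

  opaque
    y-initial : ∀ {I} → E.IsInitial I → IsInitial (Y₀ I)
    y-initial i Z = P.q Z ∘ Y₁ (proj₁ (i (P.X Z))) , λ h → initial-≈-Y i

  opaque
    strict : ∀ {A I} → E.IsInitial I → A ⇒ Y₀ I → IsInitial A
    strict {A} i a Z with y-full (a ∘ P.q A) | y-initial i Z
    ... | a₀ , _ | z , _ = z ∘ a , λ h → cover-epi (P.q-cover A) (initial-≈-Y (E.initial-stable i a₀))

  opaque
    initial⇒map : ∀ {A I} → E.IsInitial I → IsInitial A → A ⇒ Y₀ I
    initial⇒map i ia = proj₁ (ia _)

  opaque
    -- Every stage with a map to `Y₀ X` is initial, so the identity descends along `c` to a map
    -- `A → Y₀ X`, and strictness makes `A` initial.
    cover-initial : ∀ {X A} {c : Y₀ X ⇒ A} → Cover c → E.IsInitial X → IsInitial A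
    cover-initial {c = c} cc i with descend id cc (λ u v _ → initial-≈ (strict i u))
    ... | k , _ = strict i k

  opaque
    y-joint : ∀ {A B X} {f : A E.⇒ X} {g : B E.⇒ X} → E.JointlyCovering f g → JointlyCovering (Y₁ f) (Y₁ g)
    y-joint jc m mm (a , p) (b , q) with sub-rep m mm
    ... | M₀ , m₀ , mm₀ , (k , mk) , (l , ml) with jc m₀ mm₀ (y-⊑-reflect (l ∘ a , (pull ml ∙ p)))
                                                           (y-⊑-reflect (l ∘ b , (pull ml ∙ q)))
    ... | j , _ , m₀j = section-iso mm (sym assoc ∙ mk ◁ Y₁ j ∙ y-tri m₀j ∙ y-id)

  opaque
    y-splits : ∀ {A B K} {j₁ : A E.⇒ K} {j₂ : B E.⇒ K} → E.IsCoproduct j₁ j₂ → Splits (Y₁ j₁) (Y₁ j₂)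
    y-splits cp {T} u with probe u
    ... | u₀ , u≈ with E.coproduct-splits cp u₀
    ... | record { t₁ = t₁ ; t₂ = t₂ ; joint = joint ; u₁ = u₁ ; u₂ = u₂ ; eq₁ = eq₁ ; eq₂ = eq₂ } = record
      { t₁ = P.q T ∘ Y₁ t₁ ; t₂ = P.q T ∘ Y₁ t₂ ; joint = joint-cover (y-joint joint) (P.q-cover T)
      ; u₁ = Y₁ u₁ ; u₂ = Y₁ u₂ ; eq₁ = y-square eq₁ ∙ u≈ ◁ Y₁ t₁ ∙ assoc
      ; eq₂ = y-square eq₂ ∙ u≈ ◁ Y₁ t₂ ∙ assoc }

  -- In contrast to `Split`, the two parts form a coproduct in E over a cover in E. A morphism out
  -- of E preserves this form of case distinction, and the extension of such a morphism uses it to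
  -- preserve coproducts.
  record LocalSplit {A B S : Obj} (i₁ : A ⇒ S) (i₂ : B ⇒ S) {T : E.Obj} (s : Y₀ T ⇒ S)
         : Set (o ⊔ ℓ ⊔ e ⊔ o₁ ⊔ ℓ₁ ⊔ e₁) where
    field
      {T₁ T₂ T'} : E.Obj
      {l₁} : T₁ E.⇒ T'
      {l₂} : T₂ E.⇒ T'
      l-coproduct : E.IsCoproduct l₁ l₂
      t : T' E.⇒ T
      t-cover : E.Cover t
      a : Y₀ T₁ ⇒ A
      b : Y₀ T₂ ⇒ B
      eqa : i₁ ∘ a ≈ s ∘ Y₁ t ∘ Y₁ l₁
      eqb : i₂ ∘ b ≈ s ∘ Y₁ t ∘ Y₁ l₂

  opaque
    ⊕-cover : ∀ {A B A' B' K K'} {f : A E.⇒ A'} {g : B E.⇒ B'} {i₁ : A E.⇒ K} {i₂ : B E.⇒ K}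
              {j₁ : A' E.⇒ K'} {j₂ : B' E.⇒ K'} {h : K E.⇒ K'} →
              E.IsCoproduct j₁ j₂ → E.Cover f → E.Cover g →
              h E.∘ i₁ E.≈ j₁ E.∘ f → h E.∘ i₂ E.≈ j₂ E.∘ g → E.Cover h
    ⊕-cover cp cf cg p q m k mm h≈mk = E.coproduct-joint cp m mm
      (E.⊑-local mm cf (_ , (E.pull (E.sym h≈mk) E.∙ p)))
      (E.⊑-local mm cg (_ , (E.pull (E.sym h≈mk) E.∙ q)))

  opaque
    -- The generic element `P.q S` is split. On covers of its two parts, `a` and `b` lift to the
    -- presentation of `Z`; these lifts are maps of E and are copaired there.
    coproduct-intro-local : ∀ {A B S} {i₁ : A ⇒ S} {i₂ : B ⇒ S} → Mono i₁ → Mono i₂ → Disjoint i₁ i₂ →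
      (∀ {T} (s : Y₀ T ⇒ S) → LocalSplit i₁ i₂ s) → IsCoproduct i₁ i₂
    coproduct-intro-local {A} {B} {S} {i₁} {i₂} mi₁ mi₂ disj split = coproduct-intro mi₁ mi₂ disj cov
      where
        module L = LocalSplit (split (P.q S))
        cov : ∀ {Z} (a : A ⇒ Z) (b : B ⇒ Z) → CopairCover i₁ i₂ a b
        cov {Z} a b with locally-X (a ∘ L.a) | locally-X (b ∘ L.b)
        ... | T₁' , t₁ , ct₁ , f₁ , qf₁ | T₂' , t₂ , ct₂ , f₂ , qf₂ with E.coproduct T₁' T₂'
        ... | K , j₁ , j₂ , cp with cp (L.l₁ E.∘ t₁) (L.l₂ E.∘ t₂) | cp f₁ f₂
        ... | c , cj₁ , cj₂ , _ | f , fj₁ , fj₂ , _ = record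
          { j₁ = Y₁ j₁ ; j₂ = Y₁ j₂ ; splits = y-splits cp
          ; k = P.q S ∘ Y₁ L.t ∘ Y₁ c
          ; k-cover = cover-∘ (P.q-cover S) (cover-∘ (y-cover L.t-cover)
                       (y-cover (⊕-cover L.l-coproduct ct₁ ct₂ cj₁ cj₂)))
          ; a₁ = L.a ∘ Y₁ t₁ ; b₁ = L.b ∘ Y₁ t₂
          ; ka = pull L.eqa ∙ assoc ∙ P.q S ▷ (assoc ∙ Y₁ L.t ▷ y-square (E.sym cj₁)) ∙ P.q S ▷ sym assoc ∙ sym assoc
          ; kb = pull L.eqb ∙ assoc ∙ P.q S ▷ (assoc ∙ Y₁ L.t ▷ y-square (E.sym cj₂)) ∙ P.q S ▷ sym assoc ∙ sym assoc
          ; h = P.q Z ∘ Y₁ f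
          ; ha = assoc ∙ P.q Z ▷ y-tri fj₁ ∙ qf₁ ∙ assoc
          ; hb = assoc ∙ P.q Z ▷ y-tri fj₂ ∙ qf₂ ∙ assoc }

  opaque
    y-disjoint : ∀ {A B K} {j₁ : A E.⇒ K} {j₂ : B E.⇒ K} → E.IsCoproduct j₁ j₂ → Disjoint (Y₁ j₁) (Y₁ j₂)
    y-disjoint {j₁ = j₁} {j₂} cp {T} a b r with probe a | probe b
    ... | a₀ , a≈ | b₀ , b≈ = cover-initial (P.q-cover T) (E.coproduct-disjoint cp a₀ b₀
      (y-square⁻¹ (Y₁ j₁ ▷ a≈ ∙ ext r ∙ Y₁ j₂ ▷ sym b≈)))

  opaque
    split-cover : ∀ {A B K T} {j₁ : A E.⇒ K} {j₂ : B E.⇒ K} → E.IsCoproduct j₁ j₂ → (u : T E.⇒ K) →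
      Σ E.Obj λ T₁ → Σ E.Obj λ T₂ → Σ (T₁ E.⇒ T) λ l₁ → Σ (T₂ E.⇒ T) λ l₂ → E.IsCoproduct l₁ l₂ ×
        (Σ (T₁ E.⇒ A) λ a → j₁ E.∘ a E.≈ u E.∘ l₁) × (Σ (T₂ E.⇒ B) λ b → j₂ E.∘ b E.≈ u E.∘ l₂)
    split-cover {j₁ = j₁} {j₂} cp u with E.pullback j₁ u | E.pullback j₂ u
    ... | T₁ , a , l₁ , pb₁ | T₂ , b , l₂ , pb₂ = T₁ , T₂ , l₁ , l₂ ,
      E.coproduct-stable cp u a l₁ b l₂ pb₁ pb₂ , (a , E.pb-comm pb₁) , (b , E.pb-comm pb₂)

  opaque
    y-coproduct : ∀ {A B K} {j₁ : A E.⇒ K} {j₂ : B E.⇒ K} → E.IsCoproduct j₁ j₂ → IsCoproduct (Y₁ j₁) (Y₁ j₂)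
    y-coproduct {j₁ = j₁} {j₂} cp = coproduct-intro-local (y-mono (proj₁ (E.disjoint cp)))
      (y-mono (proj₁ (proj₂ (E.disjoint cp)))) (y-disjoint cp) split
      where
        split : ∀ {T} (s : Y₀ T ⇒ _) → LocalSplit (Y₁ j₁) (Y₁ j₂) s
        split s with y-full s
        ... | s₀ , s≈ with split-cover cp s₀
        ... | T₁ , T₂ , l₁ , l₂ , cpl , (a , p) , (b , q) = record
          { l-coproduct = cpl ; t = E.id ; t-cover = E.iso-cover E.id-iso ; a = Y₁ a ; b = Y₁ b
          ; eqa = y-square p ∙ s≈ ◁ Y₁ l₁ ∙ s ▷ (sym identityˡ ∙ sym y-id ◁ Y₁ l₁)
          ; eqb = y-square q ∙ s≈ ◁ Y₁ l₂ ∙ s ▷ (sym identityˡ ∙ sym y-id ◁ Y₁ l₂) }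

  -- A description of coproducts through elements, which passes to pullbacks directly; stability of
  -- coproducts in Ē is proved in this form.
  record CharacterisedCoproduct {A B S : Obj} (i₁ : A ⇒ S) (i₂ : B ⇒ S)
         : Set (o ⊔ ℓ ⊔ e ⊔ o₁ ⊔ ℓ₁ ⊔ e₁) where
    field
      mono₁ : Mono i₁
      mono₂ : Mono i₂
      disj : Disjoint i₁ i₂
      split : ∀ {T} (s : Y₀ T ⇒ S) → LocalSplit i₁ i₂ s

  module _ (A B : Obj) where
    private
      module A = P A
      module B = P B
      module ρ = E.EqRel A.rel
      module ς = E.EqRel B.rel

    -- `S` is the quotient of the coproduct of the two presenting objects by the sum of their
    -- relations; `ker` records that this sum is the kernel pair of `q`.
    module Sum {K : E.Obj} {ι₁ : A.X E.⇒ K} {ι₂ : B.X E.⇒ K} (cp : E.IsCoproduct ι₁ ι₂)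
               {L : E.Obj} {κ₁ : ρ.R E.⇒ L} {κ₂ : ς.R E.⇒ L} (cpL : E.IsCoproduct κ₁ κ₂)
               {s₁ s₂ : L E.⇒ K}
               (s₁κ₁ : s₁ E.∘ κ₁ E.≈ ι₁ E.∘ ρ.r₁) (s₁κ₂ : s₁ E.∘ κ₂ E.≈ ι₂ E.∘ ς.r₁)
               (s₂κ₁ : s₂ E.∘ κ₁ E.≈ ι₁ E.∘ ρ.r₂) (s₂κ₂ : s₂ E.∘ κ₂ E.≈ ι₂ E.∘ ς.r₂)
               {S : Obj} {q : Y₀ K ⇒ S} (cq : Cover q) (ker : IsPullback (Y₁ s₁) (Y₁ s₂) q q) where
      opaque
        resp : ∀ {D U} {κ : D E.⇒ L} {ι : U E.⇒ K} {r r' : D E.⇒ U} →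
               s₁ E.∘ κ E.≈ ι E.∘ r → s₂ E.∘ κ E.≈ ι E.∘ r' → (q ∘ Y₁ ι) ∘ Y₁ r ≈ (q ∘ Y₁ ι) ∘ Y₁ r'
        resp p p' = assoc ∙ q ▷ sym (y-square p) ∙ ext (pb-comm ker) ∙ q ▷ y-square p' ∙ sym assoc

      opaque
        desc : ∀ {D U C} {c : Y₀ U ⇒ C} {r r' : D E.⇒ U} {ι : U E.⇒ K} → Cover c →
               IsPullback (Y₁ r) (Y₁ r') c c → (q ∘ Y₁ ι) ∘ Y₁ r ≈ (q ∘ Y₁ ι) ∘ Y₁ r' →
               Σ (C ⇒ S) λ i → i ∘ c ≈ q ∘ Y₁ ι
        desc {ι = ι} cc pb p with kernel-coequalizer cc pb
        ... | _ , univ with univ (q ∘ Y₁ ι) p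
        ... | i , ic , _ = i , ic

      opaque
        d₁ : Σ (A ⇒ S) λ i → i ∘ A.q ≈ q ∘ Y₁ ι₁
        d₁ = desc A.q-cover A.q-kernel (resp s₁κ₁ s₂κ₁)

      opaque
        d₂ : Σ (B ⇒ S) λ i → i ∘ B.q ≈ q ∘ Y₁ ι₂
        d₂ = desc B.q-cover B.q-kernel (resp s₁κ₂ s₂κ₂)

      i₁ : A ⇒ S
      i₁ = proj₁ d₁

      i₂ : B ⇒ S
      i₂ = proj₁ d₂

      record Relation {U U' : E.Obj} {C C' Z : Obj} (c : Y₀ U ⇒ C) (c' : Y₀ U' ⇒ C') (ι : U E.⇒ K) (ι' : U' E.⇒ K)
                      (x : Z ⇒ C) (y : Z ⇒ C') : Set (o ⊔ ℓ ⊔ e ⊔ o₁ ⊔ ℓ₁ ⊔ e₁) where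
        field
          {T} : E.Obj
          t : Y₀ T ⇒ Z
          t-cover : Cover t
          u : T E.⇒ U
          v : T E.⇒ U'
          w : T E.⇒ L
          cu : c ∘ Y₁ u ≈ x ∘ t
          cv : c' ∘ Y₁ v ≈ y ∘ t
          s₁w : s₁ E.∘ w E.≈ ι E.∘ u
          s₂w : s₂ E.∘ w E.≈ ι' E.∘ v

      opaque
        -- An equality in the quotient `S` becomes, at a covering stage of E, a witness `w` in the
        -- sum relation `L`, which can then be split into cases.
        relate : ∀ {U U' C C' Z} {c : Y₀ U ⇒ C} {c' : Y₀ U' ⇒ C'} {i : C ⇒ S} {i' : C' ⇒ S}
          {ι : U E.⇒ K} {ι' : U' E.⇒ K} → Cover c → Cover c' → i ∘ c ≈ q ∘ Y₁ ι → i' ∘ c' ≈ q ∘ Y₁ ι' →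
          (x : Z ⇒ C) (y : Z ⇒ C') → i ∘ x ≈ i' ∘ y → Relation c c' ι ι' x y
        relate {c = c} {c'} {i} {i'} {ι} {ι'} cc cc' ic ic' x y r with lift₂ cc cc' x y
        ... | T , t , ct , u , v , cu , c'v with probe u | probe v
        ... | u₀ , u≈ | v₀ , v≈ with pb-pair ker (Y₁ ι ∘ Y₁ u₀) (Y₁ ι' ∘ Y₁ v₀)
                (sym (ext ic) ∙ i ▷ (c ▷ u≈ ∙ ext cu) ∙ ext r ∙ sym (i' ▷ (c' ▷ v≈ ∙ ext c'v)) ∙ ext ic')
        ... | w , s₁w , s₂w with y-full w
        ... | w₀ , w≈ = record
          { t = t ∘ P.q T ; t-cover = cover-∘ ct (P.q-cover T) ; u = u₀ ; v = v₀ ; w = w₀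
          ; cu = c ▷ u≈ ∙ ext cu ; cv = c' ▷ v≈ ∙ ext c'v
          ; s₁w = y-square⁻¹ (Y₁ s₁ ▷ w≈ ∙ s₁w) ; s₂w = y-square⁻¹ (Y₁ s₂ ▷ w≈ ∙ s₂w) }

      opaque
        via : ∀ {D U W T T'} {s : L E.⇒ K} {κ : D E.⇒ L} {ι : W E.⇒ K} {r : D E.⇒ W} {w : T E.⇒ L}
              {ι' : U E.⇒ K} {u : T E.⇒ U} {k : T' E.⇒ D} {t : T' E.⇒ T} → s E.∘ κ E.≈ ι E.∘ r →
              s E.∘ w E.≈ ι' E.∘ u → κ E.∘ k E.≈ w E.∘ t → ι E.∘ r E.∘ k E.≈ ι' E.∘ u E.∘ t
        via {s = s} p p' r' = E.sym (E.ext p) E.∙ s E.▷ r' E.∙ E.ext p'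

      opaque
        restrict-⊑ : ∀ {X R T T'} {r r' : R E.⇒ X} {x y : T E.⇒ X} {t : T' E.⇒ T} →
                     E.⟨ x E.∘ t , y E.∘ t ⟩ E.⊑ E.⟨ r , r' ⟩ → E.⟨ x , y ⟩ E.∘ t E.⊑ E.⟨ r , r' ⟩
        restrict-⊑ (j , p) = j , (p E.∙ E.⊗-unique (E.π₁-β E.∙ E.push E.π₁-β) (E.π₂-β E.∙ E.push E.π₂-β))

      opaque
        -- The witness of relatedness is split over the two summands of `L`. On the second part an
        -- element of `A.X` would lie in `B.X`, so the stage is initial; on the first part monicity
        -- of `ι₁` gives relatedness in `A`.
        mono₁ : Mono i₁
        mono₁ x y r = cover-epi R.t-cover (sym R.cu ∙ ~⇒≈ A (ρ.⊑⇒~ (E.joint-⊑ W.joint ρ.⟨r⟩-mono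
            (restrict-⊑ (ρ.~⇒⊑ (W.u₁ , proj₁ (E.disjoint cp) _ _ (via s₁κ₁ R.s₁w W.eq₁) ,
                                       proj₁ (E.disjoint cp) _ _ (via s₂κ₁ R.s₂w W.eq₁))))
            (E.initial-⊑ (E.coproduct-disjoint cp _ _ (E.sym (via s₁κ₂ R.s₁w W.eq₂)))))) ∙ R.cv)
          where
            module R = Relation (relate A.q-cover A.q-cover (proj₂ d₁) (proj₂ d₁) x y r)
            module W = E.Split (E.coproduct-splits cpL R.w)

      opaque
        mono₂ : Mono i₂
        mono₂ x y r = cover-epi R.t-cover (sym R.cu ∙ ~⇒≈ B (ς.⊑⇒~ (E.joint-⊑ W.joint ς.⟨r⟩-mono
            (E.initial-⊑ (E.coproduct-disjoint cp _ _ (via s₁κ₁ R.s₁w W.eq₁)))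
            (restrict-⊑ (ς.~⇒⊑ (W.u₂ , proj₁ (proj₂ (E.disjoint cp)) _ _ (via s₁κ₂ R.s₁w W.eq₂) ,
                                       proj₁ (proj₂ (E.disjoint cp)) _ _ (via s₂κ₂ R.s₂w W.eq₂)))))) ∙ R.cv)
          where
            module R = Relation (relate B.q-cover B.q-cover (proj₂ d₂) (proj₂ d₂) x y r)
            module W = E.Split (E.coproduct-splits cpL R.w)

      opaque
        disj : Disjoint i₁ i₂
        disj x y r = cover-initial R.t-cover (E.joint-initial W.joint
            (E.coproduct-disjoint cp _ _ (via s₂κ₁ R.s₂w W.eq₁))
            (E.coproduct-disjoint cp _ _ (E.sym (via s₁κ₂ R.s₁w W.eq₂))))
          where
            module R = Relation (relate A.q-cover B.q-cover (proj₂ d₁) (proj₂ d₂) x y r)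
            module W = E.Split (E.coproduct-splits cpL R.w)

      opaque
        split : ∀ {T} (s : Y₀ T ⇒ S) → LocalSplit i₁ i₂ s
        split s with locally cq s
        ... | T' , t , ct , x , qx with y-full x
        ... | x₀ , x≈ with split-cover cp x₀
        ... | T₁ , T₂ , l₁ , l₂ , cpl , (a , p) , (b , p') = record
          { l-coproduct = cpl ; t = t ; t-cover = ct ; a = A.q ∘ Y₁ a ; b = B.q ∘ Y₁ b
          ; eqa = ext (proj₂ d₁) ∙ q ▷ (y-square p ∙ x≈ ◁ Y₁ l₁) ∙ ext qx
          ; eqb = ext (proj₂ d₂) ∙ q ▷ (y-square p' ∙ x≈ ◁ Y₁ l₂) ∙ ext qx }

      opaque
        characterised : CharacterisedCoproduct i₁ i₂
        characterised = record { mono₁ = mono₁ ; mono₂ = mono₂ ; disj = disj ; split = split }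

    opaque
      sum : Σ Obj λ S → Σ (A ⇒ S) λ i₁ → Σ (B ⇒ S) λ i₂ → CharacterisedCoproduct i₁ i₂
      sum with E.coproduct A.X B.X | E.coproduct ρ.R ς.R
      ... | K , ι₁ , ι₂ , cp | L , κ₁ , κ₂ , cpL
        with cpL (ι₁ E.∘ ρ.r₁) (ι₂ E.∘ ς.r₁) | cpL (ι₁ E.∘ ρ.r₂) (ι₂ E.∘ ς.r₂)
      ... | s₁ , s₁κ₁ , s₁κ₂ , _ | s₂ , s₂κ₁ , s₂κ₂ , _
        with effective (record { equivRel = E.sum-equivRel A.rel B.rel cp cpL s₁κ₁ s₁κ₂ s₂κ₁ s₂κ₂ })
                       (E.sum-bounded A.rel B.rel cp cpL s₁κ₁ s₁κ₂ s₂κ₁ s₂κ₂ A.bounded B.bounded)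
      ... | S , q , cq , ker = S , _ , _ , Sum.characterised cp cpL s₁κ₁ s₁κ₂ s₂κ₁ s₂κ₂ cq ker

  opaque
    -- The constructed `sum` has the stated properties, and they are carried over along the
    -- comparison with the given coproduct.
    coproduct-char : ∀ {A B S} {i₁ : A ⇒ S} {i₂ : B ⇒ S} → IsCoproduct i₁ i₂ → CharacterisedCoproduct i₁ i₂
    coproduct-char {A} {B} {S} {i₁} {i₂} cp with sum A B
    ... | S₀ , ι₁ , ι₂ , record { mono₁ = m₁ ; mono₂ = m₂ ; disj = d ; split = sp }
      with cp ι₁ ι₂ | coproduct-intro-local m₁ m₂ d sp i₁ i₂ | cp i₁ i₂
    ... | u , ui₁ , ui₂ , _ | v , vι₁ , vι₂ , _ | _ , _ , _ , uniq = record
      { mono₁ = mono-cancel (mono-resp (sym ui₁) m₁) ; mono₂ = mono-cancel (mono-resp (sym ui₂) m₂)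
      ; disj = λ a b r → d a b (push ui₁ ∙ u ▷ r ∙ pull ui₂)
      ; split = split }
      where
        vu : v ∘ u ≈ id
        vu = uniq _ (assoc ∙ v ▷ ui₁ ∙ vι₁) (assoc ∙ v ▷ ui₂ ∙ vι₂) ∙ sym (uniq id identityˡ identityˡ)
        split : ∀ {T} (s : Y₀ T ⇒ S) → LocalSplit i₁ i₂ s
        split s with sp (u ∘ s)
        ... | record { l-coproduct = cpl ; t = t ; t-cover = ct ; a = a ; b = b ; eqa = p ; eqb = p' } = record
          { l-coproduct = cpl ; t = t ; t-cover = ct ; a = a ; b = b
          ; eqa = push vι₁ ∙ v ▷ (p ∙ assoc) ∙ cancel vu ; eqb = push vι₂ ∙ v ▷ (p' ∙ assoc) ∙ cancel vu }

  opaque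
    char-coproduct : ∀ {A B S} {i₁ : A ⇒ S} {i₂ : B ⇒ S} → CharacterisedCoproduct i₁ i₂ → IsCoproduct i₁ i₂
    char-coproduct c = coproduct-intro-local mono₁ mono₂ disj split
      where open CharacterisedCoproduct c

  opaque
    char-stable : ∀ {S A B} {i₁ : A ⇒ S} {i₂ : B ⇒ S} → CharacterisedCoproduct i₁ i₂ →
      ∀ {Z P₁ P₂} (f : Z ⇒ S) (p₁ : P₁ ⇒ A) (j₁ : P₁ ⇒ Z) (p₂ : P₂ ⇒ B) (j₂ : P₂ ⇒ Z) →
      IsPullback p₁ j₁ i₁ f → IsPullback p₂ j₂ i₂ f → CharacterisedCoproduct j₁ j₂
    char-stable {S} {i₁ = i₁} {i₂} c {Z} f p₁ j₁ p₂ j₂ pb₁ pb₂ = record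
      { mono₁ = pb-mono pb₁ mono₁ ; mono₂ = pb-mono pb₂ mono₂
      ; disj = λ a b r → disj (p₁ ∘ a) (p₂ ∘ b) (ext (pb-comm pb₁) ∙ f ▷ r ∙ sym (ext (pb-comm pb₂)))
      ; split = split' }
      where
        open CharacterisedCoproduct c
        split' : ∀ {T} (s : Y₀ T ⇒ Z) → LocalSplit j₁ j₂ s
        split' s with split (f ∘ s)
        ... | record { l₁ = l₁ ; l₂ = l₂ ; l-coproduct = cpl ; t = t ; t-cover = ct ; a = a ; b = b ; eqa = p ; eqb = p' }
          with pb-pair pb₁ a (s ∘ Y₁ t ∘ Y₁ l₁) (p ∙ assoc) | pb-pair pb₂ b (s ∘ Y₁ t ∘ Y₁ l₂) (p' ∙ assoc)
        ... | u , _ , ju | v , _ , jv = record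
          { l-coproduct = cpl ; t = t ; t-cover = ct ; a = u ; b = v ; eqa = ju ; eqb = jv }

  -- Universal quantification in the completion

  opaque
    y-forall : ∀ {Z X M A} {f : Z E.⇒ X} {m : M E.⇒ Z} {a : A E.⇒ X} →
      E.Mono m → E.IsForall f m a → IsForall (Y₁ f) (Y₁ m) (Y₁ a)
    y-forall {Z} {X} {f = f} {m} {a} mm fa = mk-forall (y-mono (proj₁ fa)) elim intro
      where
        elim : ∀ {T} (b : T ⇒ Y₀ X) (x : T ⇒ Y₀ Z) → Y₁ f ∘ x ≈ b → b ⊑ Y₁ a → x ⊑ Y₁ m
        elim {T} b x r (k , p) with probe x | probe k
        ... | x₀ , x≈ | k₀ , k≈ with E.forall-elim fa (a E.∘ k₀) x₀
                (y-square⁻¹ (Y₁ f ▷ x≈ ∙ pull (r ∙ sym p) ∙ assoc ∙ Y₁ a ▷ sym k≈)) (k₀ , E.refl)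
        ... | j , mj = ⊑-local (y-mono mm) (P.q-cover T) (Y₁ j , (y-tri mj ∙ x≈))

        intro : ∀ {T} (b : T ⇒ Y₀ X) → (∀ {T'} (s : T' ⇒ T) (x : T' ⇒ Y₀ Z) → Y₁ f ∘ x ≈ b ∘ s → x ⊑ Y₁ m) →
                b ⊑ Y₁ a
        intro {T} b hyp with probe b
        ... | b₀ , b≈ with E.forall-intro fa mm b₀ (λ s x r →
                y-⊑-reflect (hyp (P.q T ∘ Y₁ s) (Y₁ x) (y-square r ∙ b≈ ◁ Y₁ s ∙ assoc)))
        ... | j , aj = ⊑-local (y-mono (proj₁ fa)) (P.q-cover T) (Y₁ j , (y-tri aj ∙ b≈))

  opaque
    y-forall-reflect : ∀ {Z X M A} {f : Z E.⇒ X} {m : M E.⇒ Z} {a : A E.⇒ X} →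
      E.Mono m → IsForall (Y₁ f) (Y₁ m) (Y₁ a) → E.IsForall f m a
    y-forall-reflect {Z} {X} {f = f} {m} {a} mm fa = E.mk-forall (y-mono-reflect (proj₁ fa))
      (λ b x r b⊑a → y-⊑-reflect (forall-elim fa (Y₁ b) (Y₁ x) (y-tri r) (y-⊑ b⊑a))) intro
      where
        intro : ∀ {T} (b : T E.⇒ X) → (∀ {T'} (s : T' E.⇒ T) (x : T' E.⇒ Z) → f E.∘ x E.≈ b E.∘ s → x E.⊑ m) →
                b E.⊑ a
        intro b hyp = y-⊑-reflect (forall-intro fa (y-mono mm) (Y₁ b) λ {T} s x r →
          let (s₀ , s≈) = probe s
              (x₀ , x≈) = probe x
              (j , mj) = hyp s₀ x₀ (y-square⁻¹ (Y₁ f ▷ x≈ ∙ ext r ∙ Y₁ b ▷ sym s≈))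
          in ⊑-local (y-mono mm) (P.q-cover T) (Y₁ j , (y-tri mj ∙ x≈)))

  -- Every map is covered by one between objects of E, and ∀ descends along covering squares.
  opaque
    cover-by-Y : ∀ {A B} (f : A ⇒ B) → Σ E.Obj λ K → Σ (K E.⇒ P.X B) λ k → Σ (Y₀ K ⇒ A) λ t →
                 IsCoveringSquare t (Y₁ k) f (P.q B)
    cover-by-Y {A} {B} f with pullback f (P.q B)
    ... | W , p₁ , p₂ , pb with probe p₂
    ... | k , k≈ = P.X W , k , p₁ ∘ P.q W , mk-square
      (pull (pb-comm pb) ∙ assoc ∙ P.q B ▷ sym k≈) (P.q-cover B) lifts
      where
        lifts : Lifts (p₁ ∘ P.q W) (Y₁ k) f (P.q B)
        lifts c b r with pb-pair pb b c (sym r)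
        ... | w , p₁w , p₂w with lift (P.q-cover W) w
        ... | T , s , cs , x , qx = T , s , cs , x ,
          (k≈ ◁ x ∙ assoc ∙ p₂ ▷ qx ∙ pull p₂w) , (assoc ∙ p₁ ▷ qx ∙ pull p₁w)

  opaque
    forall-ex : ∀ {A B M} (f : A ⇒ B) (m : M ⇒ A) → Mono m → Σ Obj λ D → Σ (D ⇒ B) λ a → IsForall f m a
    forall-ex {A} {B} f m mm with cover-by-Y f
    ... | K , k , t , sq with pullback m t
    ... | N , _ , _ , pb with sub-pullback mm t pb
    ... | M₀ , m₀ , mm₀ , k₀ , pb₀ with E.forall-exists k m₀ mm₀
    -- The quantifier is computed in E on the covering object of `B` and brought down to `B` as an
    -- image.
    ... | A₀ , a₀ , fa₀ with factor (P.q B ∘ Y₁ a₀)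
    ... | D , c , a , cc , ma , fac = D , a ,
      forall-descent sq mm pb₀ ma c cc (sym fac) (y-forall mm₀ fa₀)

  positiveHeyting : IsPositiveHeyting C̄
  positiveHeyting = record
    { terminal = terminal ; pullback = pullback ; factor = factor ; cover-stable = cover-stable
    ; initial = Y₀ (proj₁ E.initial) , y-initial (proj₂ E.initial)
    ; coproduct = λ A B → let (S , i₁ , i₂ , c) = sum A B in S , i₁ , i₂ , char-coproduct c
    ; disjoint = λ cp → let open CharacterisedCoproduct (coproduct-char cp) in
        mono₁ , mono₂ , λ p q pb → disj p q (pb-comm pb)
    ; coproduct-stable = λ cp f p₁ j₁ p₂ j₂ pb₁ pb₂ →
        char-coproduct (char-stable (coproduct-char cp) f p₁ j₁ p₂ j₂ pb₁ pb₂)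
    ; initial-stable = λ i f → strict (proj₂ E.initial) (initial⇒map (proj₂ E.initial) i ∘ f)
    ; forall-exists = forall-ex }

  private
    module C̄+ = Positive C̄ positiveHeyting

  -- The class of small maps of the completion

  S̄ : ∀ {B D} → B ⇒ D → Set (o ⊔ ℓ ⊔ s ⊔ o₁ ⊔ ℓ₁ ⊔ e₁)
  S̄ {B} {D} f = Σ E.Obj λ A' → Σ E.Obj λ C' → Σ (A' E.⇒ C') λ f' → E.S f' ×
    Σ (Y₀ A' ⇒ B) λ t → Σ (Y₀ C' ⇒ D) λ p → IsCoveringSquare t (Y₁ f') f p

  opaque
    iso-square : ∀ {A B C' D} {t : A ⇒ B} {f : A ⇒ C'} {g : B ⇒ D} {p : C' ⇒ D} →
                 IsIso t → IsIso p → g ∘ t ≈ p ∘ f → IsCoveringSquare t f g p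
    iso-square {t = t} {f} {g} {p} (t' , _ , tt') ip comm = mk-square comm (iso-cover ip) λ c b r →
      _ , id , iso-cover id-iso , t' ∘ b ,
      (iso-mono ip _ _ (sym (ext comm) ∙ g ▷ cancel tt' ∙ sym r) ∙ sym identityʳ) , (cancel tt' ∙ sym identityʳ)

  opaque
    y-covering : ∀ {A B C' D} {t : A E.⇒ B} {f : A E.⇒ C'} {g : B E.⇒ D} {p : C' E.⇒ D} →
                 E.IsCoveringSquare t f g p → IsCoveringSquare (Y₁ t) (Y₁ f) (Y₁ g) (Y₁ p)
    y-covering {t = t} {f} {g} {p} sq = mk-square (y-square (proj₁ sq)) (y-cover (proj₁ (proj₂ sq))) lifts
      where
        lifts : Lifts (Y₁ t) (Y₁ f) (Y₁ g) (Y₁ p)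
        lifts {Z} c b r with probe c | probe b
        ... | c₀ , c≈ | b₀ , b≈ with E.square-lifts sq c₀ b₀ (y-square⁻¹ (Y₁ p ▷ c≈ ∙ ext r ∙ Y₁ g ▷ sym b≈))
        ... | T , z , cz , a , fa , ta = Y₀ T , P.q Z ∘ Y₁ z , cover-∘ (P.q-cover Z) (y-cover cz) , Y₁ a ,
          (y-square fa ∙ c≈ ◁ Y₁ z ∙ assoc) , (y-square ta ∙ b≈ ◁ Y₁ z ∙ assoc)

  opaque
    y-covering-reflect : ∀ {A B C' D} {t : A E.⇒ B} {f : A E.⇒ C'} {g : B E.⇒ D} {p : C' E.⇒ D} →
                 IsCoveringSquare (Y₁ t) (Y₁ f) (Y₁ g) (Y₁ p) → E.IsCoveringSquare t f g p
    y-covering-reflect {t = t} {f} {g} {p} sq =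
      E.mk-square (y-square⁻¹ (proj₁ sq)) (y-cover-reflect (proj₁ (proj₂ sq))) lifts
      where
        lifts : E.Lifts t f g p
        lifts c b r with square-lifts sq (Y₁ c) (Y₁ b) (y-square r)
        ... | T , z , cz , a , fa , ta with probe z | probe a
        ... | z₀ , z≈ | a₀ , a≈ = P.X T , z₀ , y-cover-reflect (cover-resp (sym z≈) (cover-∘ cz (P.q-cover T))) , a₀ ,
          y-square⁻¹ (Y₁ f ▷ a≈ ∙ ext fa ∙ Y₁ c ▷ sym z≈) , y-square⁻¹ (Y₁ t ▷ a≈ ∙ ext ta ∙ Y₁ b ▷ sym z≈)

  opaque
    y-small : ∀ {A B} {f : A E.⇒ B} → E.S f → S̄ (Y₁ f)
    y-small sf = _ , _ , _ , sf , id , id , iso-square id-iso id-iso (identityʳ ∙ sym identityˡ)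

  opaque
    -- When `f` lies in E, all four sides of the covering square join objects of E. By fullness the
    -- square comes from E, where a map covered by a small map is small.
    y-small-reflect : ∀ {A B} {f : A E.⇒ B} → S̄ (Y₁ f) → E.S f
    y-small-reflect {f = f} (_ , _ , f' , sf' , t , p , sq) with y-full t | y-full p
    ... | t₀ , t≈ | p₀ , p≈ = E.covered-small (y-covering-reflect sq') sf'
      where
        sq' : IsCoveringSquare (Y₁ t₀) (Y₁ f') (Y₁ f) (Y₁ p₀)
        sq' = mk-square (Y₁ f ▷ t≈ ∙ proj₁ sq ∙ sym p≈ ◁ Y₁ f') (cover-resp (sym p≈) (proj₁ (proj₂ sq)))
          λ c b r → let (T , z , cz , a , fa , ta) = square-lifts sq c b (sym p≈ ◁ c ∙ r)
                    in T , z , cz , a , fa , (t≈ ◁ a ∙ ta)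

  opaque
    square-small : ∀ {A B C' D} {t : A ⇒ B} {f : A ⇒ C'} {g : B ⇒ D} {p : C' ⇒ D} →
                   IsCoveringSquare t f g p → S̄ f → S̄ g
    square-small sq (_ , _ , f' , sf' , _ , _ , sq') = _ , _ , f' , sf' , _ , _ , square-∘ sq sq'

  opaque
    S̄-resp-≈ : ∀ {A B} {f g : A ⇒ B} → f ≈ g → S̄ f → S̄ g
    S̄-resp-≈ p = square-small (iso-square id-iso id-iso (identityʳ ∙ sym p ∙ sym identityˡ))

  opaque
    -- The bottom of the covering square of `f` is pulled back along `g` and then covered by an
    -- object of E; over that object `f'` is pulled back in E, where `A1` applies.
    Ā1 : ∀ {P A B D} {p : P ⇒ A} {q : P ⇒ B} {f : A ⇒ D} {g : B ⇒ D} → IsPullback p q f g → S̄ f → S̄ q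
    Ā1 {P} {A} {B} {D} {p} {q} {f} {g} pb (A' , C' , f' , sf' , t , π , sq) with pullback π g
    ... | W , w₁ , w₂ , pbW with probe w₁
    ... | w₀ , w≈ with E.pullback f' w₀
    ... | N , n₁ , n₂ , pbN with pb-pair pb (t ∘ Y₁ n₁) ((w₂ ∘ P.q W) ∘ Y₁ n₂)
            (ext (proj₁ sq) ∙ π ▷ (y-square (E.pb-comm pbN) ∙ w≈ ◁ Y₁ n₂) ∙
             sym assoc ∙ (sym assoc ∙ pb-comm pbW ◁ P.q W ∙ assoc) ◁ Y₁ n₂ ∙ assoc)
    ... | τ , pτ , qτ = N , P.X W , n₂ , E.A1 pbN sf' , τ , w₂ ∘ P.q W ,
        mk-square qτ (cover-∘ (cover-stable pbW (proj₁ (proj₂ sq))) (P.q-cover W)) lifts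
      where
        lifts : Lifts τ (Y₁ n₂) q (w₂ ∘ P.q W)
        lifts c b r with square-lifts sq (Y₁ w₀ ∘ c) (p ∘ b)
            (π ▷ (w≈ ◁ c ∙ assoc) ∙ ext (pb-comm pbW) ∙ g ▷ (sym assoc ∙ r) ∙ sym (ext (pb-comm pb)))
        ... | T , z , cz , a , f'a , ta with pb-pair (y-pullback pbN) a (c ∘ z) (f'a ∙ assoc)
        ... | ν , n₁ν , n₂ν = T , z , cz , ν , n₂ν ,
          pb-jm pb (pull pτ ∙ assoc ∙ t ▷ n₁ν ∙ ta ∙ assoc) (pull qτ ∙ assoc ∙ (w₂ ∘ P.q W) ▷ n₂ν ∙ pull r ∙ assoc)

  opaque
    Ā2 : ∀ {P A B D} {p : P ⇒ A} {q : P ⇒ B} {f : A ⇒ D} {g : B ⇒ D} →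
         IsPullback p q f g → Cover g → S̄ q → S̄ f
    Ā2 pb cg = square-small (mk-square (pb-comm pb) cg (pullback-lifts pb))

  module SquareSum {X X' Z Z' SX SZ : Obj} {f : X ⇒ Z} {f' : X' ⇒ Z'}
      {i₁ : X ⇒ SX} {i₂ : X' ⇒ SX} {j₁ : Z ⇒ SZ} {j₂ : Z' ⇒ SZ} (cpX : IsCoproduct i₁ i₂) (cpZ : IsCoproduct j₁ j₂)
      {h : SX ⇒ SZ} (hi₁ : h ∘ i₁ ≈ j₁ ∘ f) (hi₂ : h ∘ i₂ ≈ j₂ ∘ f')
      {A₁ A₂ C₁ C₂ K L : E.Obj} {f₁ : A₁ E.⇒ C₁} {f₂ : A₂ E.⇒ C₂} {t₁ : Y₀ A₁ ⇒ X} {p₁ : Y₀ C₁ ⇒ Z}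
      {t₂ : Y₀ A₂ ⇒ X'} {p₂ : Y₀ C₂ ⇒ Z'}
      (sq₁ : IsCoveringSquare t₁ (Y₁ f₁) f p₁) (sq₂ : IsCoveringSquare t₂ (Y₁ f₂) f' p₂)
      {α₁ : A₁ E.⇒ K} {α₂ : A₂ E.⇒ K} (cpK : E.IsCoproduct α₁ α₂)
      {γ₁ : C₁ E.⇒ L} {γ₂ : C₂ E.⇒ L} (cpL : E.IsCoproduct γ₁ γ₂)
      {g : K E.⇒ L} (gα₁ : g E.∘ α₁ E.≈ γ₁ E.∘ f₁) (gα₂ : g E.∘ α₂ E.≈ γ₂ E.∘ f₂)
      {t : Y₀ K ⇒ SX} (tα₁ : t ∘ Y₁ α₁ ≈ i₁ ∘ t₁) (tα₂ : t ∘ Y₁ α₂ ≈ i₂ ∘ t₂)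
      {p : Y₀ L ⇒ SZ} (pγ₁ : p ∘ Y₁ γ₁ ≈ j₁ ∘ p₁) (pγ₂ : p ∘ Y₁ γ₂ ≈ j₂ ∘ p₂) where
    opaque
      comm : h ∘ t ≈ p ∘ Y₁ g
      comm = joint-≈ (C̄+.coproduct-joint (y-coproduct cpK))
        (assoc ∙ h ▷ tα₁ ∙ ext hi₁ ∙ j₁ ▷ proj₁ sq₁ ∙ sym assoc ∙ sym pγ₁ ◁ Y₁ f₁ ∙ assoc ∙
          p ▷ y-square (E.sym gα₁) ∙ sym assoc)
        (assoc ∙ h ▷ tα₂ ∙ ext hi₂ ∙ j₂ ▷ proj₁ sq₂ ∙ sym assoc ∙ sym pγ₂ ◁ Y₁ f₂ ∙ assoc ∙
          p ▷ y-square (E.sym gα₂) ∙ sym assoc)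

    opaque
      cover : Cover p
      cover m k mm p≈mk = C̄+.coproduct-joint cpZ m mm
        (⊑-local mm (proj₁ (proj₂ sq₁)) (k ∘ Y₁ γ₁ , (pull (sym p≈mk) ∙ pγ₁)))
        (⊑-local mm (proj₁ (proj₂ sq₂)) (k ∘ Y₁ γ₂ , (pull (sym p≈mk) ∙ pγ₂)))

    module _ {W : Obj} (c : W ⇒ Y₀ L) (b : W ⇒ SX) (r : p ∘ c ≈ h ∘ b) where
      opaque
        meet : ∀ {C₀ Z₀ Z₁ X₁ T} {p₀ : Y₀ C₀ ⇒ Z₀} {γ : C₀ E.⇒ L} {j : Z₀ ⇒ SZ} {j' : Z₁ ⇒ SZ} {i : X₁ ⇒ SX}
               {φ : X₁ ⇒ Z₁} {a : T ⇒ Y₀ C₀} {x : T ⇒ X₁} → p ∘ Y₁ γ ≈ j ∘ p₀ → h ∘ i ≈ j' ∘ φ → (z : T ⇒ W) →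
               Y₁ γ ∘ a ≈ c ∘ z → i ∘ x ≈ b ∘ z → j ∘ p₀ ∘ a ≈ j' ∘ φ ∘ x
        meet pγ hi z γa ix = sym (ext pγ) ∙ p ▷ γa ∙ ext r ∙ h ▷ sym ix ∙ ext hi

      opaque
        on : ∀ {A₀ C₀ X₀ Z₀} {f₀ : A₀ E.⇒ C₀} {t₀ : Y₀ A₀ ⇒ X₀} {p₀ : Y₀ C₀ ⇒ Z₀} {φ : X₀ ⇒ Z₀}
             {γ : C₀ E.⇒ L} {α : A₀ E.⇒ K} {j : Z₀ ⇒ SZ} {i : X₀ ⇒ SX} → IsCoveringSquare t₀ (Y₁ f₀) φ p₀ →
             p ∘ Y₁ γ ≈ j ∘ p₀ → h ∘ i ≈ j ∘ φ → t ∘ Y₁ α ≈ i ∘ t₀ → g E.∘ α E.≈ γ E.∘ f₀ → Mono j →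
             ∀ {I} {m : I ⇒ Y₀ L ⊗ SX} {d : Y₀ K ⇒ I} → Mono m → ⟨ Y₁ g , t ⟩ ≈ m ∘ d →
             ∀ {T} (z : T ⇒ W) (a : T ⇒ Y₀ C₀) (x : T ⇒ X₀) → Y₁ γ ∘ a ≈ c ∘ z → i ∘ x ≈ b ∘ z → ⟨ c , b ⟩ ∘ z ⊑ m
        on {γ = γ} {α} {i = i} sq pγ hi tα gα mj {d = d} mm fac z a x γa ix
          with square-lifts sq a x (mj _ _ (meet pγ hi z γa ix))
        ... | T' , z' , cz' , a' , f₀a' , t₀a' = ⊑-local mm cz' (d ∘ Y₁ α ∘ a' , (pull (sym fac) ∙ ⊗-unique
            (pull π₁-β ∙ ext (y-square gα) ∙ Y₁ γ ▷ f₀a' ∙ ext γa ∙ push π₁-β ∙ π₁ ▷ sym assoc)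
            (pull π₂-β ∙ ext tα ∙ i ▷ t₀a' ∙ ext ix ∙ push π₂-β ∙ π₂ ▷ sym assoc)))

      opaque
        pair-⊑ : ∀ {I} {m : I ⇒ Y₀ L ⊗ SX} {d : Y₀ K ⇒ I} → Mono m → ⟨ Y₁ g , t ⟩ ≈ m ∘ d → ⟨ c , b ⟩ ⊑ m
        pair-⊑ mm fac = case₂-⊑ (y-splits cpL) (C̄+.coproduct-splits cpX) c b mm
          (λ z a x γa ix → on sq₁ pγ₁ hi₁ tα₁ gα₁ (proj₁ (C̄+.disjoint cpZ)) mm fac z a x γa ix)
          (λ z a x γa ix → initial-⊑ (C̄+.coproduct-disjoint cpZ (p₁ ∘ a) (f' ∘ x) (meet pγ₁ hi₂ z γa ix)))
          (λ z a x γa ix → initial-⊑ (C̄+.coproduct-disjoint cpZ (f ∘ x) (p₂ ∘ a) (sym (meet pγ₂ hi₁ z γa ix))))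
          (λ z a x γa ix → on sq₂ pγ₂ hi₂ tα₂ gα₂ (proj₁ (proj₂ (C̄+.disjoint cpZ))) mm fac z a x γa ix)

    opaque
      -- A lift is not unique, so it cannot be assembled from cases directly. Passing to the image
      -- `m` of `⟨ Y₁ g , t ⟩` turns its local existence into membership in a subobject, which can
      -- be checked on the four cases for `c` and `b`.
      lifts : Lifts t (Y₁ g) h p
      lifts c b r with factor ⟨ Y₁ g , t ⟩
      ... | I , d , m , cd , mm , fac with pair-⊑ c b r mm fac
      ... | k , mk with lift cd k
      ... | T , z , cz , a , da = T , z , cz , a ,
        (push π₁-β ∙ π₁ ▷ (fac ◁ a ∙ assoc ∙ m ▷ da ∙ pull mk) ∙ pull π₁-β) ,
        (push π₂-β ∙ π₂ ▷ (fac ◁ a ∙ assoc ∙ m ▷ da ∙ pull mk) ∙ pull π₂-β)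

    opaque
      sum-square : IsCoveringSquare t (Y₁ g) h p
      sum-square = mk-square comm cover lifts

  opaque
    Ā3 : ∀ {X X' Z Z' SX SZ} {f : X ⇒ Z} {f' : X' ⇒ Z'}
           {i₁ : X ⇒ SX} {i₂ : X' ⇒ SX} {j₁ : Z ⇒ SZ} {j₂ : Z' ⇒ SZ} →
      IsCoproduct i₁ i₂ → IsCoproduct j₁ j₂ → S̄ f → S̄ f' →
      (h : SX ⇒ SZ) → h ∘ i₁ ≈ j₁ ∘ f → h ∘ i₂ ≈ j₂ ∘ f' → S̄ h
    Ā3 {i₁ = i₁} {i₂} {j₁} {j₂} cpX cpZ (A₁ , C₁ , f₁ , sf₁ , t₁ , p₁ , sq₁) (A₂ , C₂ , f₂ , sf₂ , t₂ , p₂ , sq₂)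
       h hi₁ hi₂ with E.coproduct A₁ A₂ | E.coproduct C₁ C₂
    ... | K , α₁ , α₂ , cpK | L , γ₁ , γ₂ , cpL with cpK (γ₁ E.∘ f₁) (γ₂ E.∘ f₂)
            | y-coproduct cpK (i₁ ∘ t₁) (i₂ ∘ t₂) | y-coproduct cpL (j₁ ∘ p₁) (j₂ ∘ p₂)
    ... | g , gα₁ , gα₂ , _ | t , tα₁ , tα₂ , _ | p , pγ₁ , pγ₂ , _ =
        K , L , g , E.A3 cpK cpL sf₁ sf₂ g gα₁ gα₂ , t , p ,
        SquareSum.sum-square cpX cpZ hi₁ hi₂ sq₁ sq₂ cpK cpL gα₁ gα₂ tα₁ tα₂ pγ₁ pγ₂

  opaque
    terminal-small : ∀ {A B D} (f : A E.⇒ E.⊤) → E.S f → {t : Y₀ A ⇒ B} → Cover t → IsTerminal D →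
                     (h : B ⇒ D) → S̄ h
    terminal-small {A} {B} {D} f sf {t} ct term h = A , E.⊤ , f , sf , t , p , mk-square (uniq _ _) p-cover lifts
      where
        p : Y₀ E.⊤ ⇒ D
        p = proj₁ (term (Y₀ E.⊤))
        uniq : ∀ {W} (x y : W ⇒ D) → x ≈ y
        uniq x y = proj₂ (term _) x ∙ sym (proj₂ (term _) y)
        p-cover : Cover p
        p-cover = iso-cover (proj₁ (y-terminal E.⊤-terminal D) , y-terminal-unique E.⊤-terminal _ _ , uniq _ _)
        lifts : Lifts t (Y₁ f) h p
        lifts c b r with lift ct b
        ... | T , z , cz , a , ta = T , z , cz , a , y-terminal-unique E.⊤-terminal _ _ , ta

  opaque
    Ā4-0 : ∀ {Z T} → IsInitial Z → IsTerminal T → (h : Z ⇒ T) → S̄ h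
    Ā4-0 iz term h with E.initial
    ... | I , i = terminal-small E.! (E.A4-0 i E.⊤-terminal E.!)
      (iso-cover {f = proj₁ (y-initial i _)} (proj₁ (iz _) , initial-≈ (y-initial i) , initial-≈ iz)) term h

  opaque
    Ā4-1 : ∀ {T} → IsTerminal T → (h : T ⇒ T) → S̄ h
    Ā4-1 term h = terminal-small E.id (E.A4-1 E.⊤-terminal E.id) (iso-cover {f = proj₁ (term _)}
      (proj₁ (y-terminal E.⊤-terminal _) , y-terminal-unique E.⊤-terminal _ _ ,
       (proj₂ (term _) _ ∙ sym (proj₂ (term _) _)))) term h

  opaque
    Ā4-2 : ∀ {T U} {i₁ i₂ : T ⇒ U} → IsTerminal T → IsCoproduct i₁ i₂ → (h : U ⇒ T) → S̄ h
    Ā4-2 {T} {U} {i₁} {i₂} term cp h with E.coproduct E.⊤ E.⊤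
    ... | U₀ , κ₁ , κ₂ , cp₀ with y-coproduct cp₀ (i₁ ∘ proj₁ (term _)) (i₂ ∘ proj₁ (term _))
    ... | t , tκ₁ , tκ₂ , _ = terminal-small E.! (E.A4-2 E.⊤-terminal cp₀ E.!) t-cover term h
      where
        p' : T ⇒ Y₀ E.⊤
        p' = proj₁ (y-terminal E.⊤-terminal T)
        back : ∀ {i : T ⇒ U} {κ : E.⊤ E.⇒ U₀} → t ∘ Y₁ κ ≈ i ∘ proj₁ (term _) → t ∘ Y₁ κ ∘ p' ≈ i
        back {i} r = ext r ∙ i ▷ (proj₂ (term _) _ ∙ sym (proj₂ (term _) id)) ∙ identityʳ
        t-cover : Cover t
        t-cover m k mm t≈mk = C̄+.coproduct-joint cp m mm
          (k ∘ Y₁ κ₁ ∘ p' , (pull (sym t≈mk) ∙ back tκ₁)) (k ∘ Y₁ κ₂ ∘ p' , (pull (sym t≈mk) ∙ back tκ₂))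

  -- Collection in E makes the cover of the codomain of f and that of the domain of g compatible.
  opaque
    Ā5 : ∀ {A B D} {f : A ⇒ B} {g : B ⇒ D} → S̄ f → S̄ g → S̄ (g ∘ f)
    Ā5 {A} {B} {D} {f} {g} (A' , B' , f' , sf' , t , p , sqf) (B'' , D' , g' , sg' , u , r , sqg) with pullback p u
    ... | J , j₁ , j₂ , pbJ with probe j₁ | probe j₂
    -- `k₁` and `k₂` link the two objects over `B`. Since `p` is a cover, so is `k₂`; collection for
    -- `k₂` and `g'` yields a `Z` over `B''` that also maps to `B'` through `k₁`, so `f'` can be
    -- pulled back to it.
    ... | k₁ , k₁≈ | k₂ , k₂≈ with E.A7 k₂ g'
            (y-cover-reflect (cover-resp (sym k₂≈) (cover-∘ (cover-stable pbJ (proj₁ (proj₂ sqf))) (P.q-cover J)))) sg'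
    ... | Z , W , k , z , w , sk , sqk , (ζ , k₂ζ) with E.pullback f' (k₁ E.∘ ζ)
    ... | N , n₁ , n₂ , pbN = N , W , k E.∘ n₂ , E.A5 (E.A1 pbN sf') sk , t ∘ Y₁ n₁ , r ∘ Y₁ w ,
        mk-square comm (cover-∘ (proj₁ (proj₂ sqg)) (proj₁ (proj₂ sqk'))) lifts
      where
        sqk' : IsCoveringSquare (Y₁ z) (Y₁ k) (Y₁ g') (Y₁ w)
        sqk' = y-covering sqk

        p-k₁ζ : p ∘ Y₁ (k₁ E.∘ ζ) ≈ u ∘ Y₁ z
        p-k₁ζ = p ▷ (y-∘ ∙ k₁≈ ◁ Y₁ ζ ∙ assoc) ∙ ext (pb-comm pbJ) ∙ u ▷ (sym assoc ∙ sym k₂≈ ◁ Y₁ ζ ∙ y-tri k₂ζ)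

        comm : (g ∘ f) ∘ t ∘ Y₁ n₁ ≈ (r ∘ Y₁ w) ∘ Y₁ (k E.∘ n₂)
        comm = assoc ∙ g ▷ (ext (proj₁ sqf) ∙ p ▷ y-square (E.pb-comm pbN) ∙ ext p-k₁ζ) ∙ ext (proj₁ sqg) ∙
               r ▷ (ext (proj₁ sqk') ∙ Y₁ w ▷ sym y-∘) ∙ sym assoc

        lifts : Lifts (t ∘ Y₁ n₁) (Y₁ (k E.∘ n₂)) (g ∘ f) (r ∘ Y₁ w)
        lifts c b eq with square-lifts sqg (Y₁ w ∘ c) (f ∘ b) (sym assoc ∙ eq ∙ assoc)
        ... | T₁ , s₁ , cs₁ , b'' , g'b'' , ub'' with square-lifts sqk' (c ∘ s₁) b'' (sym assoc ∙ sym g'b'')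
        ... | T₂ , s₂ , cs₂ , x , kx , zx with square-lifts sqf (Y₁ (k₁ E.∘ ζ) ∘ x) (b ∘ s₁ ∘ s₂)
                (ext p-k₁ζ ∙ u ▷ zx ∙ pull ub'' ∙ assoc ∙ assoc)
        ... | T₃ , s₃ , cs₃ , a , f'a , ta with pb-pair (y-pullback pbN) a (x ∘ s₃) (f'a ∙ assoc)
        ... | ν , n₁ν , n₂ν = T₃ , (s₁ ∘ s₂) ∘ s₃ , cover-∘ (cover-∘ cs₁ cs₂) cs₃ , ν ,
          (y-∘ ◁ ν ∙ assoc ∙ Y₁ k ▷ n₂ν ∙ pull kx ∙ (assoc ◁ s₃) ∙ assoc) ,
          (assoc ∙ t ▷ n₁ν ∙ ta ∙ assoc)

  opaque
    Ā6 : ∀ {A B D} {f : A ⇒ B} {g : B ⇒ D} {h : A ⇒ D} → h ≈ g ∘ f → Cover f → S̄ h → S̄ g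
    Ā6 {f = f} {g} {h} h≈gf cf (_ , _ , f' , sf' , t , p , sq) = _ , _ , f' , sf' , f ∘ t , p ,
        mk-square (pull (sym h≈gf) ∙ proj₁ sq) (proj₁ (proj₂ sq)) lifts
      where
        lifts : Lifts (f ∘ t) (Y₁ f') g p
        lifts c b r with lift cf b
        ... | T , z , cz , x , fx with square-lifts sq (c ∘ z) x (pull r ∙ assoc ∙ g ▷ sym fx ∙ pull (sym h≈gf))
        ... | T' , z' , cz' , a , f'a , ta = T' , z ∘ z' , cover-∘ cz cz' , a , (f'a ∙ assoc) ,
          (assoc ∙ f ▷ ta ∙ ext fx)

  opaque
    -- The cover `p` is pulled back to `Y₀ A'` and refined by an object of E. Collection there,
    -- applied to `f'`, gives a square that is pasted onto the covering square of `f`.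
    Ā7 : ∀ {Y X A} (p : Y ⇒ X) (f : X ⇒ A) → Cover p → S̄ f →
        Σ Obj λ Z → Σ Obj λ B → Σ (Z ⇒ B) λ g → Σ (Z ⇒ X) λ z → Σ (B ⇒ A) λ b →
          S̄ g × IsCoveringSquare z g f b × (Σ (Z ⇒ Y) λ k → p ∘ k ≈ z)
    Ā7 p f cp (A' , C' , f' , sf' , t , π , sq) with pullback p t
    ... | W , w₁ , w₂ , pbW with probe w₂
    ... | w₀ , w≈ with E.A7 w₀ f'
            (y-cover-reflect (cover-resp (sym w≈) (cover-∘ (cover-stable pbW cp) (P.q-cover W)))) sf'
    ... | Z , B , g , z , b , sg , sqE , (k , w₀k) = Y₀ Z , Y₀ B , Y₁ g , t ∘ Y₁ z , π ∘ Y₁ b , y-small sg ,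
      square-∘ sq (y-covering sqE) , (w₁ ∘ P.q W) ∘ Y₁ k ,
      (p ▷ assoc ∙ ext (pb-comm pbW) ∙ t ▷ (sym assoc ∙ sym w≈ ◁ Y₁ k ∙ y-tri w₀k))

  opaque
    -- Beck-Chevalley along the covering square of `f` moves `m` and its quantifier to subobjects in
    -- E. There `A8` applies, and smallness of `a` descends along the bottom cover.
    Ā8 : ∀ {Y X M A} {f : Y ⇒ X} {m : M ⇒ Y} {a : A ⇒ X} → S̄ f → Mono m → S̄ m → IsForall f m a → S̄ a
    Ā8 {m = m} {a} (A' , C' , f' , sf' , t , π , sq) mm sm fa with pullback m t | pullback a π
    ... | _ , _ , _ , pbm | _ , _ , _ , pba with sub-pullback mm t pbm | sub-pullback (proj₁ fa) π pba
    ... | M₀ , m₀ , mm₀ , _ , pbm₀ | A₀ , a₀ , ma₀ , _ , pba₀ = Ā2 pba₀ (proj₁ (proj₂ sq)) (y-small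
      (E.A8 sf' mm₀ (y-small-reflect (Ā1 pbm₀ sm)) (y-forall-reflect mm₀ (forall-BC sq mm pbm₀ pba₀ fa))))

  opaque
    y-pair : ∀ {A B Z} (x : Z ⇒ Y₀ A) (y : Z ⇒ Y₀ B) → Σ (Z ⇒ Y₀ (A E.⊗ B)) λ w → (Y₁ E.π₁ ∘ w ≈ x) × (Y₁ E.π₂ ∘ w ≈ y)
    y-pair x y = pb-pair (y-pullback E.⊗-pullback) x y (y-terminal-unique E.⊤-terminal _ _)

  opaque
    y-⊗-unique : ∀ {A B Z} {x y : Z ⇒ Y₀ (A E.⊗ B)} → Y₁ E.π₁ ∘ x ≈ Y₁ E.π₁ ∘ y → Y₁ E.π₂ ∘ x ≈ Y₁ E.π₂ ∘ y → x ≈ y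
    y-⊗-unique = pb-jm (y-pullback E.⊗-pullback)

  opaque
    product-unique : ∀ {P A B Z} {p₁ : P ⇒ A} {p₂ : P ⇒ B} {x y : Z ⇒ P} → IsProduct p₁ p₂ →
                     p₁ ∘ x ≈ p₁ ∘ y → p₂ ∘ x ≈ p₂ ∘ y → x ≈ y
    product-unique {p₁ = p₁} {p₂} {x} {y} prod r r' with prod (p₁ ∘ y) (p₂ ∘ y)
    ... | _ , _ , _ , uniq = uniq x r r' ∙ sym (uniq y refl refl)

  opaque
    -- The relation presenting `A` is the pullback of the diagonal along `q × q`, so the diagonal is
    -- covered by it; smallness is the boundedness of the presenting relation.
    Ā9 : ∀ {A P} {p₁ p₂ : P ⇒ A} → IsProduct p₁ p₂ → (d : A ⇒ P) → p₁ ∘ d ≈ id → p₂ ∘ d ≈ id → S̄ d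
    Ā9 {A} {P} {p₁} {p₂} prod d p₁d p₂d with prod (P.q A ∘ Y₁ E.π₁) (P.q A ∘ Y₁ E.π₂)
    ... | u , p₁u , p₂u , _ = _ , _ , E.⟨ ρ.r₁ , ρ.r₂ ⟩ , E.bounded-⟨⟩ (P.bounded A) , P.q A ∘ Y₁ ρ.r₁ , u ,
        mk-square comm cover lifts
      where
        module ρ = E.EqRel (P.rel A)
        comm : d ∘ P.q A ∘ Y₁ ρ.r₁ ≈ u ∘ Y₁ E.⟨ ρ.r₁ , ρ.r₂ ⟩
        comm = product-unique prod
          (cancel p₁d ∙ P.q A ▷ sym (y-tri E.π₁-β) ∙ sym assoc ∙ push p₁u)
          (cancel p₂d ∙ pb-comm (P.q-kernel A) ∙ P.q A ▷ sym (y-tri E.π₂-β) ∙ sym assoc ∙ push p₂u)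
        cover : Cover u
        cover with lift₂ (P.q-cover A) (P.q-cover A) p₁ p₂
        ... | T , t , ct , x , y , qx , qy with y-pair x y
        ... | w , w₁ , w₂ = cover-cancel (cover-resp (sym (product-unique prod
          (pull p₁u ∙ assoc ∙ P.q A ▷ w₁ ∙ qx) (pull p₂u ∙ assoc ∙ P.q A ▷ w₂ ∙ qy))) ct)
        lifts : Lifts (P.q A ∘ Y₁ ρ.r₁) (Y₁ E.⟨ ρ.r₁ , ρ.r₂ ⟩) d u
        lifts c b r with pb-pair (P.q-kernel A) (Y₁ E.π₁ ∘ c) (Y₁ E.π₂ ∘ c) (q₁ ∙ sym q₂)
          where
            q₁ : P.q A ∘ Y₁ E.π₁ ∘ c ≈ b
            q₁ = sym assoc ∙ push p₁u ∙ p₁ ▷ r ∙ cancel p₁d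
            q₂ : P.q A ∘ Y₁ E.π₂ ∘ c ≈ b
            q₂ = sym assoc ∙ push p₂u ∙ p₂ ▷ r ∙ cancel p₂d
        ... | w , r₁w , r₂w = _ , id , iso-cover id-iso , w ,
          (y-⊗-unique (pull (y-tri E.π₁-β) ∙ r₁w) (pull (y-tri E.π₂-β) ∙ r₂w) ∙ sym identityʳ) ,
          (assoc ∙ P.q A ▷ r₁w ∙ sym assoc ∙ push p₁u ∙ p₁ ▷ r ∙ cancel p₁d ∙ sym identityʳ)

  smallMaps : IsSmallMaps C̄ S̄
  smallMaps = record
    { S-resp-≈ = S̄-resp-≈ ; A1 = Ā1 ; A2 = Ā2 ; A3 = Ā3 ; A4-0 = Ā4-0 ; A4-1 = Ā4-1 ; A4-2 = Ā4-2
    ; A5 = Ā5 ; A6 = Ā6 ; A7 = Ā7 ; A8 = Ā8 ; A9 = Ā9 }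

  Ē : CatWithSmallMaps o₁ ℓ₁ e₁ (o ⊔ ℓ ⊔ s ⊔ o₁ ⊔ ℓ₁ ⊔ e₁)
  Ē = record { cat = C̄ ; heyting = positiveHeyting ; S = S̄ ; small = smallMaps }

  yMorphism : Morphism E Ē
  yMorphism = record
    { functor = Y ; pres-terminal = y-terminal ; pres-pullback = y-pullback ; pres-cover = y-cover
    ; pres-initial = y-initial ; pres-coproduct = y-coproduct
    ; pres-least = Preservation.pres-least E.heyting positiveHeyting Y y-pullback y-initial
    ; pres-union = Preservation.pres-union E.heyting positiveHeyting Y y-pullback y-initial y-cover y-coproduct
    ; pres-forall = y-forall ; pres-small = y-small }

  -- Quotients of bounded equivalence relations in the completion

  module Exactness {A : Obj} (ρ̄ : EqRel A) where
    private
      module R̄ = EqRel ρ̄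
      X : E.Obj
      X = P.X A
      q : Y₀ X ⇒ A
      q = P.q A

    q² : Y₀ (X E.⊗ X) ⇒ A ⊗ A
    q² = ⟨ q ∘ Y₁ E.π₁ , q ∘ Y₁ E.π₂ ⟩

    module Restricted {M : E.Obj} (m : M E.⇒ X E.⊗ X) (mm : E.Mono m) (sm : E.S m) {k : Y₀ M ⇒ R̄.R}
                      (pb : IsPullback k (Y₁ m) ⟨ R̄.r₁ , R̄.r₂ ⟩ q²) where
      s₁ : M E.⇒ X
      s₁ = E.π₁ E.∘ m
      s₂ : M E.⇒ X
      s₂ = E.π₂ E.∘ m

      opaque
        down : ∀ {T} {x y : T E.⇒ X} (j : T E.⇒ M) → s₁ E.∘ j E.≈ x → s₂ E.∘ j E.≈ y → q ∘ Y₁ x R̄.~ q ∘ Y₁ y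
        down j p p' = k ∘ Y₁ j ,
          (push π₁-β ∙ π₁ ▷ ext (pb-comm pb) ∙ pull π₁-β ∙ assoc ∙ q ▷ (pull (sym y-∘) ∙ y-tri p)) ,
          (push π₂-β ∙ π₂ ▷ ext (pb-comm pb) ∙ pull π₂-β ∙ assoc ∙ q ▷ (pull (sym y-∘) ∙ y-tri p'))

      opaque
        up : ∀ {T} {x y : T E.⇒ X} → q ∘ Y₁ x R̄.~ q ∘ Y₁ y → Σ (T E.⇒ M) λ j → (s₁ E.∘ j E.≈ x) × (s₂ E.∘ j E.≈ y)
        up {x = x} {y} (j̄ , p , p') with pb-pair pb j̄ (Y₁ E.⟨ x , y ⟩) (⊗-unique
          (pull π₁-β ∙ p ∙ q ▷ sym (y-tri E.π₁-β) ∙ sym assoc ∙ push π₁-β)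
          (pull π₂-β ∙ p' ∙ q ▷ sym (y-tri E.π₂-β) ∙ sym assoc ∙ push π₂-β))
        ... | u , _ , mu with y-full u
        ... | u₀ , u≈ = u₀ , (E.assoc E.∙ E.π₁ E.▷ y-tri⁻¹ (Y₁ m ▷ u≈ ∙ mu) E.∙ E.π₁-β) ,
                             (E.assoc E.∙ E.π₂ E.▷ y-tri⁻¹ (Y₁ m ▷ u≈ ∙ mu) E.∙ E.π₂-β)

      opaque
        s-equivRel : E.IsEquivRel s₁ s₂
        s-equivRel = E.mk-equivRel
          (λ g h p p' → mm g h (E.⊗-unique (E.sym E.assoc E.∙ p E.∙ E.assoc) (E.sym E.assoc E.∙ p' E.∙ E.assoc)))
          (up (R̄.~-refl refl))
          (up (R̄.~-sym (down E.id E.identityʳ E.identityʳ)))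
          (λ i j p → up (R̄.~-trans (down i E.refl E.refl) (down j (E.sym p) E.refl)))

      opaque
        s-bounded : IsBoundedRel E s₁ s₂
        s-bounded = E.⟨⟩-bounded (E.S-resp-≈ (E.⊗-unique (E.sym E.π₁-β) (E.sym E.π₂-β)) sm)

      opaque
        locals : ∀ {Z} (a b : Z ⇒ A) → Σ E.Obj λ T → Σ (Y₀ T ⇒ Z) λ t → Cover t ×
                 Σ (T E.⇒ X) λ x → Σ (T E.⇒ X) λ y → (q ∘ Y₁ x ≈ a ∘ t) × (q ∘ Y₁ y ≈ b ∘ t)
        locals a b with lift₂ (P.q-cover A) (P.q-cover A) a b
        ... | T , t , ct , u , v , qu , qv with probe u | probe v
        ... | u₀ , u≈ | v₀ , v≈ = P.X T , t ∘ P.q T , cover-∘ ct (P.q-cover T) , u₀ , v₀ ,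
          (q ▷ u≈ ∙ ext qu) , (q ▷ v≈ ∙ ext qv)

      module _ {Q₀ : Obj} {q₀ : Y₀ X ⇒ Q₀} (cq₀ : Cover q₀) (ker : IsPullback (Y₁ s₁) (Y₁ s₂) q₀ q₀) where
        opaque
          q₀⇒ : ∀ {T} {x y : T E.⇒ X} → q ∘ Y₁ x R̄.~ q ∘ Y₁ y → q₀ ∘ Y₁ x ≈ q₀ ∘ Y₁ y
          q₀⇒ r with up r
          ... | j , p , p' = q₀ ▷ sym (y-tri p) ∙ ext (pb-comm ker) ∙ q₀ ▷ y-tri p'

        opaque
          q₀⇐ : ∀ {T} {x y : T E.⇒ X} → q₀ ∘ Y₁ x ≈ q₀ ∘ Y₁ y → q ∘ Y₁ x R̄.~ q ∘ Y₁ y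
          q₀⇐ {x = x} {y} r with pb-pair ker (Y₁ x) (Y₁ y) r
          ... | j , p , p' with y-full j
          ... | j₀ , j≈ = down j₀ (y-tri⁻¹ (Y₁ s₁ ▷ j≈ ∙ p)) (y-tri⁻¹ (Y₁ s₂ ▷ j≈ ∙ p'))

        opaque
          q₀-resp : ∀ {T} (u v : T ⇒ Y₀ X) → q ∘ u ≈ q ∘ v → q₀ ∘ u ≈ q₀ ∘ v
          q₀-resp {T} u v r with probe u | probe v
          ... | u₀ , u≈ | v₀ , v≈ = cover-epi (P.q-cover T) (assoc ∙ q₀ ▷ sym u≈ ∙
            q₀⇒ (R̄.~-refl (q ▷ u≈ ∙ pull r ∙ assoc ∙ q ▷ sym v≈)) ∙ q₀ ▷ v≈ ∙ sym assoc)

        opaque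
          -- Reflexivity of the given relation on `A` makes `q₀` constant on the fibres of `q`, so
          -- it descends to `A`. That the descended map has this relation as kernel pair is tested
          -- on local representatives in `X`.
          quotient-from : Σ (A ⇒ Q₀) λ g → IsQuotient R̄.r₁ R̄.r₂ g
          quotient-from with descend q₀ (P.q-cover A) q₀-resp
          ... | g , gq = g , cover-quotient (cover-cancel (cover-resp (sym gq) cq₀))
                               (mk-pullback comm (λ {_} {x} {y} → proj₁ R̄.equivRel x y) sur)
            where
              comm : g ∘ R̄.r₁ ≈ g ∘ R̄.r₂
              comm with locals R̄.r₁ R̄.r₂
              ... | T , t , ct , x , y , qx , qy = cover-epi ct (assoc ∙ g ▷ sym qx ∙ pull gq ∙
                q₀⇒ (t , sym qx , sym qy) ∙ push gq ∙ g ▷ qy ∙ sym assoc)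

              sur : ∀ {Z} (a b : Z ⇒ A) → g ∘ a ≈ g ∘ b → Σ Obj λ T → Σ (T ⇒ Z) λ t → Cover t ×
                    Σ (T ⇒ R̄.R) λ w → (R̄.r₁ ∘ w ≈ a ∘ t) × (R̄.r₂ ∘ w ≈ b ∘ t)
              sur a b r with locals a b
              ... | T , t , ct , x , y , qx , qy with q₀⇐ (push gq ∙ g ▷ qx ∙ pull r ∙ assoc ∙ g ▷ sym qy ∙ pull gq)
              ... | w , p , p' = Y₀ T , t , ct , w , (p ∙ qx) , (p' ∙ qy)

    opaque
      quotient : IsBoundedRel Ē R̄.r₁ R̄.r₂ → Σ Obj λ Q → Σ (A ⇒ Q) λ g → IsQuotient R̄.r₁ R̄.r₂ g
      quotient bd with pullback ⟨ R̄.r₁ , R̄.r₂ ⟩ q²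
      ... | _ , _ , _ , pb₀ with sub-pullback R̄.⟨r⟩-mono q² pb₀
      ... | M , m , mm , k , pb
        with y-small-reflect (Ā1 pb (bd π₁ π₂ ⊗-product ⟨ R̄.r₁ , R̄.r₂ ⟩ π₁-β π₂-β))
      ... | sm with effective (record { equivRel = Restricted.s-equivRel m mm sm pb })
                              (Restricted.s-bounded m mm sm pb)
      ... | Q₀ , q₀ , cq₀ , ker = Q₀ , Restricted.quotient-from m mm sm pb cq₀ ker

  Ē-exact : IsExact Ē
  Ē-exact r₁ r₂ eq bd = Exactness.quotient (record { r₁ = r₁ ; r₂ = r₂ ; equivRel = eq }) bd

-- Extending a morphism to the completion

record SmallMapCategory : Setω where
  field
    {o ℓ e s} : Level
    structure : CatWithSmallMaps o ℓ e s

module Extension (V : Envelope) (K : SmallMapCategory) where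
  open SmallMapCategory K using () renaming (structure to F; o to o₂; ℓ to ℓ₂; e to e₂)
  private
    module V = EnvelopeTheory V
  open V using (E; module E; module P; Y₀; Y₁; y-∘; o; ℓ; e₁)
  open SmallMaps F

  module Extend (G : Morphism E F) where
    private
      module G = Morphism G

    opaque
      G-⊗-unique : ∀ {A B Z} {x y : Z ⇒ G.F₀ (A E.⊗ B)} → G.F₁ E.π₁ ∘ x ≈ G.F₁ E.π₁ ∘ y →
                   G.F₁ E.π₂ ∘ x ≈ G.F₁ E.π₂ ∘ y → x ≈ y
      G-⊗-unique = pb-jm (G.pres-pullback E.⊗-pullback)

    opaque
      G-pair : ∀ {A B Z} (x : Z ⇒ G.F₀ A) (y : Z ⇒ G.F₀ B) →
               Σ (Z ⇒ G.F₀ (A E.⊗ B)) λ w → (G.F₁ E.π₁ ∘ w ≈ x) × (G.F₁ E.π₂ ∘ w ≈ y)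
      G-pair x y = pb-pair (G.pres-pullback E.⊗-pullback) x y
        (proj₂ (G.pres-terminal E.⊤-terminal _) _ ∙ sym (proj₂ (G.pres-terminal E.⊤-terminal _) _))

    opaque
      G-tri : ∀ {A B D Z} {f : A E.⇒ B} {g : B E.⇒ D} {h : A E.⇒ D} {x : Z ⇒ G.F₀ A} → g E.∘ f E.≈ h →
              G.F₁ g ∘ G.F₁ f ∘ x ≈ G.F₁ h ∘ x
      G-tri p = pull (sym G.homomorphism ∙ G.F-resp-≈ p)

    opaque
      G-tri₂ : ∀ {A B D} {f : A E.⇒ B} {g : B E.⇒ D} {h : A E.⇒ D} → g E.∘ f E.≈ h → G.F₁ g ∘ G.F₁ f ≈ G.F₁ h
      G-tri₂ p = sym G.homomorphism ∙ G.F-resp-≈ p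

    opaque
      G-mono : ∀ {A B} {m : A E.⇒ B} → E.Mono m → Mono (G.F₁ m)
      G-mono = Preservation.pres-mono E.heyting heyting G.functor G.pres-pullback

    -- An element of H A over Z is locally ⟦ q ⟧ of an element of G X, where q : yX → A presents A.
    module ExtensionAlong (H : Functor V.C̄ cat)
        (θ : ∀ T → G.F₀ T ⇒ Functor.F₀ H (Y₀ T)) (θ-iso : ∀ T → IsIso (θ T))
        (θ-natural : ∀ {S T} (f : S E.⇒ T) → θ T ∘ G.F₁ f ≈ Functor.F₁ H (Y₁ f) ∘ θ S)
        (⟦q⟧-cover : ∀ A → Cover (Functor.F₁ H (P.q A) ∘ θ (P.X A)))
        (⟦q⟧-kernel : ∀ A → IsPullback (G.F₁ (E.EqRel.r₁ (P.rel A))) (G.F₁ (E.EqRel.r₂ (P.rel A)))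
                                       (Functor.F₁ H (P.q A) ∘ θ (P.X A)) (Functor.F₁ H (P.q A) ∘ θ (P.X A))) where
      private
        module H = Functor H

      ⟦_⟧ : ∀ {T A} → Y₀ T V.⇒ A → G.F₀ T ⇒ H.F₀ A
      ⟦_⟧ {T} a = H.F₁ a ∘ θ T

      opaque
        ⟦⟧-resp : ∀ {T A} {a b : Y₀ T V.⇒ A} → a V.≈ b → ⟦ a ⟧ ≈ ⟦ b ⟧
        ⟦⟧-resp p = H.F-resp-≈ p ◁ θ _

      opaque
        ⟦⟧-post : ∀ {T A B} (h : A V.⇒ B) {a : Y₀ T V.⇒ A} → H.F₁ h ∘ ⟦ a ⟧ ≈ ⟦ h V.∘ a ⟧
        ⟦⟧-post h = pull (sym H.homomorphism)

      opaque
        ⟦⟧-pre : ∀ {S T A} {a : Y₀ T V.⇒ A} (t : S E.⇒ T) → ⟦ a ⟧ ∘ G.F₁ t ≈ ⟦ a V.∘ Y₁ t ⟧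
        ⟦⟧-pre {a = a} t = assoc ∙ H.F₁ a ▷ θ-natural t ∙ pull (sym H.homomorphism)

      opaque
        ⟦⟧-eval : ∀ {S T A Z} {a : Y₀ T V.⇒ A} {b : Y₀ S V.⇒ A} {t : S E.⇒ T} {x : Z ⇒ G.F₀ S} →
                  a V.∘ Y₁ t V.≈ b → ⟦ b ⟧ ∘ x ≈ ⟦ a ⟧ ∘ G.F₁ t ∘ x
        ⟦⟧-eval {t = t} {x} p = sym (⟦⟧-pre t ∙ ⟦⟧-resp p) ◁ x ∙ assoc

      record Equaliser {T D Z} (a b : Y₀ T V.⇒ D) (x : Z ⇒ G.F₀ T) : Set (o ⊔ ℓ ⊔ e₁ ⊔ o₂ ⊔ ℓ₂ ⊔ e₂) where
        field
          {Z'} : Obj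
          {N} : E.Obj
          z : Z' ⇒ Z
          z-cover : Cover z
          n : N E.⇒ T
          agree : a V.∘ Y₁ n V.≈ b V.∘ Y₁ n
          w : Z' ⇒ G.F₀ N
          nw : G.F₁ n ∘ w ≈ x ∘ z

      opaque
        -- On a cover `U` of `T` the maps `a` and `b` lift to `f` and `g` into the presenting object
        -- of `D`. By `⟦q⟧-kernel`, agreement of their values in F means that `f` and `g` are
        -- related under `G`; hence the lifted element factors through `G` of the part `N` of `U`
        -- where `f` and `g` are related already in E.
        equalise : ∀ {T D Z} (a b : Y₀ T V.⇒ D) (x : Z ⇒ G.F₀ T) → ⟦ a ⟧ ∘ x ≈ ⟦ b ⟧ ∘ x → Equaliser a b x
        equalise {T} {D} a b x r with V.locally-X a
        ... | U₁ , t₁ , ct₁ , f₁ , qf₁ with V.locally-X (b V.∘ Y₁ t₁)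
        ... | U , t₂ , ct₂ , g , qg with lift (G.pres-cover (E.cover-∘ ct₁ ct₂)) x
        ... | Z' , z , cz , u , tu = finish
          where
            module ρ = E.EqRel (P.rel D)
            t : U E.⇒ T
            t = t₁ E.∘ t₂
            f : U E.⇒ P.X D
            f = f₁ E.∘ t₂
            qf : P.q D V.∘ Y₁ f V.≈ a V.∘ Y₁ t
            qf = P.q D V.▷ y-∘ V.∙ V.ext qf₁ V.∙ a V.▷ V.sym y-∘
            qg' : P.q D V.∘ Y₁ g V.≈ b V.∘ Y₁ t
            qg' = qg V.∙ V.assoc V.∙ b V.▷ V.sym y-∘
            related : ⟦ P.q D ⟧ ∘ G.F₁ f ∘ u ≈ ⟦ P.q D ⟧ ∘ G.F₁ g ∘ u
            related = sym (⟦⟧-eval qf) ∙ ⟦⟧-eval V.refl ∙ ⟦ a ⟧ ▷ tu ∙ pull r ∙ assoc ∙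
                      ⟦ b ⟧ ▷ sym tu ∙ sym (⟦⟧-eval V.refl) ∙ ⟦⟧-eval qg'
            finish : Equaliser a b x
            finish with pb-pair (⟦q⟧-kernel D) _ _ related | E.pullback E.⟨ f , g ⟩ E.⟨ ρ.r₁ , ρ.r₂ ⟩
            ... | w , r₁w , r₂w | N , n₁ , n₂ , pbN
              with pb-pair (G.pres-pullback pbN) u w
                (G-⊗-unique (G-tri E.π₁-β ∙ sym r₁w ∙ sym (G-tri E.π₁-β)) (G-tri E.π₂-β ∙ sym r₂w ∙ sym (G-tri E.π₂-β)))
            ... | ν , n₁ν , _ = record
              { z = z ; z-cover = cz ; n = t E.∘ n₁ ; w = ν
              ; agree = a V.▷ y-∘ V.∙ V.sym (V.ext qf) V.∙ P.q D V.▷ V.sym y-∘ V.∙ same V.∙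
                        P.q D V.▷ y-∘ V.∙ V.ext qg' V.∙ b V.▷ V.sym y-∘
              ; nw = G.homomorphism ◁ ν ∙ assoc ∙ G.F₁ t ▷ n₁ν ∙ tu }
              where
                same : P.q D V.∘ Y₁ (f E.∘ n₁) V.≈ P.q D V.∘ Y₁ (g E.∘ n₁)
                same = V.~⇒≈ D (n₂ , (E.push E.π₁-β E.∙ E.π₁ E.▷ E.sym (E.pb-comm pbN) E.∙ E.pull E.π₁-β) ,
                                     (E.push E.π₂-β E.∙ E.π₂ E.▷ E.sym (E.pb-comm pbN) E.∙ E.pull E.π₂-β))

      opaque
        -- The presentation of `A` factors locally through `a`, so a cover of `H.F₀ A` factors
        -- through `⟦ a ⟧`.
        ⟦⟧-cover : ∀ {T A} {a : Y₀ T V.⇒ A} → V.Cover a → Cover ⟦ a ⟧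
        ⟦⟧-cover {A = A} {a} ca with V.locally ca (P.q A)
        ... | S , t , ct , x , ax with V.y-full x
        ... | x₀ , x≈ = cover-cancel {f = G.F₁ x₀} (cover-resp
          (⟦⟧-pre t ∙ ⟦⟧-resp (V.sym ax V.∙ a V.▷ V.sym x≈) ∙ sym (⟦⟧-pre x₀)) (cover-∘ (⟦q⟧-cover A) (G.pres-cover ct)))

      opaque
        pres-cover : ∀ {A B} {f : A V.⇒ B} → V.Cover f → Cover (H.F₁ f)
        pres-cover {A} {f = f} cf = cover-cancel (cover-resp (sym (⟦⟧-post f))
          (⟦⟧-cover (V.cover-∘ cf (P.q-cover A))))

      opaque
        pres-terminal : ∀ {T} → V.IsTerminal T → IsTerminal (H.F₀ T)
        pres-terminal {T} term Z = ⟦ t ⟧ ∘ proj₁ (G.pres-terminal E.⊤-terminal Z) , uniq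
          where
            t : Y₀ E.⊤ V.⇒ T
            t = proj₁ (term (Y₀ E.⊤))
            ⟦t⟧-cover : Cover ⟦ t ⟧
            ⟦t⟧-cover = ⟦⟧-cover (V.iso-cover (proj₁ (V.y-terminal E.⊤-terminal T) ,
              V.y-terminal-unique E.⊤-terminal _ _ , (proj₂ (term _) _ V.∙ V.sym (proj₂ (term _) _))))
            uniq : ∀ (h : Z ⇒ H.F₀ T) → h ≈ ⟦ t ⟧ ∘ proj₁ (G.pres-terminal E.⊤-terminal Z)
            uniq h with lift ⟦t⟧-cover h
            ... | W , w , cw , x , tx = cover-epi cw (sym tx ∙ ⟦ t ⟧ ▷ (proj₂ (G.pres-terminal E.⊤-terminal W) _ ∙
              sym (proj₂ (G.pres-terminal E.⊤-terminal W) _)) ∙ sym assoc)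

      opaque
        pres-initial : ∀ {I} → V.IsInitial I → IsInitial (H.F₀ I)
        pres-initial i with E.initial
        ... | Z , zi = initial-stable (G.pres-initial zi) (proj₁ (θ-iso Z) ∘ H.F₁ (proj₁ (i (Y₀ Z))))

      opaque
        pres-pullback : ∀ {P A B D} {p : P V.⇒ A} {q : P V.⇒ B} {f : A V.⇒ D} {g : B V.⇒ D} →
          V.IsPullback p q f g → IsPullback (H.F₁ p) (H.F₁ q) (H.F₁ f) (H.F₁ g)
        pres-pullback {P} {A} {B} {D} {p} {q} {f} {g} pb = mk-pullback
            (sym H.homomorphism ∙ H.F-resp-≈ (V.pb-comm pb) ∙ H.homomorphism) jm sur
          where
            at : ∀ {C C' T T' Z} {h : C V.⇒ C'} {a : Y₀ T V.⇒ C} {π : T' E.⇒ T} {w : Z ⇒ G.F₀ T'}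
                 {u : Z ⇒ G.F₀ T} {x : Z ⇒ H.F₀ C} → G.F₁ π ∘ w ≈ u → ⟦ a ⟧ ∘ u ≈ x →
                 ⟦ (h V.∘ a) V.∘ Y₁ π ⟧ ∘ w ≈ H.F₁ h ∘ x
            at {h = h} {a} πw ax = ⟦⟧-eval V.refl ∙ ⟦ h V.∘ a ⟧ ▷ πw ∙ push (⟦⟧-post h) ∙ H.F₁ h ▷ ax

            jm : ∀ {Z} {x y : Z ⇒ H.F₀ P} → H.F₁ p ∘ x ≈ H.F₁ p ∘ y → H.F₁ q ∘ x ≈ H.F₁ q ∘ y → x ≈ y
            jm {x = x} {y} r r' with lift₂ (⟦q⟧-cover P) (⟦q⟧-cover P) x y
            ... | W , t , ct , u , v , qu , qv with G-pair u v
            ... | w , w₁ , w₂ with equalise ((p V.∘ P.q P) V.∘ Y₁ E.π₁) ((p V.∘ P.q P) V.∘ Y₁ E.π₂) w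
                    (at w₁ qu ∙ pull r ∙ assoc ∙ sym (at w₂ qv))
            -- `equalise` is applied twice: on the stage where the components under `p` agree, it
            -- makes those under `q` agree too, after which joint monicity in Ē identifies the two
            -- elements of `P`.
            ... | E₁ with equalise (((q V.∘ P.q P) V.∘ Y₁ E.π₁) V.∘ Y₁ (Equaliser.n E₁))
                                   (((q V.∘ P.q P) V.∘ Y₁ E.π₂) V.∘ Y₁ (Equaliser.n E₁)) (Equaliser.w E₁)
                    (⟦⟧-eval V.refl ∙ _ ▷ Equaliser.nw E₁ ∙ pull (at w₁ qu ∙ pull r' ∙ assoc ∙ sym (at w₂ qv)) ∙ assoc ∙
                     sym (_ ▷ Equaliser.nw E₁) ∙ sym (⟦⟧-eval V.refl))
            ... | E₂ = cover-epi ct (cover-epi (cover-∘ E₁.z-cover E₂.z-cover)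
                    (sym (⟦⟧-eval V.refl ∙ ⟦ P.q P ⟧ ▷ w₁ ∙ qu) ◁ (E₁.z ∘ E₂.z) ∙ assoc ∙ final ∙ sym assoc ∙
                     (⟦⟧-eval V.refl ∙ ⟦ P.q P ⟧ ▷ w₂ ∙ qv) ◁ (E₁.z ∘ E₂.z)))
              where
                module E₁ = Equaliser E₁
                module E₂ = Equaliser E₂
                left right : Y₀ (P.X P E.⊗ P.X P) V.⇒ P
                left = P.q P V.∘ Y₁ E.π₁
                right = P.q P V.∘ Y₁ E.π₂
                nest : ∀ {C} {h : P V.⇒ C} {π : (P.X P E.⊗ P.X P) E.⇒ P.X P} →
                       h V.∘ ((P.q P V.∘ Y₁ π) V.∘ Y₁ E₁.n) V.∘ Y₁ E₂.n V.≈
                       (((h V.∘ P.q P) V.∘ Y₁ π) V.∘ Y₁ E₁.n) V.∘ Y₁ E₂.n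
                nest = V.sym V.assoc V.∙ (V.sym V.assoc V.∙ V.sym V.assoc V.◁ Y₁ E₁.n) V.◁ Y₁ E₂.n
                same : (left V.∘ Y₁ E₁.n) V.∘ Y₁ E₂.n V.≈ (right V.∘ Y₁ E₁.n) V.∘ Y₁ E₂.n
                same = V.pb-jm pb (nest V.∙ E₁.agree V.◁ Y₁ E₂.n V.∙ V.sym nest) (nest V.∙ E₂.agree V.∙ V.sym nest)
                final : ⟦ left ⟧ ∘ w ∘ E₁.z ∘ E₂.z ≈ ⟦ right ⟧ ∘ w ∘ E₁.z ∘ E₂.z
                final = ⟦ left ⟧ ▷ (pull (sym E₁.nw) ∙ assoc ∙ G.F₁ E₁.n ▷ sym E₂.nw) ∙
                  sym (⟦⟧-eval V.refl) ∙ sym (⟦⟧-eval same) ∙ ⟦⟧-eval V.refl ∙ ⟦⟧-eval V.refl ∙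
                  ⟦ right ⟧ ▷ (G.F₁ E₁.n ▷ E₂.nw ∙ ext E₁.nw)

            sur : ∀ {Z} (a : Z ⇒ H.F₀ A) (b : Z ⇒ H.F₀ B) → H.F₁ f ∘ a ≈ H.F₁ g ∘ b → Σ Obj λ T → Σ (T ⇒ Z) λ t →
                  Cover t × Σ (T ⇒ H.F₀ P) λ w → (H.F₁ p ∘ w ≈ a ∘ t) × (H.F₁ q ∘ w ≈ b ∘ t)
            sur a b r with lift₂ (⟦q⟧-cover A) (⟦q⟧-cover B) a b
            ... | W , t , ct , u , v , qu , qv with G-pair u v
            ... | w , w₁ , w₂ with equalise ((f V.∘ P.q A) V.∘ Y₁ E.π₁) ((g V.∘ P.q B) V.∘ Y₁ E.π₂) w
                    (at w₁ qu ∙ pull r ∙ assoc ∙ sym (at w₂ qv))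
            ... | E₁ with V.pb-pair pb ((P.q A V.∘ Y₁ E.π₁) V.∘ Y₁ (Equaliser.n E₁))
                                       ((P.q B V.∘ Y₁ E.π₂) V.∘ Y₁ (Equaliser.n E₁))
                    (f V.▷ V.assoc V.∙ V.sym V.assoc V.∙ V.sym V.assoc V.∙ Equaliser.agree E₁ V.∙
                     V.assoc V.∙ V.assoc V.∙ g V.▷ V.sym V.assoc)
            ... | ν , pν , qν = _ , t ∘ E₁.z , cover-∘ ct E₁.z-cover , ⟦ ν ⟧ ∘ E₁.w ,
                  (pull (⟦⟧-post p ∙ ⟦⟧-resp pν) ∙ back w₁ qu) , (pull (⟦⟧-post q ∙ ⟦⟧-resp qν) ∙ back w₂ qv)
              where
                module E₁ = Equaliser E₁
                back : ∀ {C} {π : _ E.⇒ P.X C} {u : W ⇒ G.F₀ (P.X C)} {x : _ ⇒ H.F₀ C} → G.F₁ π ∘ w ≈ u →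
                       ⟦ P.q C ⟧ ∘ u ≈ x ∘ t →
                       ⟦ (P.q C V.∘ Y₁ π) V.∘ Y₁ E₁.n ⟧ ∘ E₁.w ≈ x ∘ t ∘ E₁.z
                back {C} πw qx = ⟦⟧-eval V.refl ∙ _ ▷ E₁.nw ∙ ⟦⟧-eval V.refl ∙ ⟦ P.q C ⟧ ▷ pull πw ∙ pull qx ∙ assoc

      opaque
        pres-mono : ∀ {A B} {m : A V.⇒ B} → V.Mono m → Mono (H.F₁ m)
        pres-mono = Preservation.pres-mono V.positiveHeyting heyting H pres-pullback

      opaque
        pres-coproduct : ∀ {S A B} {i₁ : A V.⇒ S} {i₂ : B V.⇒ S} →
          V.IsCoproduct i₁ i₂ → IsCoproduct (H.F₁ i₁) (H.F₁ i₂)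
        pres-coproduct {S} {A} {B} {i₁} {i₂} cp with V.coproduct-char cp
        ... | char = coproduct-intro (pres-mono C.mono₁) (pres-mono C.mono₂) disj cov
          where
            module C = V.CharacterisedCoproduct char
            -- Splitting the generic element is enough, because `⟦ P.q S ⟧` covers `H.F₀ S`.
            module L = V.LocalSplit (C.split (P.q S))

            disj : Disjoint (H.F₁ i₁) (H.F₁ i₂)
            disj a b r with V.pullback i₁ i₂
            ... | P , p , q , pb with pb-pair (pres-pullback pb) a b r
            ... | u , _ = initial-stable (pres-initial (C.disj p q (V.pb-comm pb))) u

            part : ∀ {T' D} {i : D V.⇒ S} {a : Y₀ T' V.⇒ D} {l : T' E.⇒ _} →
                   i V.∘ a V.≈ P.q S V.∘ Y₁ L.t V.∘ Y₁ l →
                   H.F₁ i ∘ ⟦ a ⟧ ≈ (⟦ P.q S ⟧ ∘ G.F₁ L.t) ∘ G.F₁ l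
            part {i = i} {l = l} p = ⟦⟧-post i ∙ ⟦⟧-resp (p V.∙ V.sym V.assoc) ∙ sym (⟦⟧-pre l) ∙
                                     sym (⟦⟧-pre L.t) ◁ G.F₁ l

            cov : ∀ {Z} (a : H.F₀ A ⇒ Z) (b : H.F₀ B ⇒ Z) → CopairCover (H.F₁ i₁) (H.F₁ i₂) a b
            cov a b with G.pres-coproduct L.l-coproduct (a ∘ ⟦ L.a ⟧) (b ∘ ⟦ L.b ⟧)
            ... | h , hl₁ , hl₂ , _ = record
              { j₁ = G.F₁ L.l₁ ; j₂ = G.F₁ L.l₂ ; splits = coproduct-splits (G.pres-coproduct L.l-coproduct)
              ; k = ⟦ P.q S ⟧ ∘ G.F₁ L.t ; k-cover = cover-∘ (⟦q⟧-cover S) (G.pres-cover L.t-cover)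
              ; a₁ = ⟦ L.a ⟧ ; b₁ = ⟦ L.b ⟧ ; ka = part L.eqa ; kb = part L.eqb
              ; h = h ; ha = hl₁ ; hb = hl₂ }

      opaque
        ⟦⟧-square : ∀ {K C A B} {t : Y₀ K V.⇒ A} {k : K E.⇒ C} {f : A V.⇒ B} {p : Y₀ C V.⇒ B} →
          V.IsCoveringSquare t (Y₁ k) f p → IsCoveringSquare ⟦ t ⟧ (G.F₁ k) (H.F₁ f) ⟦ p ⟧
        ⟦⟧-square {K} {C} {A} {B} {t} {k} {f} {p} sq = mk-square
            (⟦⟧-post f ∙ ⟦⟧-resp (proj₁ sq) ∙ sym (⟦⟧-pre k)) (⟦⟧-cover (proj₁ (proj₂ sq))) lifts
          where
            lifts : Lifts ⟦ t ⟧ (G.F₁ k) (H.F₁ f) ⟦ p ⟧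
            lifts c b r with lift (⟦q⟧-cover A) b
            ... | W , z , cz , u , qu with G-pair (c ∘ z) u
            ... | w , w₁ , w₂ with equalise (p V.∘ Y₁ E.π₁) ((f V.∘ P.q A) V.∘ Y₁ E.π₂) w
                    (⟦⟧-eval V.refl ∙ ⟦ p ⟧ ▷ w₁ ∙ pull r ∙ assoc ∙ H.F₁ f ▷ sym qu ∙ pull (⟦⟧-post f) ∙
                     ⟦ f V.∘ P.q A ⟧ ▷ sym w₂ ∙ sym (⟦⟧-eval V.refl))
            -- The lifting problem is solved in Ē for the generic pair over the object of E returned
            -- by `equalise`, and the solution is evaluated at the given element of F.
            ... | E₁ with V.square-lifts sq (Y₁ E.π₁ V.∘ Y₁ (Equaliser.n E₁))
                            (P.q A V.∘ Y₁ E.π₂ V.∘ Y₁ (Equaliser.n E₁))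
                            (V.sym V.assoc V.∙ Equaliser.agree E₁ V.∙ V.assoc V.∙ V.assoc)
            ... | T , s , cs , κ , kκ , tκ with V.probe s | V.probe κ
            ... | s₀ , s≈ | κ₀ , κ≈
              with lift (G.pres-cover (V.y-cover-reflect (V.cover-resp (V.sym s≈) (V.cover-∘ cs (P.q-cover T)))))
                        (Equaliser.w E₁)
            ... | W' , z' , cz' , v , sv = W' , (z ∘ E₁.z) ∘ z' , cover-∘ (cover-∘ cz E₁.z-cover) cz' , G.F₁ κ₀ ∘ v ,
                  (G-tri {f = κ₀} {k} {(E.π₁ E.∘ E₁.n) E.∘ s₀} (V.y-square⁻¹ (Y₁ k V.▷ κ≈ V.∙ V.ext kκ V.∙
                     V.sym y-∘ V.◁ (s V.∘ P.q T) V.∙ Y₁ (E.π₁ E.∘ E₁.n) V.▷ V.sym s≈)) ∙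
                   sym (G-tri E.refl) ∙ G.F₁ (E.π₁ E.∘ E₁.n) ▷ sv ∙ sym (G-tri E.refl) ∙
                   G.F₁ E.π₁ ▷ pull E₁.nw ∙ G.F₁ E.π₁ ▷ assoc ∙ pull w₁ ∙ assoc ∙ c ▷ sym assoc) ,
                  (sym (⟦⟧-eval {b = ((P.q A V.∘ Y₁ E.π₂) V.∘ Y₁ E₁.n) V.∘ Y₁ s₀} (t V.▷ κ≈ V.∙ V.ext tκ V.∙
                     V.sym V.assoc V.◁ (s V.∘ P.q T) V.∙ _ V.▷ V.sym s≈)) ∙
                   ⟦⟧-eval V.refl ∙ _ ▷ sv ∙ ⟦⟧-eval V.refl ∙ _ ▷ pull E₁.nw ∙ ⟦⟧-eval V.refl ∙
                   ⟦ P.q A ⟧ ▷ (G.F₁ E.π₂ ▷ assoc ∙ pull w₂) ∙ pull qu ∙ assoc ∙ b ▷ sym assoc)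
              where
                module E₁ = Equaliser E₁

      opaque
        pres-small : ∀ {A B} {f : A V.⇒ B} → V.S̄ f → S (H.F₁ f)
        pres-small (_ , _ , f' , sf' , t , p , sq) = covered-small (⟦⟧-square sq) (G.pres-small sf')

      opaque
        ⟦⟧-pullback : ∀ {M₀ M A T} {k : Y₀ M₀ V.⇒ M} {m₀ : M₀ E.⇒ T} {m : M V.⇒ A} {t : Y₀ T V.⇒ A} →
          V.IsPullback k (Y₁ m₀) m t → IsPullback ⟦ k ⟧ (G.F₁ m₀) (H.F₁ m) ⟦ t ⟧
        ⟦⟧-pullback {M₀} {T = T} {k} {m₀} {m} {t} pb = mk-pullback
            (⟦⟧-post m ∙ ⟦⟧-resp (V.pb-comm pb) ∙ sym (⟦⟧-pre m₀))
            (λ {_} {x} {y} r r' → iso-mono (θ-iso M₀) x y (pb-jm (pres-pullback pb)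
              (sym assoc ∙ r ∙ assoc) (sym (ext (θ-natural m₀)) ∙ θ T ▷ r' ∙ ext (θ-natural m₀))))
            sur
          where
            sur : ∀ {Z} (a : Z ⇒ _) (b : Z ⇒ G.F₀ T) → H.F₁ m ∘ a ≈ ⟦ t ⟧ ∘ b → Σ Obj λ W → Σ (W ⇒ Z) λ z → Cover z ×
                  Σ (W ⇒ G.F₀ M₀) λ w → (⟦ k ⟧ ∘ w ≈ a ∘ z) × (G.F₁ m₀ ∘ w ≈ b ∘ z)
            sur a b r with pb-pair (pres-pullback pb) a (θ T ∘ b) (r ∙ assoc) | θ-iso M₀
            ... | u , ku , mu | θ' , _ , θθ' = _ , id , iso-cover id-iso , θ' ∘ u ,
              (assoc ∙ H.F₁ k ▷ cancel θθ' ∙ ku ∙ sym identityʳ) ,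
              (iso-mono (θ-iso T) _ _ (ext (θ-natural m₀) ∙ H.F₁ (Y₁ m₀) ▷ cancel θθ' ∙ mu) ∙ sym identityʳ)

      opaque
        -- Beck-Chevalley in Ē moves the quantifier to E, where `G` preserves it; descent in F along
        -- the image of the same covering square moves it back.
        pres-forall : ∀ {A B M D} {f : A V.⇒ B} {m : M V.⇒ A} {a : D V.⇒ B} →
          V.Mono m → V.IsForall f m a → IsForall (H.F₁ f) (H.F₁ m) (H.F₁ a)
        pres-forall {B = B} {f = f} {m} {a} mm fa with V.cover-by-Y f
        ... | K , k , t , sq with V.pullback m t | V.pullback a (P.q B)
        ... | _ , _ , _ , pbm | _ , _ , _ , pba with V.sub-pullback mm t pbm | V.sub-pullback (proj₁ fa) (P.q B) pba
        ... | M₀ , m₀ , mm₀ , _ , pbm₀ | A₀ , a₀ , ma₀ , c₀ , pba₀ =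
          forall-descent (⟦⟧-square sq) (pres-mono mm) (⟦⟧-pullback pbm₀) (pres-mono (proj₁ fa)) ⟦ c₀ ⟧
            (⟦⟧-cover (V.cover-stable (V.pb-swap pba₀) (P.q-cover B)))
            (pb-comm (⟦⟧-pullback pba₀))
            (G.pres-forall mm₀ (V.y-forall-reflect mm₀ (V.forall-BC sq mm pbm₀ pba₀ fa)))

      extension : Morphism V.Ē F
      extension = record
        { functor = H ; pres-terminal = pres-terminal ; pres-pullback = pres-pullback ; pres-cover = pres-cover
        ; pres-initial = pres-initial ; pres-coproduct = pres-coproduct
        ; pres-least = Preservation.pres-least V.positiveHeyting heyting H pres-pullback pres-initial
        ; pres-union = Preservation.pres-union V.positiveHeyting heyting H pres-pullback pres-initial
                         pres-cover pres-coproduct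
        ; pres-forall = pres-forall ; pres-small = pres-small }

    -- The extension of G sends A, presented by a relation R on X, to the quotient of G X by G R.
    module _ (F-exact : IsExact F) where

      opaque
        G-iso⊗ : ∀ {A B} → IsIso ⟨ G.F₁ (E.π₁ {A} {B}) , G.F₁ E.π₂ ⟩
        G-iso⊗ {A} {B} with pb-pair (G.pres-pullback (E.⊗-pullback {A} {B})) π₁ π₂
            (proj₂ (G.pres-terminal E.⊤-terminal _) _ ∙ sym (proj₂ (G.pres-terminal E.⊤-terminal _) _))
        ... | w , p , q = w ,
          G-⊗-unique (pull p ∙ π₁-β ∙ sym identityʳ) (pull q ∙ π₂-β ∙ sym identityʳ) ,
          ⊗-unique (pull π₁-β ∙ p ∙ sym identityʳ) (pull π₂-β ∙ q ∙ sym identityʳ)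

      opaque
        G-equivRel : ∀ {X} (ρ : E.EqRel X) → IsEquivRel (G.F₁ (E.EqRel.r₁ ρ)) (G.F₁ (E.EqRel.r₂ ρ))
        G-equivRel ρ = mk-equivRel jm
            (let (r , p , q) = proj₁ (proj₂ ρ.equivRel) in G.F₁ r , (G-tri₂ p ∙ G.identity) , (G-tri₂ q ∙ G.identity))
            (let (σ , p , q) = proj₁ (proj₂ (proj₂ ρ.equivRel)) in G.F₁ σ , G-tri₂ p , G-tri₂ q)
            trans
          where
            module ρ = E.EqRel ρ
            jm : JointlyMonic (G.F₁ ρ.r₁) (G.F₁ ρ.r₂)
            jm g h p q = G-mono ρ.⟨r⟩-mono g h (G-⊗-unique (G-tri E.π₁-β ∙ p ∙ sym (G-tri E.π₁-β))
                                                           (G-tri E.π₂-β ∙ q ∙ sym (G-tri E.π₂-β)))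
            trans : ∀ {T} (k l : T ⇒ G.F₀ ρ.R) → G.F₁ ρ.r₂ ∘ k ≈ G.F₁ ρ.r₁ ∘ l →
              Σ (T ⇒ G.F₀ ρ.R) λ τ → (G.F₁ ρ.r₁ ∘ τ ≈ G.F₁ ρ.r₁ ∘ k) × (G.F₁ ρ.r₂ ∘ τ ≈ G.F₁ ρ.r₂ ∘ l)
            trans k l r with E.pullback ρ.r₂ ρ.r₁
            ... | P , p₁ , p₂ , pb with proj₂ (proj₂ (proj₂ ρ.equivRel)) p₁ p₂ pb | pb-pair (G.pres-pullback pb) k l r
            ... | τ , u , v | w , p₁w , p₂w = G.F₁ τ ∘ w ,
              (G-tri u ∙ sym (G-tri E.refl) ∙ G.F₁ ρ.r₁ ▷ p₁w) , (G-tri v ∙ sym (G-tri E.refl) ∙ G.F₁ ρ.r₂ ▷ p₂w)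

      opaque
        G-bounded : ∀ {X} (ρ : E.EqRel X) → IsBoundedRel E (E.EqRel.r₁ ρ) (E.EqRel.r₂ ρ) →
                    IsBoundedRel F (G.F₁ (E.EqRel.r₁ ρ)) (G.F₁ (E.EqRel.r₂ ρ))
        G-bounded ρ bd = ⟨⟩-bounded (S-resp-≈
          (⊗-unique (pull π₁-β ∙ G-tri₂ E.π₁-β ∙ sym π₁-β) (pull π₂-β ∙ G-tri₂ E.π₂-β ∙ sym π₂-β))
          (A5 (G.pres-small (E.bounded-⟨⟩ bd)) (iso-small G-iso⊗)))

      opaque
        quot : ∀ A → Σ Obj λ Q → Σ (G.F₀ (P.X A) ⇒ Q) λ q → Cover q ×
               IsPullback (G.F₁ (E.EqRel.r₁ (P.rel A))) (G.F₁ (E.EqRel.r₂ (P.rel A))) q q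
        quot A with F-exact _ _ (G-equivRel (P.rel A)) (G-bounded (P.rel A) (P.bounded A))
        ... | Q , q , pb , coeq , _ = Q , q , coequalizer-cover coeq , pb

      H₀ : V.Obj → Obj
      H₀ A = proj₁ (quot A)

      ε : ∀ A → G.F₀ (P.X A) ⇒ H₀ A
      ε A = proj₁ (proj₂ (quot A))

      ε-cover : ∀ A → Cover (ε A)
      ε-cover A = proj₁ (proj₂ (proj₂ (quot A)))

      ε-kernel : ∀ A → IsPullback (G.F₁ (E.EqRel.r₁ (P.rel A))) (G.F₁ (E.EqRel.r₂ (P.rel A))) (ε A) (ε A)
      ε-kernel A = proj₂ (proj₂ (proj₂ (quot A)))

      -- c ↦[ h ] f : the morphism h takes the class of c to the class of f.
      _↦[_]_ : ∀ {T A B} → T E.⇒ P.X A → A V.⇒ B → T E.⇒ P.X B → Set e₁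
      _↦[_]_ {A = A} {B} c h f = P.q B V.∘ Y₁ f V.≈ h V.∘ P.q A V.∘ Y₁ c

      opaque
        ↦-∘ : ∀ {S T A B} {c : T E.⇒ P.X A} {h : A V.⇒ B} {f : T E.⇒ P.X B} (t : S E.⇒ T) →
              c ↦[ h ] f → (c E.∘ t) ↦[ h ] (f E.∘ t)
        ↦-∘ {A = A} {B} {c} {h} {f} t p = P.q B V.▷ y-∘ V.∙ V.sym V.assoc V.∙ p V.◁ Y₁ t V.∙ V.assoc V.∙
          h V.▷ (V.assoc V.∙ P.q A V.▷ V.sym y-∘)

      opaque
        ↦-∘ʰ : ∀ {T A B D} {c : T E.⇒ P.X A} {h : A V.⇒ B} {f : T E.⇒ P.X B} {g : B V.⇒ D} {d : T E.⇒ P.X D} →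
               c ↦[ h ] f → f ↦[ g ] d → c ↦[ g V.∘ h ] d
        ↦-∘ʰ {g = g} p r = r V.∙ g V.▷ p V.∙ V.sym V.assoc

      opaque
        -- The hypothesis is an element of `G` applied to the relation of `A`. `N` is the object of
        -- E of triples formed by an element of `T`, one of `T'` and a witness that their values
        -- under `c` and `c'` are related. Over `N` the values of `h` agree, so `f` and `f'` are
        -- related in E, and `G` transports this.
        functional : ∀ {T T' Z A B} {h : A V.⇒ B} {c : T E.⇒ P.X A} {f : T E.⇒ P.X B} {c' : T' E.⇒ P.X A}
          {f' : T' E.⇒ P.X B} → c ↦[ h ] f → c' ↦[ h ] f' → (u : Z ⇒ G.F₀ T) (v : Z ⇒ G.F₀ T') →
          ε A ∘ G.F₁ c ∘ u ≈ ε A ∘ G.F₁ c' ∘ v → ε B ∘ G.F₁ f ∘ u ≈ ε B ∘ G.F₁ f' ∘ v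
        functional {A = A} {B} {h} {c} {f} {c'} {f'} p p' u v r
          with pb-pair (ε-kernel A) (G.F₁ c ∘ u) (G.F₁ c' ∘ v) r
             | E.pullback c (E.EqRel.r₁ (P.rel A))
        ... | w , r₁w , r₂w | N₁ , n₁ , n₂ , pb₁ with E.pullback (E.EqRel.r₂ (P.rel A) E.∘ n₂) c'
        ... | N , m₁ , m₂ , pb₂ with pb-pair (G.pres-pullback pb₁) u w (sym r₁w)
        ... | z₁ , n₁z , n₂z with pb-pair (G.pres-pullback pb₂) z₁ v (G.homomorphism ◁ z₁ ∙ assoc ∙ G.F₁ _ ▷ n₂z ∙ r₂w)
        ... | z , m₁z , m₂z with V.≈⇒~ B {x = f E.∘ n₁ E.∘ m₁} {y = f' E.∘ m₂}
              (↦-∘ (n₁ E.∘ m₁) p V.∙ h V.▷ V.~⇒≈ A (n₂ E.∘ m₁ ,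
                (E.sym (E.ext (E.pb-comm pb₁))) , (E.sym E.assoc E.∙ E.pb-comm pb₂)) V.∙ V.sym (↦-∘ m₂ p'))
        ... | k , r₁k , r₂k = ε B ▷ (G.F₁ f ▷ (sym n₁z ∙ G.F₁ n₁ ▷ sym m₁z ∙ G-tri E.refl) ∙ G-tri E.refl ∙ sym (G-tri r₁k)) ∙
            ext (pb-comm (ε-kernel B)) ∙ ε B ▷ (G-tri r₂k ∙ sym (G-tri E.refl) ∙ G.F₁ f' ▷ m₂z)

      opaque
        on-generic : ∀ {A B} (h : A V.⇒ B) → Σ E.Obj λ T → Σ (T E.⇒ P.X A) λ t → E.Cover t ×
                     Σ (T E.⇒ P.X B) λ x → t ↦[ h ] x
        on-generic {A} h with V.locally-X (h V.∘ P.q A)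
        ... | T , t , ct , x , p = T , t , ct , x , (p V.∙ V.assoc)

      opaque
        ε-G-cover : ∀ {T} A {t : T E.⇒ P.X A} → E.Cover t → Cover (ε A ∘ G.F₁ t)
        ε-G-cover A ct = cover-∘ (ε-cover A) (G.pres-cover ct)

      opaque
        -- `h` has representatives only on a cover `t` of the presenting object, so the map descends
        -- along `ε A ∘ G.F₁ t`. The value at arbitrary representatives is part of the claim in
        -- order that the result not be tied to this cover.
        H₁-exists : ∀ {A B} (h : A V.⇒ B) → Σ (H₀ A ⇒ H₀ B) λ k →
          ∀ {T} {c : T E.⇒ P.X A} {f : T E.⇒ P.X B} → c ↦[ h ] f → k ∘ ε A ∘ G.F₁ c ≈ ε B ∘ G.F₁ f
        H₁-exists {A} {B} h with on-generic h
        ... | T , t , ct , x , tx with descend (ε B ∘ G.F₁ x) (ε-G-cover A ct)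
                  (λ u v r → assoc ∙ functional tx tx u v (sym assoc ∙ r ∙ assoc) ∙ sym assoc)
        ... | k , kt = k , value
          where
            value : ∀ {T'} {c : T' E.⇒ P.X A} {f : T' E.⇒ P.X B} → c ↦[ h ] f → k ∘ ε A ∘ G.F₁ c ≈ ε B ∘ G.F₁ f
            value {c = c} {f} p with lift (ε-G-cover A ct) (ε A ∘ G.F₁ c)
            ... | Z , z , cz , y , r = cover-epi cz (assoc ∙ k ▷ sym r ∙ pull kt ∙ assoc ∙
                  functional tx p y z (sym assoc ∙ r ∙ assoc) ∙ sym assoc)

      H₁ : ∀ {A B} → A V.⇒ B → H₀ A ⇒ H₀ B
      H₁ h = proj₁ (H₁-exists h)

      opaque
        H₁-value : ∀ {A B} (h : A V.⇒ B) {T} {c : T E.⇒ P.X A} {f : T E.⇒ P.X B} → c ↦[ h ] f →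
                   H₁ h ∘ ε A ∘ G.F₁ c ≈ ε B ∘ G.F₁ f
        H₁-value h = proj₂ (H₁-exists h)

      opaque
        H-identity : ∀ {A} → H₁ (V.id {A}) ≈ id
        H-identity {A} = cover-epi (ε-G-cover A (E.iso-cover E.id-iso)) (H₁-value V.id (V.sym V.identityˡ) ∙ sym identityˡ)

      opaque
        H-homomorphism : ∀ {A B D} {f : A V.⇒ B} {g : B V.⇒ D} → H₁ (g V.∘ f) ≈ H₁ g ∘ H₁ f
        H-homomorphism {A} {B} {f = f} {g} with on-generic f
        ... | T , t , ct , x , p with V.locally-X (g V.∘ P.q B V.∘ Y₁ x)
        ... | T' , t' , ct' , y , p' = cover-epi (ε-G-cover A (E.cover-∘ ct ct'))
              (H₁-value (g V.∘ f) (↦-∘ʰ {g = g} (↦-∘ t' p) q) ∙ sym (H₁-value g q) ∙ H₁ g ▷ sym (H₁-value f (↦-∘ t' p)) ∙ sym assoc)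
          where
            q : (x E.∘ t') ↦[ g ] y
            q = p' V.∙ V.assoc V.∙ g V.▷ (V.assoc V.∙ P.q B V.▷ V.sym y-∘)

      opaque
        H-resp-≈ : ∀ {A B} {f g : A V.⇒ B} → f V.≈ g → H₁ f ≈ H₁ g
        H-resp-≈ {A} {f = f} {g} r with on-generic f
        ... | T , t , ct , x , p = cover-epi (ε-G-cover A ct) (H₁-value f p ∙ sym (H₁-value g (p V.∙ r V.◁ _)))

      H : Functor V.C̄ cat
      H = record { F₀ = H₀ ; F₁ = H₁ ; identity = H-identity ; homomorphism = H-homomorphism ; F-resp-≈ = H-resp-≈ }

      -- yX has its own presentation q = y(b), and b : X' → X is a cover with kernel pair the relation of yX.
      opaque
        base : ∀ X → Σ (P.X (Y₀ X) E.⇒ X) λ b → Y₁ b V.≈ P.q (Y₀ X)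
        base X = V.y-full (P.q (Y₀ X))

      b : ∀ X → P.X (Y₀ X) E.⇒ X
      b X = proj₁ (base X)

      opaque
        b-cover : ∀ X → Cover (G.F₁ (b X))
        b-cover X = G.pres-cover (V.y-cover-reflect (V.cover-resp (V.sym (proj₂ (base X))) (P.q-cover (Y₀ X))))

      opaque
        b-kernel : ∀ X → E.IsPullback (E.EqRel.r₁ (P.rel (Y₀ X))) (E.EqRel.r₂ (P.rel (Y₀ X))) (b X) (b X)
        b-kernel X = E.mk-pullback
            (V.y-square⁻¹ (proj₂ (base X) V.◁ _ V.∙ V.pb-comm (P.q-kernel (Y₀ X)) V.∙ V.sym (proj₂ (base X)) V.◁ _))
            (λ {_} {x} {y} → proj₁ (E.EqRel.equivRel (P.rel (Y₀ X))) x y)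
            (λ x y r → let (k , p , q) = V.≈⇒~ (Y₀ X) (V.sym (proj₂ (base X)) V.◁ _ V.∙ V.y-square r V.∙ proj₂ (base X) V.◁ _)
                       in _ , E.id , E.iso-cover E.id-iso , k , (p E.∙ E.sym E.identityʳ) , (q E.∙ E.sym E.identityʳ))

      opaque
        α-exists : ∀ X → Σ (H₀ (Y₀ X) ⇒ G.F₀ X) λ k → k ∘ ε (Y₀ X) ≈ G.F₁ (b X)
        α-exists X = descend (G.F₁ (b X)) (ε-cover (Y₀ X)) λ u v r →
          let (w , p , q) = pb-pair (ε-kernel (Y₀ X)) u v r
          in G.F₁ (b X) ▷ sym p ∙ ext (pb-comm (G.pres-pullback (b-kernel X))) ∙ G.F₁ (b X) ▷ q

      α : ∀ X → H₀ (Y₀ X) ⇒ G.F₀ X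
      α X = proj₁ (α-exists X)

      opaque
        α-ε : ∀ X → α X ∘ ε (Y₀ X) ≈ G.F₁ (b X)
        α-ε X = proj₂ (α-exists X)

      opaque
        -- `ε (Y₀ X)` and `G.F₁ (b X)` are covers with the same kernel pair.
        α-iso : ∀ X → IsIso (α X)
        α-iso X = cover-mono-iso (cover-cancel (cover-resp (sym (α-ε X)) (b-cover X))) inj
          where
            inj : Mono (α X)
            inj x y r with lift₂ (ε-cover (Y₀ X)) (ε-cover (Y₀ X)) x y
            ... | Z , z , cz , u , v , εu , εv with pb-pair (G.pres-pullback (b-kernel X)) u v
                    (push (α-ε X) ∙ α X ▷ εu ∙ pull r ∙ assoc ∙ α X ▷ sym εv ∙ pull (α-ε X))
            ... | w , p , q = cover-epi cz (sym εu ∙ ε _ ▷ sym p ∙ ext (pb-comm (ε-kernel (Y₀ X))) ∙ ε _ ▷ q ∙ εv)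

      opaque
        α-natural : ∀ {X Z} (f : X E.⇒ Z) → α Z ∘ H₁ (Y₁ f) ≈ G.F₁ f ∘ α X
        α-natural {X} {Z} f with on-generic (Y₁ f)
        ... | T , t , ct , x , p = cover-epi (ε-G-cover (Y₀ X) ct)
            (assoc ∙ α Z ▷ H₁-value (Y₁ f) p ∙ pull (α-ε Z) ∙ G-tri₂ bx ∙ sym (G-tri₂ E.refl) ∙
             G.F₁ f ▷ (sym (G-tri₂ E.refl) ∙ sym (α-ε X) ◁ G.F₁ t ∙ assoc) ∙ sym assoc)
          where
            bx : b Z E.∘ x E.≈ f E.∘ b X E.∘ t
            bx = V.y-faithful (y-∘ V.∙ proj₂ (base Z) V.◁ Y₁ x V.∙ p V.∙ Y₁ f V.▷ (V.sym (proj₂ (base X)) V.◁ Y₁ t V.∙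
                   V.sym y-∘) V.∙ V.sym y-∘)

      θ : ∀ X → G.F₀ X ⇒ H₀ (Y₀ X)
      θ X = proj₁ (α-iso X)

      opaque
        θ-natural : ∀ {S T} (f : S E.⇒ T) → θ T ∘ G.F₁ f ≈ H₁ (Y₁ f) ∘ θ S
        θ-natural {S} {T} f with α-iso S | α-iso T
        ... | θS , _ , αθ | θT , θα , _ = sym (θT ▷ (pull (α-natural f) ∙ assoc ∙ G.F₁ f ▷ αθ ∙ identityʳ)) ∙ cancel θα

      opaque
        ⟦q⟧≈ε : ∀ A → H₁ (P.q A) ∘ θ (P.X A) ≈ ε A
        ⟦q⟧≈ε A with α-iso (P.X A)
        ... | θA , θα , _ = cover-epi (b-cover (P.X A))
            (assoc ∙ H₁ (P.q A) ▷ (θA ▷ sym (α-ε (P.X A)) ∙ cancel θα ∙ sym identityʳ ∙ ε _ ▷ sym G.identity) ∙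
             H₁-value (P.q A) (P.q A V.▷ (proj₂ (base (P.X A)) V.∙ V.sym V.identityʳ V.∙ _ V.▷ V.sym V.y-id)))

      opaque
        ⟦q⟧-cover : ∀ A → Cover (H₁ (P.q A) ∘ θ (P.X A))
        ⟦q⟧-cover A = cover-resp (sym (⟦q⟧≈ε A)) (ε-cover A)

      opaque
        ⟦q⟧-kernel : ∀ A → IsPullback (G.F₁ (E.EqRel.r₁ (P.rel A))) (G.F₁ (E.EqRel.r₂ (P.rel A)))
                           (H₁ (P.q A) ∘ θ (P.X A)) (H₁ (P.q A) ∘ θ (P.X A))
        ⟦q⟧-kernel A = (⟦q⟧≈ε A ◁ _ ∙ pb-comm (ε-kernel A) ∙ sym (⟦q⟧≈ε A) ◁ _) ,
          λ x y r → proj₂ (ε-kernel A) x y (sym (⟦q⟧≈ε A) ◁ x ∙ r ∙ ⟦q⟧≈ε A ◁ y)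

      H-morphism : Morphism V.Ē F
      H-morphism = ExtensionAlong.extension H θ (λ X → iso-inv (α-iso X)) θ-natural ⟦q⟧-cover ⟦q⟧-kernel

  -- Natural transformations between morphisms out of the completion

  module _ (H H' : Morphism V.Ē F) where
    private
      module H = Morphism H
      module H' = Morphism H'
      Hy H'y : Functor E.cat cat
      Hy = Morphism.functor H ∘F Morphism.functor V.yMorphism
      H'y = Morphism.functor H' ∘F Morphism.functor V.yMorphism

    opaque
      H'-square : ∀ {A B B' D Z} {f : A V.⇒ B} {g : B V.⇒ D} {f' : A V.⇒ B'} {g' : B' V.⇒ D} {x : Z ⇒ H'.F₀ A} →
                  g V.∘ f V.≈ g' V.∘ f' → H'.F₁ g ∘ H'.F₁ f ∘ x ≈ H'.F₁ g' ∘ H'.F₁ f' ∘ x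
      H'-square p = ext (sym H'.homomorphism ∙ H'.F-resp-≈ p ∙ H'.homomorphism)

    opaque
      H-square : ∀ {A B B' D} {f : A V.⇒ B} {g : B V.⇒ D} {f' : A V.⇒ B'} {g' : B' V.⇒ D} →
                 g V.∘ f V.≈ g' V.∘ f' → H.F₁ g ∘ H.F₁ f ≈ H.F₁ g' ∘ H.F₁ f'
      H-square p = sym H.homomorphism ∙ H.F-resp-≈ p ∙ H.homomorphism

    opaque
      faithful : (β β' : NatTrans H.functor H'.functor) →
        (∀ X → NatTrans.η β (Y₀ X) ≈ NatTrans.η β' (Y₀ X)) → ∀ A → NatTrans.η β A ≈ NatTrans.η β' A
      faithful β β' p A = cover-epi (H.pres-cover (P.q-cover A))
        (NatTrans.commute β (P.q A) ∙ H'.F₁ (P.q A) ▷ p (P.X A) ∙ sym (NatTrans.commute β' (P.q A)))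

    module _ (α : NatTrans Hy H'y) where
      private
        module α = NatTrans α

      opaque
        -- `H` sends the presentation of `A` to a cover with kernel pair the image of the presenting
        -- relation, and naturality of `α` at the two legs of that relation is what descent
        -- requires.
        component : ∀ A → Σ (H.F₀ A ⇒ H'.F₀ A) λ β → β ∘ H.F₁ (P.q A) ≈ H'.F₁ (P.q A) ∘ α.η (P.X A)
        component A = descend (H'.F₁ (P.q A) ∘ α.η (P.X A)) (H.pres-cover (P.q-cover A)) ker
          where
            ker : ∀ {T} (u v : T ⇒ H.F₀ (Y₀ (P.X A))) → H.F₁ (P.q A) ∘ u ≈ H.F₁ (P.q A) ∘ v →
                  (H'.F₁ (P.q A) ∘ α.η (P.X A)) ∘ u ≈ (H'.F₁ (P.q A) ∘ α.η (P.X A)) ∘ v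
            ker u v r with pb-pair (H.pres-pullback (P.q-kernel A)) u v r
            ... | w , p , q = assoc ∙ H'.F₁ _ ▷ (α.η _ ▷ sym p ∙ ext (α.commute _)) ∙
              H'-square (V.pb-comm (P.q-kernel A)) ∙ sym (H'.F₁ _ ▷ (α.η _ ▷ sym q ∙ ext (α.commute _))) ∙ sym assoc

      opaque
        component-natural : ∀ {A B} (f : A V.⇒ B) →
          proj₁ (component B) ∘ H.F₁ f ≈ H'.F₁ f ∘ proj₁ (component A)
        component-natural {A} {B} f with V.locally-X (f V.∘ P.q A)
        ... | T , t , ct , x , p with component A | component B
        ... | βA , eA | βB , eB = cover-epi (cover-∘ (H.pres-cover (P.q-cover A)) (H.pres-cover (V.y-cover ct)))
          (assoc ∙ βB ▷ (sym assoc ∙ sym H.homomorphism ◁ _ ∙ H-square (V.sym p)) ∙ pull eB ∙ assoc ∙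
           H'.F₁ (P.q B) ▷ α.commute x ∙ H'-square p ∙ (H'.homomorphism ◁ _ ∙ assoc) ∙
           H'.F₁ f ▷ (H'.F₁ (P.q A) ▷ sym (α.commute t) ∙ pull (sym eA) ∙ assoc) ∙ sym assoc)

      opaque
        component-y : ∀ X → proj₁ (component (Y₀ X)) ≈ α.η X
        component-y X with component (Y₀ X) | V.y-full (P.q (Y₀ X))
        ... | β , eq | b , b≈ = cover-epi (H.pres-cover (P.q-cover (Y₀ X)))
          (eq ∙ H'.F-resp-≈ (V.sym b≈) ◁ _ ∙ sym (α.commute b) ∙ α.η X ▷ H.F-resp-≈ b≈)

      full : Σ (NatTrans H.functor H'.functor) λ β → ∀ X → NatTrans.η β (Y₀ X) ≈ α.η X
      full = record { η = λ A → proj₁ (component A) ; commute = component-natural } , component-y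

  precompEquivalence : IsExact F → PrecompEquivalence V.yMorphism F
  precompEquivalence exact = record
    { ess-surj = λ G → Extend.H-morphism G exact ,
        record { η = Extend.α G exact ; commute = Extend.α-natural G exact } , Extend.α-iso G exact
    ; full = full ; faithful = faithful }

-- The category of bounded equivalence relations

module Completion (K : SmallMapCategory) where
  open SmallMapCategory K renaming (structure to E)
  open SmallMaps E

  record Ob : Set (o ⊔ ℓ ⊔ e ⊔ s) where
    field
      {X} : Obj
      rel : EqRel X
      bounded : IsBoundedRel E (EqRel.r₁ rel) (EqRel.r₂ rel)
    open EqRel rel public

  infix 4 Related
  Related : ∀ (A : Ob) {T} → T ⇒ Ob.X A → T ⇒ Ob.X A → Set (ℓ ⊔ e)
  Related A x y = Ob._~_ A x y

  syntax Related A x y = x ~[ A ] y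

  -- A morphism (X , R) → (Y , S) is a map f out of a cover c of X, compatible with R and S.
  record Hom (A B : Ob) : Set (o ⊔ ℓ ⊔ e) where
    no-eta-equality
    field
      {U} : Obj
      c : U ⇒ Ob.X A
      c-cover : Cover c
      f : U ⇒ Ob.X B
      cong : ∀ {T} (u v : T ⇒ U) → c ∘ u ~[ A ] c ∘ v → f ∘ u ~[ B ] f ∘ v

  -- F sends the class of the generalised element x to that of y.
  infix 4 _⊢_↦_
  record _⊢_↦_ {A B : Ob} (F : Hom A B) {T : Obj} (x : T ⇒ Ob.X A) (y : T ⇒ Ob.X B) : Set (o ⊔ ℓ ⊔ e) where
    constructor maps
    open Hom F
    field
      at : ∀ {T'} (t : T' ⇒ T) (u : T' ⇒ U) → c ∘ u ~[ A ] x ∘ t → f ∘ u ~[ B ] y ∘ t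
  open _⊢_↦_ using (at)

  infix 4 _≈ₕ_
  -- A one-sided condition at the generic element of `F`; it is symmetric because morphisms are
  -- total and functional.
  record _≈ₕ_ {A B : Ob} (F G : Hom A B) : Set (o ⊔ ℓ ⊔ e) where
    constructor mk≈
    field
      generic : G ⊢ Hom.c F ↦ Hom.f F
  open _≈ₕ_ using (generic)

  module _ {A B : Ob} (F : Hom A B) where
    private
      module A = Ob A
      module B = Ob B
    open Hom F

    opaque
      ↦-generic : F ⊢ c ↦ f
      ↦-generic = maps λ t u r → cong u t r

    opaque
      ↦-∘ : ∀ {T T'} {x : T ⇒ A.X} {y : T ⇒ B.X} (t : T' ⇒ T) → F ⊢ x ↦ y → F ⊢ x ∘ t ↦ y ∘ t
      ↦-∘ t p = maps λ s u r → B.~-resp refl (sym assoc) (at p (t ∘ s) u (A.~-resp refl assoc r))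

    opaque
      ↦-resp : ∀ {T} {x x' : T ⇒ A.X} {y y' : T ⇒ B.X} → x A.~ x' → y B.~ y' → F ⊢ x ↦ y → F ⊢ x' ↦ y'
      ↦-resp p q r = maps λ t u z → B.~-trans (at r t u (A.~-trans z (A.~-∘ t (A.~-sym p)))) (B.~-∘ t q)

    opaque
      functional : ∀ {T} {x x' : T ⇒ A.X} {y y' : T ⇒ B.X} → F ⊢ x ↦ y → F ⊢ x' ↦ y' → x A.~ x' → y B.~ y'
      functional {x = x} p p' r with lift c-cover x
      ... | T' , t , ct , u , cu = B.~-local ct (B.~-trans (B.~-sym (at p t u (A.~-refl cu)))
        (at p' t u (A.~-resp (sym cu) refl (A.~-∘ t r))))

    opaque
      total : ∀ {T} (x : T ⇒ A.X) → Σ Obj λ T' → Σ (T' ⇒ T) λ t → Cover t × Σ (T' ⇒ B.X) λ y → F ⊢ x ∘ t ↦ y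
      total x with lift c-cover x
      ... | T' , t , ct , u , cu = T' , t , ct , f ∘ u , ↦-resp (A.~-refl cu) (B.~-refl refl) (↦-∘ u ↦-generic)

    opaque
      total-id : Σ Obj λ T → Σ (T ⇒ A.X) λ t → Cover t × Σ (T ⇒ B.X) λ y → F ⊢ t ↦ y
      total-id = U , c , c-cover , f , ↦-generic

    opaque
      ↦-local : ∀ {T T'} {x : T ⇒ A.X} {y : T ⇒ B.X} {t : T' ⇒ T} → Cover t → F ⊢ x ∘ t ↦ y ∘ t → F ⊢ x ↦ y
      ↦-local {x = x} {y} {t} ct p = maps go
        where
          go : ∀ {S} (z : S ⇒ _) (u : S ⇒ U) → c ∘ u A.~ x ∘ z → f ∘ u B.~ y ∘ z
          go z u r with lift ct z
          ... | W , w , cw , v , tv = B.~-local cw (B.~-resp (sym assoc) (assoc ∙ y ▷ tv ∙ sym assoc)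
            (at p v (u ∘ w) (A.~-resp assoc (assoc ∙ x ▷ sym tv ∙ sym assoc) (A.~-∘ w r))))

  opaque
    -- The standard way to prove equations in Ē: one cover with a common value determines both
    -- morphisms, by functionality and locality.
    ≈-intro : ∀ {A B} {F G : Hom A B} {T} {t : T ⇒ Ob.X A} {y : T ⇒ Ob.X B} → Cover t →
              F ⊢ t ↦ y → G ⊢ t ↦ y → F ≈ₕ G
    ≈-intro {A} {B} {F} {G} ct p q with lift ct (Hom.c F)
    ... | S , z , cz , w , tw = mk≈ (↦-local G cz (↦-resp G (Ob.~-refl A tw)
      (functional F (↦-∘ F w p) (↦-∘ F z (↦-generic F)) (Ob.~-refl A tw)) (↦-∘ G w q)))

  opaque
    ≈-apply : ∀ {A B} {F G : Hom A B} {T} {x : T ⇒ Ob.X A} {y : T ⇒ Ob.X B} → F ≈ₕ G → F ⊢ x ↦ y → G ⊢ x ↦ y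
    ≈-apply {A} {B} {F} {G} {x = x} r p with lift (Hom.c-cover F) x
    ... | S , z , cz , u , cu = ↦-local G cz (↦-resp G (Ob.~-refl A cu)
      (functional F (↦-∘ F u (↦-generic F)) (↦-∘ F z p) (Ob.~-refl A cu)) (↦-∘ G u (generic r)))

  opaque
    ≈ₕ-refl : ∀ {A B} {F : Hom A B} → F ≈ₕ F
    ≈ₕ-refl {F = F} = mk≈ (↦-generic F)

  opaque
    ≈ₕ-sym : ∀ {A B} {F G : Hom A B} → F ≈ₕ G → G ≈ₕ F
    ≈ₕ-sym {F = F} r = ≈-intro (Hom.c-cover F) (generic r) (↦-generic F)

  opaque
    ≈ₕ-trans : ∀ {A B} {F G K : Hom A B} → F ≈ₕ G → G ≈ₕ K → F ≈ₕ K
    ≈ₕ-trans r r' = mk≈ (≈-apply r' (generic r))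

  opaque
    idₕ : ∀ {A} → Hom A A
    idₕ {A} = record { c = id ; c-cover = iso-cover id-iso ; f = id ; cong = λ u v r → r }

    idₕ-↦ : ∀ {A T} {x y : T ⇒ Ob.X A} → x ~[ A ] y → idₕ {A} ⊢ x ↦ y
    idₕ-↦ {A} r = maps λ t u p → Ob.~-trans A p (Ob.~-∘ A t r)

    infixr 9 _∘ₕ_
    -- The strict pullback serves as domain although values in `B` count only up to its relation:
    -- being a pullback of the cover `G.c`, it covers the domain of `F`.
    _∘ₕ_ : ∀ {A B D} → Hom B D → Hom A B → Hom A D
    _∘ₕ_ {A} {B} {D} G F with pullback (Hom.f F) (Hom.c G)
    ... | W , w₁ , w₂ , pb = record
      { c = F.c ∘ w₁ ; c-cover = cover-∘ F.c-cover (cover-stable (pb-swap pb) G.c-cover) ; f = G.f ∘ w₂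
      ; cong = λ u v r → Ob.~-resp D (sym assoc) (sym assoc) (G.cong (w₂ ∘ u) (w₂ ∘ v)
          (Ob.~-resp B (ext (pb-comm pb)) (ext (pb-comm pb))
            (F.cong (w₁ ∘ u) (w₁ ∘ v) (Ob.~-resp A assoc assoc r)))) }
      where
        module F = Hom F
        module G = Hom G

    ∘-↦ : ∀ {A B D} (G : Hom B D) (F : Hom A B) {T} {x : T ⇒ Ob.X A} {y : T ⇒ Ob.X B} {z : T ⇒ Ob.X D} →
          F ⊢ x ↦ y → G ⊢ y ↦ z → (G ∘ₕ F) ⊢ x ↦ z
    ∘-↦ {A} {B} {D} G F p q with pullback (Hom.f F) (Hom.c G)
    ... | W , w₁ , w₂ , pb = maps λ t u r → Ob.~-resp D (sym assoc) refl
      (at q t (w₂ ∘ u) (Ob.~-resp B (ext (pb-comm pb)) refl (at p t (w₁ ∘ u) (Ob.~-resp A assoc refl r))))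

  opaque
    ∘ₕ-resp : ∀ {A B D} {F F' : Hom B D} {G G' : Hom A B} → F ≈ₕ F' → G ≈ₕ G' → F ∘ₕ G ≈ₕ F' ∘ₕ G'
    ∘ₕ-resp {F = F} {F'} {G} {G'} r r' with total-id G
    ... | T , t , ct , y , p with total F y
    ... | T' , t' , ct' , z , q = ≈-intro (cover-∘ ct ct') (∘-↦ F G (↦-∘ G t' p) q)
          (∘-↦ F' G' (≈-apply r' (↦-∘ G t' p)) (≈-apply r q))

  opaque
    ∘ₕ-assoc : ∀ {A B D K} {F : Hom A B} {G : Hom B D} {H : Hom D K} → (H ∘ₕ G) ∘ₕ F ≈ₕ H ∘ₕ (G ∘ₕ F)
    ∘ₕ-assoc {F = F} {G} {H} with total-id F
    ... | T , t , ct , y , p with total G y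
    ... | T' , t' , ct' , z , q with total H z
    ... | T'' , t'' , ct'' , w , r = ≈-intro (cover-∘ (cover-∘ ct ct') ct'')
          (∘-↦ (H ∘ₕ G) F (↦-∘ F t'' (↦-∘ F t' p)) (∘-↦ H G (↦-∘ G t'' q) r))
          (∘-↦ H (G ∘ₕ F) (∘-↦ G F (↦-∘ F t'' (↦-∘ F t' p)) (↦-∘ G t'' q)) r)

  opaque
    ∘ₕ-identityˡ : ∀ {A B} {F : Hom A B} → idₕ ∘ₕ F ≈ₕ F
    ∘ₕ-identityˡ {B = B} {F} with total-id F
    ... | T , t , ct , y , p = ≈-intro ct (∘-↦ idₕ F p (idₕ-↦ (Ob.~-refl B refl))) p

  opaque
    ∘ₕ-identityʳ : ∀ {A B} {F : Hom A B} → F ∘ₕ idₕ ≈ₕ F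
    ∘ₕ-identityʳ {A} {F = F} with total-id F
    ... | T , t , ct , y , p = ≈-intro ct (∘-↦ F idₕ (idₕ-↦ (Ob.~-refl A refl)) p) p

  C̄ : Category (o ⊔ ℓ ⊔ e ⊔ s) (o ⊔ ℓ ⊔ e) (o ⊔ ℓ ⊔ e)
  C̄ = record
    { Obj = Ob ; _⇒_ = Hom ; _≈_ = _≈ₕ_ ; id = idₕ ; _∘_ = _∘ₕ_
    ; equiv = record { refl = ≈ₕ-refl ; sym = ≈ₕ-sym ; trans = ≈ₕ-trans }
    ; ∘-resp-≈ = ∘ₕ-resp ; assoc = ∘ₕ-assoc ; identityˡ = ∘ₕ-identityˡ ; identityʳ = ∘ₕ-identityʳ }

  private
    module N = Notions C̄

  -- Intersections of pulled-back bounded relations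

  module _ (A B : Ob) {N : Obj} (a : N ⇒ Ob.X A) (b : N ⇒ Ob.X B) where
    private
      module A = Ob A
      module B = Ob B

    opaque
      -- Each relation is pulled back to a small mono, the second over the domain of the first;
      -- their composite is the intersection and is small by `A5`.
      meet-sub : Σ Obj λ M → Σ (M ⇒ N ⊗ N) λ m → Mono m × S m ×
        (∀ {T} {x y : T ⇒ N} → ⟨ x , y ⟩ ⊑ m → (a ∘ x A.~ a ∘ y) × (b ∘ x B.~ b ∘ y)) ×
        (∀ {T} {x y : T ⇒ N} → a ∘ x A.~ a ∘ y → b ∘ x B.~ b ∘ y → ⟨ x , y ⟩ ⊑ m)
      meet-sub with pullback ⟨ A.r₁ , A.r₂ ⟩ ⟨ a ∘ π₁ , a ∘ π₂ ⟩
      ... | E₁ , k₁ , e₁ , pb₁ with pullback ⟨ B.r₁ , B.r₂ ⟩ (⟨ b ∘ π₁ , b ∘ π₂ ⟩ ∘ e₁)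
      ... | E₂ , k₂ , e₂ , pb₂ = E₂ , e₁ ∘ e₂ , mono-∘ (pb-mono pb₁ A.⟨r⟩-mono) (pb-mono pb₂ B.⟨r⟩-mono) ,
          A5 (A1 pb₂ (bounded-⟨⟩ B.bounded)) (A1 pb₁ (bounded-⟨⟩ A.bounded)) , elim , intro
        where
          image : ∀ {X T} {d : N ⇒ X} {x y : T ⇒ N} → ⟨ d ∘ π₁ , d ∘ π₂ ⟩ ∘ ⟨ x , y ⟩ ≈ ⟨ d ∘ x , d ∘ y ⟩
          image {d = d} = ⊗-unique (pull π₁-β ∙ assoc ∙ d ▷ π₁-β ∙ sym π₁-β) (pull π₂-β ∙ assoc ∙ d ▷ π₂-β ∙ sym π₂-β)

          elim : ∀ {T} {x y : T ⇒ N} → ⟨ x , y ⟩ ⊑ e₁ ∘ e₂ → (a ∘ x A.~ a ∘ y) × (b ∘ x B.~ b ∘ y)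
          elim (j , p) =
            A.⊑⇒~ (k₁ ∘ e₂ ∘ j , (ext (pb-comm pb₁) ∙ _ ▷ (sym assoc ∙ p) ∙ image)) ,
            B.⊑⇒~ (k₂ ∘ j , (pull (pb-comm pb₂) ∙ assoc ◁ j ∙ assoc ∙ _ ▷ p ∙ image))

          intro : ∀ {T} {x y : T ⇒ N} → a ∘ x A.~ a ∘ y → b ∘ x B.~ b ∘ y → ⟨ x , y ⟩ ⊑ e₁ ∘ e₂
          intro {x = x} {y} r r' with A.~⇒⊑ r | B.~⇒⊑ r'
          ... | j , p | j' , p' with pb-pair pb₁ j ⟨ x , y ⟩ (p ∙ sym image)
          ... | u , _ , e₁u with pb-pair pb₂ j' u (p' ∙ sym (assoc ∙ _ ▷ e₁u ∙ image))
          ... | v , _ , e₂v = v , (assoc ∙ e₁ ▷ e₂v ∙ e₁u)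

    opaque
      meet-exists : Σ (EqRel N) λ ρ → IsBoundedRel E (EqRel.r₁ ρ) (EqRel.r₂ ρ) ×
        (∀ {T} {x y : T ⇒ N} → EqRel._~_ ρ x y → (a ∘ x A.~ a ∘ y) × (b ∘ x B.~ b ∘ y)) ×
        (∀ {T} {x y : T ⇒ N} → a ∘ x A.~ a ∘ y → b ∘ x B.~ b ∘ y → EqRel._~_ ρ x y)
      meet-exists with meet-sub
      ... | M , m , mm , sm , elim , intro = record { equivRel = equivRel } ,
          ⟨⟩-bounded (S-resp-≈ (⊗-unique (sym π₁-β) (sym π₂-β)) sm) , down , up
        where
          down : ∀ {T} {x y : T ⇒ N} → (Σ (T ⇒ M) λ k → ((π₁ ∘ m) ∘ k ≈ x) × ((π₂ ∘ m) ∘ k ≈ y)) →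
                 (a ∘ x A.~ a ∘ y) × (b ∘ x B.~ b ∘ y)
          down (k , p , q) = elim (k , ⊗-unique (sym assoc ∙ p ∙ sym π₁-β) (sym assoc ∙ q ∙ sym π₂-β))

          up : ∀ {T} {x y : T ⇒ N} → a ∘ x A.~ a ∘ y → b ∘ x B.~ b ∘ y →
               Σ (T ⇒ M) λ k → ((π₁ ∘ m) ∘ k ≈ x) × ((π₂ ∘ m) ∘ k ≈ y)
          up r r' with intro r r'
          ... | k , p = k , (assoc ∙ π₁ ▷ p ∙ π₁-β) , (assoc ∙ π₂ ▷ p ∙ π₂-β)

          equivRel : IsEquivRel (π₁ ∘ m) (π₂ ∘ m)
          equivRel = mk-equivRel
            (λ g h p q → mm g h (⊗-unique (sym assoc ∙ p ∙ assoc) (sym assoc ∙ q ∙ assoc)))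
            (up (A.~-refl refl) (B.~-refl refl))
            (let (r , r') = down (id , identityʳ , identityʳ) in up (A.~-sym r) (B.~-sym r'))
            (λ k l p → let (r , r') = down (k , refl , refl)
                           (t , t') = down (l , sym p , refl)
                       in up (A.~-trans r t) (B.~-trans r' t'))

    -- Two uses: with `a` and `b` both equal to the underlying map of a morphism it yields the
    -- image, and on compatible pairs with the two projections it yields the pullback.
    meet : Ob
    meet = record { rel = proj₁ meet-exists ; bounded = proj₁ (proj₂ meet-exists) }

    opaque
      meet-elim : ∀ {T} {x y : T ⇒ N} → x ~[ meet ] y → (a ∘ x A.~ a ∘ y) × (b ∘ x B.~ b ∘ y)
      meet-elim = proj₁ (proj₂ (proj₂ meet-exists))

    opaque
      meet-intro : ∀ {T} {x y : T ⇒ N} → a ∘ x A.~ a ∘ y → b ∘ x B.~ b ∘ y → x ~[ meet ] y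
      meet-intro = proj₂ (proj₂ (proj₂ meet-exists))

  -- The objects yX and elements as morphisms

  opaque
    diagonal : ∀ X → IsEquivRel (id {X}) id
    diagonal X = mk-equivRel (λ g h p _ → sym identityˡ ∙ p ∙ identityˡ) (id , identityˡ , identityˡ)
      (id , identityˡ , identityˡ) (λ k l p → k , refl , p)

  yOb : Obj → Ob
  yOb X = record { rel = record { equivRel = diagonal X } ; bounded = λ p₁ p₂ prod u r r' → A9 prod u r r' }

  opaque
    y~⇒≈ : ∀ {X T} {x y : T ⇒ X} → x ~[ yOb X ] y → x ≈ y
    y~⇒≈ (k , p , q) = sym p ∙ q

  -- The morphism yT → A given by an element of A over T.
  opaque
    ŷ : ∀ {T} (A : Ob) → T ⇒ Ob.X A → Hom (yOb T) A
    ŷ A x = record { c = id ; c-cover = iso-cover id-iso ; f = x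
                   ; cong = λ u v r → Ob.~-refl A (x ▷ (sym identityˡ ∙ y~⇒≈ r ∙ identityˡ)) }

    ŷ-↦ : ∀ {T} (A : Ob) {x : T ⇒ Ob.X A} {S} {t : S ⇒ T} {z : S ⇒ Ob.X A} → x ∘ t ~[ A ] z → ŷ A x ⊢ t ↦ z
    ŷ-↦ A {x} r = maps λ s u p → Ob.~-trans A (Ob.~-refl A (x ▷ (sym identityˡ ∙ y~⇒≈ p) ∙ sym assoc)) (Ob.~-∘ A s r)

  opaque
    ŷ-↦⁻¹ : ∀ {T} (A : Ob) {x : T ⇒ Ob.X A} {S} {t : S ⇒ T} {z : S ⇒ Ob.X A} → ŷ A x ⊢ t ↦ z → x ∘ t ~[ A ] z
    ŷ-↦⁻¹ {T} A {x} p = functional (ŷ A x) (ŷ-↦ A (Ob.~-refl A refl)) p (Ob.~-refl (yOb T) refl)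

  opaque
    ŷ-cong : ∀ {T} (A : Ob) {x x' : T ⇒ Ob.X A} → x ~[ A ] x' → ŷ A x ≈ₕ ŷ A x'
    ŷ-cong A r = ≈-intro (iso-cover id-iso) (ŷ-↦ A (Ob.~-refl A refl))
      (ŷ-↦ A (Ob.~-resp A (sym identityʳ) (sym identityʳ) (Ob.~-sym A r)))

  opaque
    ŷ-reflect : ∀ {T} (A : Ob) {x x' : T ⇒ Ob.X A} → ŷ A x ≈ₕ ŷ A x' → x ~[ A ] x'
    ŷ-reflect A p = Ob.~-resp A identityʳ identityʳ (Ob.~-sym A (ŷ-↦⁻¹ A {t = id}
      (≈-apply p (ŷ-↦ A (Ob.~-refl A refl)))))

  opaque
    ŷ-apply : ∀ {T A B} (F : Hom A B) {x : T ⇒ Ob.X A} {y : T ⇒ Ob.X B} → F ⊢ x ↦ y → F ∘ₕ ŷ A x ≈ₕ ŷ B y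
    ŷ-apply {A = A} {B} F p = ≈-intro (iso-cover id-iso)
      (∘-↦ F (ŷ A _) (ŷ-↦ A (Ob.~-refl A refl)) (↦-∘ F id p)) (ŷ-↦ B (Ob.~-refl B refl))

  -- Monos as injections, covers as surjections, and images

  Injective : ∀ {A B} → Hom A B → Set (o ⊔ ℓ ⊔ e)
  Injective {A} {B} F = ∀ {T} {x x' : T ⇒ Ob.X A} {y y' : T ⇒ Ob.X B} →
    F ⊢ x ↦ y → F ⊢ x' ↦ y' → y ~[ B ] y' → x ~[ A ] x'

  Surjective : ∀ {A B} → Hom A B → Set (o ⊔ ℓ ⊔ e)
  Surjective {A} {B} F = Σ Obj λ T → Σ (T ⇒ Ob.X B) λ t → Cover t × Σ (T ⇒ Ob.X A) λ x → F ⊢ x ↦ t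

  opaque
    mono⇒injective : ∀ {A B} {F : Hom A B} → N.Mono F → Injective F
    mono⇒injective {A} {B} {F} mf {x = x} {x'} p p' r = ŷ-reflect A (mf (ŷ A x) (ŷ A x')
      (≈ₕ-trans (ŷ-apply F p) (≈ₕ-trans (ŷ-cong B r) (≈ₕ-sym (ŷ-apply F p')))))

  opaque
    injective⇒mono : ∀ {A B} {F : Hom A B} → Injective F → N.Mono F
    injective⇒mono {A} {B} {F} inj {Z} g h p with total-id g
    ... | T₁ , t₁ , ct₁ , x , gx with total h t₁
    ... | T₂ , t₂ , ct₂ , x' , hx' with total F (x ∘ t₂)
    ... | T₃ , t₃ , ct₃ , y , Fy with total F (x' ∘ t₃)
    ... | T₄ , t₄ , ct₄ , y' , Fy' = ≈-intro (cover-∘ (cover-∘ (cover-∘ ct₁ ct₂) ct₃) ct₄) g₄ (↦-resp h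
          (Ob.~-refl Z refl) (inj Fy' (↦-∘ F t₄ Fy) (functional (F ∘ₕ h) (∘-↦ F h h₄ Fy')
            (≈-apply p (∘-↦ F g g₄ (↦-∘ F t₄ Fy))) (Ob.~-refl Z refl))) h₄)
      where
        g₄ : g ⊢ ((t₁ ∘ t₂) ∘ t₃) ∘ t₄ ↦ ((x ∘ t₂) ∘ t₃) ∘ t₄
        g₄ = ↦-∘ g t₄ (↦-∘ g t₃ (↦-∘ g t₂ gx))
        h₄ : h ⊢ ((t₁ ∘ t₂) ∘ t₃) ∘ t₄ ↦ (x' ∘ t₃) ∘ t₄
        h₄ = ↦-∘ h t₄ (↦-∘ h t₃ hx')

  opaque
    -- The witness of surjectivity read backwards, as the map `x` out of the cover `t`, is the
    -- inverse; injectivity says that it respects the relations.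
    bijective⇒iso : ∀ {A B} {F : Hom A B} → Injective F → Surjective F → N.IsIso F
    bijective⇒iso {A} {B} {F} inj (T , t , ct , x , Fx) with lift ct (Hom.f F)
    ... | W , w , cw , v , tv = F⁻¹ ,
        ≈-intro (cover-∘ (Hom.c-cover F) cw) (∘-↦ F⁻¹ F Fw F⁻¹w) (idₕ-↦ (Ob.~-refl A refl)) ,
        ≈-intro ct (∘-↦ F F⁻¹ (↦-generic F⁻¹) Fx) (idₕ-↦ (Ob.~-refl B refl))
      where
        F⁻¹ : Hom B A
        F⁻¹ = record { c = t ; c-cover = ct ; f = x
                     ; cong = λ u v r → inj (↦-∘ F u Fx) (↦-∘ F v Fx) r }
        Fw : F ⊢ Hom.c F ∘ w ↦ Hom.f F ∘ w
        Fw = ↦-∘ F w (↦-generic F)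
        F⁻¹w : F⁻¹ ⊢ Hom.f F ∘ w ↦ Hom.c F ∘ w
        F⁻¹w = ↦-resp F⁻¹ (Ob.~-refl B tv) (inj (↦-∘ F v Fx) Fw (Ob.~-refl B tv)) (↦-∘ F⁻¹ v (↦-generic F⁻¹))

  opaque
    surjective-cancel : ∀ {A B D} {G : Hom B D} {F : Hom A B} {K : Hom A D} → K ≈ₕ G ∘ₕ F → Surjective K → Surjective G
    surjective-cancel {A} {B} {D} {G} {F} {K} r (T , t , ct , x , Kx) with total F x
    ... | T₁ , t₁ , ct₁ , y , Fy with total G y
    ... | T₂ , t₂ , ct₂ , z , Gz = T₂ , (t ∘ t₁) ∘ t₂ , cover-∘ (cover-∘ ct ct₁) ct₂ , y ∘ t₂ ,
      ↦-resp G (Ob.~-refl B refl) (functional (G ∘ₕ F) (∘-↦ G F (↦-∘ F t₂ Fy) Gz)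
        (↦-∘ (G ∘ₕ F) t₂ (↦-∘ (G ∘ₕ F) t₁ (≈-apply r Kx))) (Ob.~-refl A refl)) Gz

  opaque
    surjective⇒cover : ∀ {A B} {F : Hom A B} → Surjective F → N.Cover F
    surjective⇒cover {F = F} sf m g mm r = bijective⇒iso (mono⇒injective mm) (surjective-cancel r sf)

  opaque
    iso⇒surjective : ∀ {A B} {F : Hom A B} → N.IsIso F → Surjective F
    iso⇒surjective {B = B} {F} (G , _ , FG) = surjective-cancel (≈ₕ-sym FG)
      (Ob.X B , id , iso-cover id-iso , id , idₕ-↦ (Ob.~-refl B refl))

  opaque
    surjective-∘ : ∀ {A B D} {G : Hom B D} {F : Hom A B} → Surjective G → Surjective F → Surjective (G ∘ₕ F)
    surjective-∘ {B = B} {D} {G} {F} (T , t , ct , x , Gx) (T' , t' , ct' , x' , Fx') with lift ct' x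
    ... | W , w , cw , v , tv = W , t ∘ w , cover-∘ ct cw , x' ∘ v ,
      ∘-↦ G F (↦-∘ F v Fx') (↦-resp G (Ob.~-refl B (sym tv)) (Ob.~-refl D refl) (↦-∘ G w Gx))

  module Image {A B : Ob} (F : Hom A B) where
    open Hom F

    -- The image keeps the elements of the covering object `U` and compares them by their values in
    -- `B`, so its relation is pulled back from that of `B` and remains bounded.
    image : Ob
    image = meet B B f f

    opaque
      onto : Hom A image
      onto = record { c = c ; c-cover = c-cover ; f = id ; cong = λ u v r →
        meet-intro B B f f (Ob.~-resp B (f ▷ sym identityˡ) (f ▷ sym identityˡ) (cong u v r))
                           (Ob.~-resp B (f ▷ sym identityˡ) (f ▷ sym identityˡ) (cong u v r)) }

      onto-↦ : onto ⊢ c ↦ id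
      onto-↦ = ↦-generic onto

      inclusion : Hom image B
      inclusion = record { c = id ; c-cover = iso-cover id-iso ; f = f ; cong = λ u v r →
        Ob.~-resp B (f ▷ identityˡ) (f ▷ identityˡ) (proj₁ (meet-elim B B f f r)) }

      inclusion-↦ : ∀ {T} {x : T ⇒ U} → inclusion ⊢ x ↦ f ∘ x
      inclusion-↦ {x = x} = ↦-resp inclusion (Ob.~-refl image identityˡ) (Ob.~-refl B refl)
                              (↦-∘ inclusion x (↦-generic inclusion))

    opaque
      onto-surjective : Surjective onto
      onto-surjective = U , id , iso-cover id-iso , c , onto-↦

    opaque
      inclusion-injective : Injective inclusion
      inclusion-injective {x = x} {x'} p p' r = meet-intro B B f f r' r'
        where
          r' : f ∘ x ~[ B ] f ∘ x'
          r' = Ob.~-trans B (functional inclusion inclusion-↦ p (Ob.~-refl image refl))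
                 (Ob.~-trans B r (functional inclusion p' inclusion-↦ (Ob.~-refl image refl)))

    opaque
      factors : F ≈ₕ inclusion ∘ₕ onto
      factors = ≈-intro c-cover (↦-generic F) (∘-↦ inclusion onto onto-↦
        (↦-resp inclusion (Ob.~-refl image refl) (Ob.~-refl B identityʳ) inclusion-↦))

  opaque
    cover⇒surjective : ∀ {A B} {F : Hom A B} → N.Cover F → Surjective F
    cover⇒surjective {F = F} cf with cf inclusion onto (injective⇒mono inclusion-injective) factors
      where open Image F
    ... | iso with surjective-∘ (iso⇒surjective iso) (Image.onto-surjective F)
    ... | T , t , ct , x , p = T , t , ct , x , ≈-apply (≈ₕ-sym (Image.factors F)) p

  opaque
    factor-ex : ∀ {A B} (F : Hom A B) → Σ Ob λ M → Σ (Hom A M) λ c → Σ (Hom M B) λ m →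
                N.Cover c × N.Mono m × (F ≈ₕ m ∘ₕ c)
    factor-ex F = image , onto , inclusion , surjective⇒cover onto-surjective , injective⇒mono inclusion-injective , factors
      where open Image F

  opaque
    y-terminal : N.IsTerminal (yOb ⊤)
    y-terminal A = k , uniq
      where
        k : Hom A (yOb ⊤)
        k = record { c = id ; c-cover = iso-cover id-iso ; f = ! ; cong = λ u v r → Ob.~-refl (yOb ⊤) !-unique }
        uniq : ∀ (h : Hom A (yOb ⊤)) → h ≈ₕ k
        uniq h = mk≈ (↦-resp k (Ob.~-refl A identityˡ) (Ob.~-refl (yOb ⊤) !-unique) (↦-∘ k (Hom.c h) (↦-generic k)))

  -- Pullbacks and stability of covers

  module Pullback {A B D : Ob} (F : Hom A D) (G : Hom B D) where
    private
      module A = Ob A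
      module B = Ob B
      module D = Ob D
      module F = Hom F
      module G = Hom G

    opaque
      pairs : Σ Obj λ N → Σ (N ⇒ F.U) λ n₁ → Σ (N ⇒ G.U) λ n₂ → (F.f ∘ n₁ D.~ G.f ∘ n₂) ×
        (∀ {T} (u : T ⇒ F.U) (v : T ⇒ G.U) → F.f ∘ u D.~ G.f ∘ v → Σ (T ⇒ N) λ w → (n₁ ∘ w ≈ u) × (n₂ ∘ w ≈ v))
      pairs with pullback ⟨ D.r₁ , D.r₂ ⟩ ⟨ F.f ∘ π₁ , G.f ∘ π₂ ⟩
      ... | N , k , n , pb = N , π₁ ∘ n , π₂ ∘ n ,
          D.⊑⇒~ (k , (pb-comm pb ∙ ⊗-unique (pull π₁-β ∙ assoc ∙ sym π₁-β) (pull π₂-β ∙ assoc ∙ sym π₂-β))) , univ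
        where
          univ : ∀ {T} (u : T ⇒ F.U) (v : T ⇒ G.U) → F.f ∘ u D.~ G.f ∘ v →
                 Σ (T ⇒ N) λ w → ((π₁ ∘ n) ∘ w ≈ u) × ((π₂ ∘ n) ∘ w ≈ v)
          univ u v r with D.~⇒⊑ r
          ... | j , p with pb-pair pb j ⟨ u , v ⟩ (p ∙ ⊗-unique
                  (π₁-β ∙ F.f ▷ sym π₁-β ∙ sym assoc ∙ push π₁-β) (π₂-β ∙ G.f ▷ sym π₂-β ∙ sym assoc ∙ push π₂-β))
          ... | w , _ , nw = w , (assoc ∙ π₁ ▷ nw ∙ π₁-β) , (assoc ∙ π₂ ▷ nw ∙ π₂-β)

    N₀ : Obj
    N₀ = proj₁ pairs

    a : N₀ ⇒ A.X
    a = F.c ∘ proj₁ (proj₂ pairs)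

    b : N₀ ⇒ B.X
    b = G.c ∘ proj₁ (proj₂ (proj₂ pairs))

    P : Ob
    P = meet A B a b

    opaque
      p : Hom P A
      p = record { c = id ; c-cover = iso-cover id-iso ; f = a ; cong = λ u v r →
        A.~-resp (a ▷ identityˡ) (a ▷ identityˡ) (proj₁ (meet-elim A B a b r)) }

      p-↦ : ∀ {T} {x : T ⇒ N₀} → p ⊢ x ↦ a ∘ x
      p-↦ {x = x} = ↦-resp p (Ob.~-refl P identityˡ) (A.~-refl refl) (↦-∘ p x (↦-generic p))

      q : Hom P B
      q = record { c = id ; c-cover = iso-cover id-iso ; f = b ; cong = λ u v r →
        B.~-resp (b ▷ identityˡ) (b ▷ identityˡ) (proj₂ (meet-elim A B a b r)) }

      q-↦ : ∀ {T} {x : T ⇒ N₀} → q ⊢ x ↦ b ∘ x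
      q-↦ {x = x} = ↦-resp q (Ob.~-refl P identityˡ) (B.~-refl refl) (↦-∘ q x (↦-generic q))

    opaque
      is-pullback : N.IsPullback p q F G
      is-pullback = comm , univ
        where
          n₁ : N₀ ⇒ F.U
          n₁ = proj₁ (proj₂ pairs)
          n₂ : N₀ ⇒ G.U
          n₂ = proj₁ (proj₂ (proj₂ pairs))

          comm : F ∘ₕ p ≈ₕ G ∘ₕ q
          comm = ≈-intro (iso-cover id-iso)
            (∘-↦ F p p-↦ (↦-resp F (A.~-refl (sym identityʳ)) (D.~-refl refl) (↦-∘ F n₁ (↦-generic F))))
            (↦-resp (G ∘ₕ q) (Ob.~-refl P refl) (D.~-sym (proj₁ (proj₂ (proj₂ (proj₂ pairs)))))
              (∘-↦ G q q-↦ (↦-resp G (B.~-refl (sym identityʳ)) (D.~-refl refl) (↦-∘ G n₂ (↦-generic G)))))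

          elements : ∀ {Z : Ob} (f : Hom Z A) (g : Hom Z B) → F ∘ₕ f ≈ₕ G ∘ₕ g →
            Σ Obj λ T → Σ (T ⇒ Ob.X Z) λ t → Cover t × Σ (T ⇒ N₀) λ w → (f ⊢ t ↦ a ∘ w) × (g ⊢ t ↦ b ∘ w)
          elements {Z} f g r with total-id f
          ... | T₁ , t₁ , ct₁ , x , fx with total g t₁
          ... | T₂ , t₂ , ct₂ , y , gy with lift₂ F.c-cover G.c-cover (x ∘ t₂) y
          ... | T₃ , t₃ , ct₃ , u , v , cu , cv with proj₂ (proj₂ (proj₂ (proj₂ pairs))) u v
                (functional (G ∘ₕ g) (≈-apply r (∘-↦ F f fu (↦-∘ F u (↦-generic F))))
                  (∘-↦ G g gv (↦-∘ G v (↦-generic G))) (Ob.~-refl Z refl))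
            where
              fu : f ⊢ (t₁ ∘ t₂) ∘ t₃ ↦ F.c ∘ u
              fu = ↦-resp f (Ob.~-refl Z refl) (A.~-refl (sym cu)) (↦-∘ f t₃ (↦-∘ f t₂ fx))
              gv : g ⊢ (t₁ ∘ t₂) ∘ t₃ ↦ G.c ∘ v
              gv = ↦-resp g (Ob.~-refl Z refl) (B.~-refl (sym cv)) (↦-∘ g t₃ gy)
          ... | w , n₁w , n₂w = T₃ , (t₁ ∘ t₂) ∘ t₃ , cover-∘ (cover-∘ ct₁ ct₂) ct₃ , w ,
            ↦-resp f (Ob.~-refl Z refl) (A.~-refl (sym cu ∙ F.c ▷ sym n₁w ∙ sym assoc)) (↦-∘ f t₃ (↦-∘ f t₂ fx)) ,
            ↦-resp g (Ob.~-refl Z refl) (B.~-refl (sym cv ∙ G.c ▷ sym n₂w ∙ sym assoc)) (↦-∘ g t₃ gy)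

          univ : ∀ {Z} (f : Hom Z A) (g : Hom Z B) → F ∘ₕ f ≈ₕ G ∘ₕ g →
            Σ (Hom Z P) λ u → (p ∘ₕ u ≈ₕ f) × (q ∘ₕ u ≈ₕ g) ×
              (∀ (u' : Hom Z P) → p ∘ₕ u' ≈ₕ f → q ∘ₕ u' ≈ₕ g → u' ≈ₕ u)
          univ {Z} f g r with elements f g r
          ... | T , t , ct , w , ft , gt = h , ≈-intro ct (∘-↦ p h (↦-generic h) p-↦) ft ,
              ≈-intro ct (∘-↦ q h (↦-generic h) q-↦) gt , uniq
            where
              h : Hom Z P
              h = record { c = t ; c-cover = ct ; f = w ; cong = λ u v s → meet-intro A B a b
                (A.~-resp assoc assoc (functional f (↦-∘ f u ft) (↦-∘ f v ft) s))
                (B.~-resp assoc assoc (functional g (↦-∘ g u gt) (↦-∘ g v gt) s)) }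

              uniq : ∀ (u' : Hom Z P) → p ∘ₕ u' ≈ₕ f → q ∘ₕ u' ≈ₕ g → u' ≈ₕ h
              uniq u' pu qu with total u' t
              ... | T' , t' , ct' , z , uz = ≈-intro (cover-∘ ct ct') uz (↦-resp h (Ob.~-refl Z refl)
                (meet-intro A B a b
                  (A.~-resp assoc refl (functional f (↦-∘ f t' ft) (≈-apply pu (∘-↦ p u' uz p-↦)) (Ob.~-refl Z refl)))
                  (B.~-resp assoc refl (functional g (↦-∘ g t' gt) (≈-apply qu (∘-↦ q u' uz q-↦)) (Ob.~-refl Z refl))))
                (↦-∘ h t' (↦-generic h)))

  opaque
    -- The value of `g` at a generic element of `B` has a local preimage under `f`. The universal
    -- property turns this pair into a morphism to `P` whose composite with `q` is surjective.
    stable : ∀ {P A B D} {p : Hom P A} {q : Hom P B} {f : Hom A D} {g : Hom B D} →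
      N.IsPullback p q f g → N.Cover f → N.Cover q
    stable {A = A} {B} {D} {p} {q} {f} {g} (_ , univ) cf with total-id g | cover⇒surjective cf
    ... | T , t , ct , d , gd | T₁ , t₁ , ct₁ , x , fx with lift ct₁ d
    ... | W , w , cw , v , tv with univ (ŷ A (x ∘ v)) (ŷ B (t ∘ w))
            (≈ₕ-trans (ŷ-apply f (↦-∘ f v fx)) (≈ₕ-trans (ŷ-cong D (Ob.~-refl D tv)) (≈ₕ-sym (ŷ-apply g (↦-∘ g w gd)))))
    ... | u , _ , qu , _ = surjective⇒cover (surjective-cancel (≈ₕ-sym qu)
      (W , t ∘ w , cover-∘ ct cw , id , ŷ-↦ B (Ob.~-refl B identityʳ)))

  regular : IsRegular C̄
  regular = record
    { terminal = yOb ⊤ , y-terminal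
    ; pullback = λ F G → Pullback.P F G , Pullback.p F G , Pullback.q F G , Pullback.is-pullback F G
    ; factor = factor-ex ; cover-stable = stable }

  -- Verification of the abstract properties of y

  opaque
    y-id : ∀ {X} → ŷ (yOb X) id ≈ₕ idₕ
    y-id {X} = ≈-intro (iso-cover id-iso) (ŷ-↦ (yOb X) (Ob.~-refl (yOb X) refl))
      (idₕ-↦ (Ob.~-refl (yOb X) (sym identityʳ)))

  opaque
    y-∘ : ∀ {A B D} {f : A ⇒ B} {g : B ⇒ D} → ŷ (yOb D) (g ∘ f) ≈ₕ ŷ (yOb D) g ∘ₕ ŷ (yOb B) f
    y-∘ {D = D} {f} {g} = ≈ₕ-sym (ŷ-apply (ŷ (yOb D) g) (ŷ-↦ (yOb D) (Ob.~-refl (yOb D) refl)))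

  Y : Functor cat C̄
  Y = record { F₀ = yOb ; F₁ = λ {A} {B} f → ŷ (yOb B) f ; identity = y-id ; homomorphism = y-∘
             ; F-resp-≈ = λ {A} {B} p → ŷ-cong (yOb B) (Ob.~-refl (yOb B) p) }

  opaque
    -- In `yOb B` related elements are equal, so the underlying map of `g` is constant on the fibres
    -- of its cover and descends to `A`.
    full : ∀ {A B} (g : Hom (yOb A) (yOb B)) → Σ (A ⇒ B) λ f → ŷ (yOb B) f ≈ₕ g
    full {A} {B} g with descend g.f g.c-cover (λ u v r → y~⇒≈ (g.cong u v (Ob.~-refl (yOb A) r)))
      where module g = Hom g
    ... | k , kc = k , ≈-intro (Hom.c-cover g) (ŷ-↦ (yOb B) (Ob.~-refl (yOb B) kc)) (↦-generic g)

  opaque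
    y-cover : ∀ {A B} {f : A ⇒ B} → Cover f → N.Cover (ŷ (yOb B) f)
    y-cover {A} {B} {f} cf = surjective⇒cover (A , f , cf , id , ŷ-↦ (yOb B) (Ob.~-refl (yOb B) identityʳ))

  opaque
    q-cover : ∀ A → N.Cover (ŷ A id)
    q-cover A = surjective⇒cover (Ob.X A , id , iso-cover id-iso , id , ŷ-↦ A (Ob.~-refl A identityʳ))

  opaque
    -- Two elements of `A.X` have the same class exactly when a witness in `A.R` exists. Such a
    -- witness is determined by its endpoints, and in `yOb` these are fixed up to equality, so local
    -- witnesses define a morphism.
    q-kernel : ∀ A → N.IsPullback (ŷ (yOb (Ob.X A)) (Ob.r₁ A)) (ŷ (yOb (Ob.X A)) (Ob.r₂ A)) (ŷ A id) (ŷ A id)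
    q-kernel A = comm , univ
      where
        module A = Ob A
        yX : Ob
        yX = yOb A.X
        q-↦ : ∀ {T} {x y : T ⇒ A.X} → x A.~ y → ŷ A id ⊢ x ↦ y
        q-↦ r = ŷ-↦ A (A.~-resp (sym identityˡ) refl r)
        q-↦⁻¹ : ∀ {T} {x y : T ⇒ A.X} → ŷ A id ⊢ x ↦ y → x A.~ y
        q-↦⁻¹ r = A.~-resp identityˡ refl (ŷ-↦⁻¹ A r)

        comm : ŷ A id ∘ₕ ŷ yX A.r₁ ≈ₕ ŷ A id ∘ₕ ŷ yX A.r₂
        comm = ≈ₕ-trans (ŷ-apply (ŷ A id) (q-↦ (id , identityʳ , identityʳ)))
                        (≈ₕ-sym (ŷ-apply (ŷ A id) (q-↦ (A.~-refl refl))))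

        univ : ∀ {Z} (a b : Hom Z yX) → ŷ A id ∘ₕ a ≈ₕ ŷ A id ∘ₕ b →
          Σ (Hom Z (yOb A.R)) λ u → (ŷ yX A.r₁ ∘ₕ u ≈ₕ a) × (ŷ yX A.r₂ ∘ₕ u ≈ₕ b) ×
            (∀ (u' : Hom Z (yOb A.R)) → ŷ yX A.r₁ ∘ₕ u' ≈ₕ a → ŷ yX A.r₂ ∘ₕ u' ≈ₕ b → u' ≈ₕ u)
        univ {Z} a b r with total-id a
        ... | T₁ , t₁ , ct₁ , x , ax with total b t₁
        ... | T₂ , t₂ , ct₂ , y , by' with q-↦⁻¹ (≈-apply-q (↦-∘ a t₂ ax) by')
          where
            ≈-apply-q : ∀ {T} {t : T ⇒ Ob.X Z} {x y : T ⇒ A.X} → a ⊢ t ↦ x → b ⊢ t ↦ y → ŷ A id ⊢ x ↦ y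
            ≈-apply-q p p' = q-↦ (functional (ŷ A id ∘ₕ b) (≈-apply r (∘-↦ (ŷ A id) a p (q-↦ (A.~-refl refl))))
              (∘-↦ (ŷ A id) b p' (q-↦ (A.~-refl refl))) (Ob.~-refl Z refl))
        ... | k , r₁k , r₂k = h ,
            ≈-intro (cover-∘ ct₁ ct₂) (∘-↦ (ŷ yX A.r₁) h (↦-generic h) (ŷ-↦ yX (Ob.~-refl yX r₁k))) (↦-∘ a t₂ ax) ,
            ≈-intro (cover-∘ ct₁ ct₂) (∘-↦ (ŷ yX A.r₂) h (↦-generic h) (ŷ-↦ yX (Ob.~-refl yX r₂k))) by' , uniq
          where
            h : Hom Z (yOb A.R)
            h = record { c = t₁ ∘ t₂ ; c-cover = cover-∘ ct₁ ct₂ ; f = k ; cong = λ u v s → Ob.~-refl (yOb A.R)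
              (proj₁ A.equivRel (k ∘ u) (k ∘ v)
                (pull r₁k ∙ y~⇒≈ (functional a (↦-∘ a u (↦-∘ a t₂ ax)) (↦-∘ a v (↦-∘ a t₂ ax)) s) ∙ push r₁k)
                (pull r₂k ∙ y~⇒≈ (functional b (↦-∘ b u by') (↦-∘ b v by') s) ∙ push r₂k)) }

            uniq : ∀ (u' : Hom Z (yOb A.R)) → ŷ yX A.r₁ ∘ₕ u' ≈ₕ a → ŷ yX A.r₂ ∘ₕ u' ≈ₕ b → u' ≈ₕ h
            uniq u' p p' with total u' (t₁ ∘ t₂)
            ... | T , t , ct , z , uz = ≈-intro (cover-∘ (cover-∘ ct₁ ct₂) ct) uz (↦-resp h (Ob.~-refl Z refl)
              (Ob.~-refl (yOb A.R) (proj₁ A.equivRel (k ∘ t) z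
                (pull r₁k ∙ y~⇒≈ (functional a (↦-∘ a t (↦-∘ a t₂ ax))
                  (≈-apply p (∘-↦ (ŷ yX A.r₁) u' uz (ŷ-↦ yX (Ob.~-refl yX refl)))) (Ob.~-refl Z refl)))
                (pull r₂k ∙ y~⇒≈ (functional b (↦-∘ b t by')
                  (≈-apply p' (∘-↦ (ŷ yX A.r₂) u' uz (ŷ-↦ yX (Ob.~-refl yX refl)))) (Ob.~-refl Z refl)))))
              (↦-∘ h t (↦-generic h)))

  envelope : Envelope
  envelope = record
    { E = E ; C̄ = C̄ ; regular = regular ; Y = Y ; y-full = full
    ; y-faithful = λ {A} {B} p → y~⇒≈ (ŷ-reflect (yOb B) p) ; y-cover = y-cover
    ; present = λ A → record { rel = Ob.rel A ; bounded = Ob.bounded A ; q = ŷ A id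
                             ; q-cover = q-cover A ; q-kernel = q-kernel A }
    ; effective = λ rel bd → record { rel = rel ; bounded = bd } ,
        ŷ (record { rel = rel ; bounded = bd }) id , q-cover _ , q-kernel _ }

theorem5p2 : ∀ {o ℓ e s : Level} (E : CatWithSmallMaps o ℓ e s) → ExactCompletionWithProperties E
theorem5p2 E = record
  { completion = record
    { Ē = V.Ē ; Ē-exact = V.Ē-exact ; y = V.yMorphism
    ; universal = λ F → Extension.precompEquivalence envelope (record { structure = F }) }
  ; fully-faithful = V.y-full , (λ f g → V.y-faithful)
  ; covering = λ A → V.P.X A , V.P.q A , V.P.q-cover A
  ; sub-bijection = λ X → (λ m n _ _ p q → V.y-⊑-reflect p , V.y-⊑-reflect q) , V.sub-rep
  -- Being covered by the image of a small map is how smallness in Ē was defined, so both directions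
  -- are identities.
  ; small-characterisation = λ f → (λ s → s) , (λ s → s) }
  where
    envelope : Envelope
    envelope = Completion.envelope (record { structure = E })
    module V = EnvelopeTheory envelope
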